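{- Let $\Gamma$ be a group with a linear representation $\rho:\Gamma\to GL(\mathbb{F}^d)$ over a field $\mathbb{F}$, let $1\le k\le d$, and let $(G=(V,E),\psi)$ be a finite $\Gamma$-gain graph. Then there exist vectors $\{p_{e,i}\in\mathbb{K}^d\mid e\in E,1\le i\le k\}$ such that the linear matroid on $E$ represented by $e\mapsto\hat x^{(k)}_{e,\psi}$ equals $\mathbf M(f_{\rho^{(k)}})$; that is, for every $F\subseteq E$, the family $\{\hat x^{(k)}_{e,\psi}\mid e\in F\}$ is linearly independent over $\mathbb{K}$ if and only if $|X|\le f_{\rho^{(k)}}(X)$ for every nonempty $X\subseteq F$.
   Context: $\mathbb{K}$ is an extension field of $\mathbb{F}$ containing sufficiently many elements algebraically independent over $\mathbb{F}$. $\bigwedge^k\mathbb{K}^d$ is the $k$-th exterior power; $\rho^{(k)}:\Gamma\to GL(\bigwedge^k\mathbb{F}^d)$ is the representation with $\rho^{(k)}(\gamma)(v_1\wedge\cdots\wedge v_k)=\rho(\gamma)v_1\wedge\cdots\wedge\rho(\gamma)v_k$. Let $D=\binom dk$. A $\Gamma$-gain graph: $G$ finite directed graph (loops, parallel edges allowed), $\psi:E\to\Gamma$, $\psi_e=\psi(e)$, reversing an edge inverts its gain; walk gains are ordered products with inverses for backward edges. For connected $X\subseteq E$, $\langle X\rangle$ = subgroup of gains of closed walks at a vertex of $V(X)$ using only edges of $X$. $V(F)$, $C(F)$ (edge sets of connected components of $(V(F),F)$), $c(F)=|C(F)|$. $d_{\rho^{(k)}}(Y)=\dim_{\mathbb{F}}\operatorname{span}\{\operatorname{image}(\rho^{(k)}(\gamma)-I_D)\mid\gamma\in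 Y\}$ for $Y\subseteq\Gamma$, and $f_{\rho^{(k)}}(F)=D|V(F)|-D\,c(F)+\sum_{X\in C(F)}d_{\rho^{(k)}}(\langle X\rangle)$. $\hat x^{(k)}_{e,\psi}\in(\bigwedge^k\mathbb{K}^d)^V$: for a non-loop edge $e$ from $i$ to $j$, $\hat x(i)=-\rho(\psi_e)p_{e,1}\wedge\cdots\wedge\rho(\psi_e)p_{e,k}$, $\hat x(j)=p_{e,1}\wedge\cdots\wedge p_{e,k}$, $\hat x(v)=0$ otherwise; for a loop $e$ at $i$, $\hat x(i)=\rho(\psi_e)p_{e,1}\wedge\cdots\wedge\rho(\psi_e)p_{e,k}-p_{e,1}\wedge\cdots\wedge p_{e,k}$, $\hat x(v)=0$ otherwise. -}

module Defs where

open import Level using (Level; _⊔_) renaming (suc to lsuc)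
open import Algebra.Bundles using (CommutativeRing; Group)
open import Algebra.Morphism.Structures using (module RingMorphisms)
open import Data.Nat as ℕ using (ℕ; zero; suc)
open import Data.Fin using (Fin; zero; suc; punchIn; _≟_)
open import Data.Fin.Properties using (any?)
open import Data.Fin.Subset using (Subset; _∈_; _∉_; _⊆_; ∣_∣; Nonempty)
open import Data.Fin.Subset.Properties using (_∈?_)
open import Data.Vec using (tabulate)
open import Data.List using (List; []; _∷_; [_]; map; _++_; length; lookup; foldr)
open import Data.List.Relation.Unary.All using (All)
open import Data.List.Relation.Unary.AllPairs using (AllPairs)
open import Data.Product using (Σ; ∃; ∃-syntax; Σ-syntax; _×_; _,_; proj₁; proj₂)
open import Data.Product.Relation.Unary.All using ()
open import Data.Sum using (_⊎_)
open import Data.Bool using (Bool; true; false; if_then_else_)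
open import Relation.Nullary using (¬_; Dec; yes; no)
open import Relation.Nullary.Decidable using (⌊_⌋; _×-dec_; _⊎-dec_)
open import Relation.Unary using (Pred)
open import Relation.Binary.PropositionalEquality using (_≡_; _≢_)
open import Function using (_∘_)

record Field (c ℓ : Level) : Set (lsuc (c ⊔ ℓ)) where
  field
    commutativeRing : CommutativeRing c ℓ
  open CommutativeRing commutativeRing public
  field
    1≉0     : ¬ (1# ≈ 0#)
    inverse : ∀ x → ¬ (x ≈ 0#) → ∃[ y ] (x * y ≈ 1#)

-- A field extension K of F, given by a (necessarily injective) ring
-- homomorphism ι : F → K.
IsFieldEmbedding : ∀ {c₁ ℓ₁ c₂ ℓ₂} (F : Field c₁ ℓ₁) (K : Field c₂ ℓ₂) →
                   (Field.Carrier F → Field.Carrier K) → Set _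
IsFieldEmbedding F K ι =
  RingMorphisms.IsRingHomomorphism (Field.rawRing F) (Field.rawRing K) ι

-- Strictly increasing maps Fin k → Fin d, i.e. the k-subsets of Fin d,
-- listed once each.  They index the standard basis e_{t₁}∧⋯∧e_{t_k}
-- (t₁ < ⋯ < t_k) of the k-th exterior power.

combos : (k d : ℕ) → List (Fin k → Fin d)
combos zero    d       = [ (λ ()) ]
combos (suc k) zero    = []
combos (suc k) (suc d) =
  map (λ g → λ { zero → zero ; (suc a) → suc (g a) }) (combos k d)
  ++ map (λ g → suc ∘ g) (combos (suc k) d)

Dim : (k d : ℕ) → ℕ
Dim k d = length (combos k d)

basisIdx : ∀ {k d} → Fin (Dim k d) → Fin k → Fin d
basisIdx {k} {d} = lookup (combos k d)

sumℕ : ∀ n → (Fin n → ℕ) → ℕ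
sumℕ zero    f = 0
sumℕ (suc n) f = f zero ℕ.+ sumℕ n (f ∘ suc)

module LinAlg {c ℓ} (R : CommutativeRing c ℓ) where
  open CommutativeRing R using (Carrier; _≈_; _+_; _*_; -_; 0#; 1#)

  sumFin : ∀ n → (Fin n → Carrier) → Carrier
  sumFin zero    f = 0#
  sumFin (suc n) f = f zero + sumFin n (f ∘ suc)

  sumList : List Carrier → Carrier
  sumList = foldr _+_ 0#

  prodFin : ∀ n → (Fin n → Carrier) → Carrier
  prodFin zero    f = 1#
  prodFin (suc n) f = f zero * prodFin n (f ∘ suc)

  pow : Carrier → ℕ → Carrier
  pow x zero    = 1#
  pow x (suc e) = x * pow x e

  Mat : ℕ → ℕ → Set c
  Mat m n = Fin m → Fin n → Carrier

  I : ∀ {n} → Mat n n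
  I i j = if ⌊ i ≟ j ⌋ then 1# else 0#

  _·_ : ∀ {m n o} → Mat m n → Mat n o → Mat m o
  (A · B) i j = sumFin _ (λ l → A i l * B l j)

  _·v_ : ∀ {m n} → Mat m n → (Fin n → Carrier) → Fin m → Carrier
  (A ·v v) i = sumFin _ (λ j → A i j * v j)

  alt : ∀ {n} → Fin n → Carrier → Carrier
  alt zero    x = x
  alt (suc j) x = - alt j x

  det : ∀ n → Mat n n → Carrier
  det zero    M = 1#
  det (suc n) M =
    sumFin (suc n) (λ j → alt j (M zero j * det n (λ r s → M (suc r) (punchIn j s))))

  -- ⋀^k R^d in coordinates w.r.t. the basis e_T (T ∈ combos k d)
  Ext : ℕ → ℕ → Set c
  Ext k d = Fin (Dim k d) → Carrier

  wedge : ∀ {k d} → (Fin k → Fin d → Carrier) → Ext k d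
  wedge {k} p S = det k (λ a b → p b (basisIdx S a))

  -- matrix of A^{(k)} : v₁∧⋯∧v_k ↦ Av₁∧⋯∧Av_k  (k-th compound matrix)
  compound : ∀ k {d} → Mat d d → Mat (Dim k d) (Dim k d)
  compound k A S T = det k (λ a b → A (basisIdx S a) (basisIdx T b))

  LinIndep : ∀ {D n} → (Fin n → Fin D → Carrier) → Set (c ⊔ ℓ)
  LinIndep {D} {n} b =
    ∀ (co : Fin n → Carrier) →
    (∀ i → sumFin n (λ j → co j * b j i) ≈ 0#) → ∀ j → co j ≈ 0#

  InSpanFam : ∀ {D n} → (Fin n → Fin D → Carrier) → (Fin D → Carrier) → Set (c ⊔ ℓ)
  InSpanFam {D} {n} b u = Σ (Fin n → Carrier) λ co → (∀ i → u i ≈ sumFin n (λ j → co j * b j i))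

  InSpan : ∀ {D p} → Pred (Fin D → Carrier) p → (Fin D → Carrier) → Set (c ⊔ ℓ ⊔ p)
  InSpan {D} S u =
    Σ (List (Carrier × (Fin D → Carrier))) λ L → (All (λ (x : Carrier × (Fin D → Carrier)) → S (proj₂ x)) L ×
            (∀ i → u i ≈ sumList (map (λ (x : Carrier × (Fin D → Carrier)) → proj₁ x * proj₂ x i) L)))

  HasDim : ∀ {D p} → Pred (Fin D → Carrier) p → ℕ → Set (c ⊔ ℓ ⊔ p)
  HasDim {D} S n =
    Σ (Fin n → Fin D → Carrier) λ b → ((∀ j → InSpan S (b j)) × LinIndep {D} {n} b × (∀ u → S u → InSpanFam b u))

module _ {c₁ ℓ₁ c₂ ℓ₂} (F : Field c₁ ℓ₁) (K : Field c₂ ℓ₂)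
         (ι : Field.Carrier F → Field.Carrier K) where
  private
    module F = Field F
    module K = Field K
    module LK = LinAlg K.commutativeRing

  AlgIndep : ∀ {N} → (Fin N → K.Carrier) → Set (c₁ ⊔ ℓ₁ ⊔ ℓ₂)
  AlgIndep {N} t =
    ∀ (L : List (F.Carrier × (Fin N → ℕ))) →
    AllPairs (λ x y → ∃[ i ] (proj₂ x i ≢ proj₂ y i)) L →
    LK.sumList (map (λ x → ι (proj₁ x) K.* LK.prodFin N (λ i → LK.pow (t i) (proj₂ x i))) L) K.≈ K.0# →
    All (λ x → proj₁ x F.≈ F.0#) L

module _ {a b c ℓ} (Γ : Group a b) (F : Field c ℓ) (d : ℕ) where
  private
    module Γ = Group Γ
    module F = Field F
    open LinAlg F.commutativeRing

  record IsRepresentation (ρ : Γ.Carrier → Mat d d) : Set (a ⊔ b ⊔ c ⊔ ℓ) where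
    field
      cong : ∀ {x y} → x Γ.≈ y → ∀ i j → ρ x i j F.≈ ρ y i j
      hom  : ∀ x y i j → ρ (x Γ.∙ y) i j F.≈ (ρ x · ρ y) i j
      unit : ∀ i j → ρ Γ.ε i j F.≈ I i j

module GainGraph {a b} (Γ : Group a b) {n m : ℕ}
                 (src tgt : Fin m → Fin n) (ψ : Fin m → Group.Carrier Γ) where
  open Group Γ using (Carrier; _≈_; _∙_; ε; _⁻¹)

  data Walk (X : Subset m) : Fin n → Fin n → Set where
    []  : ∀ {v} → Walk X v v
    fwd : ∀ e {w} → e ∈ X → Walk X (tgt e) w → Walk X (src e) w
    bwd : ∀ e {w} → e ∈ X → Walk X (src e) w → Walk X (tgt e) w

  gain : ∀ {X u v} → Walk X u v → Carrier
  gain []          = ε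
  gain (fwd e _ w) = ψ e ∙ gain w
  gain (bwd e _ w) = ψ e ⁻¹ ∙ gain w

  ⟨_⟩at : Subset m → Fin n → Pred Carrier b
  ⟨ X ⟩at v = λ γ → ∃[ w ] (γ ≈ gain {X} {v} {v} w)

  V : Subset m → Subset n
  V X = tabulate (λ v → ⌊ any? (λ e → (e ∈? X) ×-dec ((src e ≟ v) ⊎-dec (tgt e ≟ v))) ⌋)

  Connected : Subset m → Set
  Connected X = ∀ u v → u ∈ V X → v ∈ V X → Walk X u v

  record Components (X : Subset m) (c : ℕ) : Set where
    field
      comp      : Fin c → Subset m
      base      : Fin c → Fin n
      base∈     : ∀ i → base i ∈ V (comp i)
      nonempty  : ∀ i → Nonempty (comp i)
      connected : ∀ i → Connected (comp i)
      sub       : ∀ i → comp i ⊆ X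
      cover     : ∀ e → e ∈ X → ∃[ i ] (e ∈ comp i)
      disjoint  : ∀ i j → i ≢ j → ∀ v → v ∈ V (comp i) → v ∉ V (comp j)

module Setting {a b c₁ ℓ₁ c₂ ℓ₂} (Γ : Group a b) (F : Field c₁ ℓ₁) (K : Field c₂ ℓ₂)
               (ι : Field.Carrier F → Field.Carrier K)
               (d : ℕ) (ρ : Group.Carrier Γ → LinAlg.Mat (Field.commutativeRing F) d d)
               (k : ℕ) {n m : ℕ} (src tgt : Fin m → Fin n) (ψ : Fin m → Group.Carrier Γ) where
  private
    module Γ = Group Γ
    module F = Field F
    module K = Field K
    module LF = LinAlg F.commutativeRing
    module LK = LinAlg K.commutativeRing
  open GainGraph Γ src tgt ψ public

  D : ℕ
  D = Dim k d

  ImageUnion : ∀ {p} → Pred Γ.Carrier p → Pred (LF.Ext k d) (a ⊔ c₁ ⊔ ℓ₁ ⊔ p)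
  ImageUnion Y u =
    ∃[ γ ] (Y γ × ∃[ w ] (∀ S → u S F.≈ (LF.compound k (ρ γ) LF.·v w) S F.- w S))

  dρ≡ : ∀ {p} → Pred Γ.Carrier p → ℕ → Set _
  dρ≡ Y r = LF.HasDim (ImageUnion Y) r

  fρ≡ : Subset m → ℕ → Set _
  fρ≡ X r =
    ∃[ c ] Σ (Components X c) λ C →
      ∃[ ds ] ((∀ i → dρ≡ (⟨ Components.comp C i ⟩at (Components.base C i)) (ds i)) ×
               r ≡ (D ℕ.* ∣ V X ∣ ℕ.∸ D ℕ.* c) ℕ.+ sumℕ c ds)

  Points : Set c₂
  Points = Fin m → Fin k → Fin d → K.Carrier

  ρK : Fin m → LK.Mat d d
  ρK e i j = ι (ρ (ψ e) i j)

  xhat : Points → Fin m → Fin n → LK.Ext k d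
  xhat p e v S with src e ≟ tgt e
  ... | yes _ = if ⌊ v ≟ src e ⌋
                  then LK.wedge (λ i → ρK e LK.·v p e i) S K.- LK.wedge (p e) S
                  else K.0#
  ... | no _  = (if ⌊ v ≟ src e ⌋ then K.- LK.wedge (λ i → ρK e LK.·v p e i) S else K.0#)
                K.+ (if ⌊ v ≟ tgt e ⌋ then LK.wedge (p e) S else K.0#)

  IndepOn : Points → Subset m → Set (c₂ ⊔ ℓ₂)
  IndepOn p Fs =
    ∀ (co : Fin m → K.Carrier) → (∀ e → e ∉ Fs → co e K.≈ K.0#) →
    (∀ v S → LK.sumFin m (λ e → co e K.* xhat p e v S) K.≈ K.0#) →
    ∀ e → co e K.≈ K.0#

-- The edge e with point w ∈ ⋀ᵏ contributes w at its head and −R(ψ_e) w at its tail, where R = ρ⁽ᵏ⁾ is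
-- multiplicative by the Cauchy–Binet formula.  Transporting along walks from a base vertex in every
-- component shows that the edge spaces of X together span a space of dimension f(X): each further
-- vertex contributes a full copy of ⋀ᵏ, each base the displacements (R(γ) − 1) w of its closed walks.
-- Independent points therefore satisfy the count.
--
-- Conversely take the generic points p and suppose that some set is dependent; let X be the support of
-- a relation.  The vector of each e ∈ X lies in the span of the others, and this remains true when the
-- coordinates of p_e alone are specialised to basis vectors, so the span of the |X| − 1 other vectors
-- contains the whole edge space of e.  Hence f(X) ≤ |X| − 1.
--
-- Equality in a field need not be decidable here, so case distinctions are made under double negation,
-- which is harmless for a contradiction.  Passing from ¬ ¬ (c ≈ 0) to c ≈ 0 for the coefficients of a
-- relation then needs an invertible pivot, obtained by adding up all candidates multiplied by widely
-- separated powers of a transcendental.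
module Submission where

-- Genericity is brought to bear on a span through an annihilator: a matrix whose kernel is exactly
-- the span of the points other than p_e. Its entries are polynomial in the coordinates of those
-- other points, so specialising p_e leaves it unchanged, while the equation that it kills the
-- vector of e holds at the transcendental point and is therefore a polynomial identity. Elimination
-- is carried out without division because algebraic independence speaks of polynomials only.
--
-- The same matrices bridge the two fields. The function f is defined by dimensions over `F`,
-- whereas the points live over `K`; the elimination matrix belonging to a basis over `F`, mapped by
-- `ι`, shows that this basis is independent over `K` as well.
--
-- The count is a hypothesis about numbers r that are values of f. Contradicting it at X means
-- exhibiting such a value: components, and for each of them a basis of the displacements of all
-- closed walks. There are infinitely many of these walks in general; fundamental closed walks
-- reduce them to finitely many generators, from which elimination selects a basis.

open import Defs
open import Level using (Level; _⊔_)
open import Algebra.Bundles using (CommutativeRing; Group; RawRing)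
open import Algebra.Morphism.Structures using (module RingMorphisms)
open import Algebra.Solver.Ring.AlmostCommutativeRing using (fromCommutativeRing; _-Raw-AlmostCommutative⟶_)
open import Data.Bool using (Bool; true; false; if_then_else_)
open import Data.Empty using (⊥-elim)
open import Data.Fin using (Fin; zero; suc; punchIn; punchOut; splitAt; combine; remQuot; fromℕ<; _≟_; _↑ˡ_; _↑ʳ_)
import Data.Fin.Properties as Finₚ
open import Data.Fin.Subset using (Subset; inside; outside; ∣_∣; _∈_; _∉_; _⊆_; ⊤; Nonempty) renaming (_-_ to _∖_)
open import Data.Fin.Subset.Properties using (_∈?_; nonempty?; Empty-unique; ∈⊤; ∣⊤∣≡n; ∣⊥∣≡0; p─⊥≡p; p─q⊆p; p⊂q⇒∣p∣<∣q∣; x∈p∧x≢y⇒x∈p-y; x∈p⇒∣p-x∣<∣p∣)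
open import Data.List using (List; []; _∷_; map; _++_; foldr; length; lookup)
open import Data.List.Membership.Propositional.Properties using (∈-lookup)
open import Data.List.Relation.Unary.All as All using (All; []; _∷_)
import Data.List.Relation.Unary.All.Properties as Allₚ
open import Data.List.Relation.Unary.AllPairs as AllPairs using (AllPairs; []; _∷_)
import Data.List.Relation.Unary.AllPairs.Properties as AllPairsₚ
open import Data.Maybe using (Maybe; just; nothing)
open import Data.Nat as ℕ using (ℕ; zero; suc)
import Data.Nat.Properties as ℕₚ
open import Data.Product using (Σ; ∃; ∃-syntax; Σ-syntax; _×_; _,_; proj₁; proj₂)
open import Data.Sum using (_⊎_; inj₁; inj₂; [_,_]′)
open import Data.Unit using () renaming (⊤ to Unit; tt to ∗)
open import Data.Vec using ([]; _∷_; here; there; tabulate)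
open import Data.Vec.Functional using () renaming (_∷_ to _◂_)
open import Data.Vec.Properties using (lookup⇒[]=; []=⇒lookup; lookup∘tabulate)
open import Function using (_∘_; case_of_)
open import Function.Bundles using (_⇔_; mk⇔)
open import Relation.Binary.PropositionalEquality as ≡ using (_≡_; _≢_)
open import Relation.Nullary using (¬_; Dec; yes; no)
open import Relation.Nullary.Decidable using (⌊_⌋; _×-dec_; _⊎-dec_; ¬?)
open import Relation.Unary using (Pred)

-- Sums over finite index sets

-- Coefficients (a , b) stand for the integer a − b.
module IntegerCoefficients {c ℓ} (R : CommutativeRing c ℓ) where
  open CommutativeRing R hiding (zero)
  open import Algebra.Properties.Semiring.Mult.TCOptimised semiring using (×-homo-+; ×1-homo-*) renaming (_×_ to _⊗_)
  open import Algebra.Properties.Ring ring using (-‿distribˡ-*; -‿distribʳ-*; -‿involutive; -‿+-comm; -0#≈0#)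
  open import Algebra.Properties.CommutativeSemigroup +-commutativeSemigroup using (interchange)
  open import Relation.Binary.Reasoning.Setoid setoid

  coefficients : RawRing _ _
  coefficients = record
    { Carrier = ℕ × ℕ
    ; _≈_ = _≡_
    ; _+_ = λ { (a , b) (a′ , b′) → a ℕ.+ a′ , b ℕ.+ b′ }
    ; _*_ = λ { (a , b) (a′ , b′) → a ℕ.* a′ ℕ.+ b ℕ.* b′ , a ℕ.* b′ ℕ.+ b ℕ.* a′ }
    ; -_ = λ { (a , b) → b , a }
    ; 0# = 0 , 0
    ; 1# = 1 , 0
    }

  -- The separate clause for `zero` lets `(1 , 0)` and `(0 , 0)` evaluate to `1#` and `0#` by
  -- computation, so that constants in solved equations are those of the ring itself.
  ⟦_⟧ : ℕ × ℕ → Carrier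
  ⟦ a , zero ⟧ = a ⊗ 1#
  ⟦ a , suc b ⟧ = a ⊗ 1# - suc b ⊗ 1#

  ⟦⟧-difference : ∀ a b → ⟦ a , b ⟧ ≈ a ⊗ 1# - b ⊗ 1#
  ⟦⟧-difference a zero    = sym (trans (+-congˡ -0#≈0#) (+-identityʳ _))
  ⟦⟧-difference a (suc b) = refl

  +-homo : ∀ x y → ⟦ RawRing._+_ coefficients x y ⟧ ≈ ⟦ x ⟧ + ⟦ y ⟧
  +-homo (a , b) (a′ , b′) = begin
    ⟦ a ℕ.+ a′ , b ℕ.+ b′ ⟧                    ≈⟨ ⟦⟧-difference (a ℕ.+ a′) (b ℕ.+ b′) ⟩
    (a ℕ.+ a′) ⊗ 1# - (b ℕ.+ b′) ⊗ 1#          ≈⟨ +-cong (×-homo-+ 1# a a′) (-‿cong (×-homo-+ 1# b b′)) ⟩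
    (a ⊗ 1# + a′ ⊗ 1#) - (b ⊗ 1# + b′ ⊗ 1#)    ≈⟨ +-congˡ (-‿+-comm _ _) ⟨
    (a ⊗ 1# + a′ ⊗ 1#) + (- (b ⊗ 1#) + - (b′ ⊗ 1#)) ≈⟨ interchange _ _ _ _ ⟩
    (a ⊗ 1# - b ⊗ 1#) + (a′ ⊗ 1# - b′ ⊗ 1#)    ≈⟨ +-cong (⟦⟧-difference a b) (⟦⟧-difference a′ b′) ⟨
    ⟦ a , b ⟧ + ⟦ a′ , b′ ⟧                    ∎

  -‿homo : ∀ x → ⟦ RawRing.-_ coefficients x ⟧ ≈ - ⟦ x ⟧
  -‿homo (a , b) = begin
    ⟦ b , a ⟧              ≈⟨ ⟦⟧-difference b a ⟩
    b ⊗ 1# - a ⊗ 1#        ≈⟨ +-comm _ _ ⟩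
    - (a ⊗ 1#) + b ⊗ 1#    ≈⟨ +-congˡ (-‿involutive _) ⟨
    - (a ⊗ 1#) + - - (b ⊗ 1#) ≈⟨ -‿+-comm _ _ ⟩
    - (a ⊗ 1# - b ⊗ 1#)    ≈⟨ -‿cong (⟦⟧-difference a b) ⟨
    - ⟦ a , b ⟧            ∎

  *-homo : ∀ x y → ⟦ RawRing._*_ coefficients x y ⟧ ≈ ⟦ x ⟧ * ⟦ y ⟧
  *-homo (a , b) (a′ , b′) = begin
    ⟦ a ℕ.* a′ ℕ.+ b ℕ.* b′ , a ℕ.* b′ ℕ.+ b ℕ.* a′ ⟧
      ≈⟨ ⟦⟧-difference (a ℕ.* a′ ℕ.+ b ℕ.* b′) (a ℕ.* b′ ℕ.+ b ℕ.* a′) ⟩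
    (a ℕ.* a′ ℕ.+ b ℕ.* b′) ⊗ 1# - (a ℕ.* b′ ℕ.+ b ℕ.* a′) ⊗ 1#
      ≈⟨ +-cong (expand a a′ b b′) (-‿cong (expand a b′ b a′)) ⟩
    (A * A′ + B * B′) - (A * B′ + B * A′)
      ≈⟨ +-congˡ (-‿+-comm _ _) ⟨
    (A * A′ + B * B′) + (- (A * B′) + - (B * A′))
      ≈⟨ +-congˡ (+-comm _ _) ⟩
    (A * A′ + B * B′) + (- (B * A′) + - (A * B′))
      ≈⟨ interchange _ _ _ _ ⟩
    (A * A′ + - (B * A′)) + (B * B′ + - (A * B′))
      ≈⟨ +-cong (+-congˡ (-‿distribˡ-* _ _)) (+-comm _ _) ⟩
    (A * A′ + - B * A′) + (- (A * B′) + B * B′)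
      ≈⟨ +-cong (sym (distribʳ _ _ _)) (+-cong (-‿distribʳ-* _ _) (sym (trans (sym (-‿distribˡ-* _ _)) (trans (-‿cong (sym (-‿distribʳ-* _ _))) (-‿involutive _))))) ⟩
    (A - B) * A′ + (A * - B′ + - B * - B′)
      ≈⟨ +-congˡ (distribʳ _ _ _) ⟨
    (A - B) * A′ + (A - B) * - B′
      ≈⟨ distribˡ _ _ _ ⟨
    (A - B) * (A′ - B′)
      ≈⟨ *-cong (⟦⟧-difference a b) (⟦⟧-difference a′ b′) ⟨
    ⟦ a , b ⟧ * ⟦ a′ , b′ ⟧ ∎
    where
    A = a ⊗ 1#
    B = b ⊗ 1#
    A′ = a′ ⊗ 1#
    B′ = b′ ⊗ 1#
    expand : ∀ p q r s → (p ℕ.* q ℕ.+ r ℕ.* s) ⊗ 1# ≈ p ⊗ 1# * q ⊗ 1# + r ⊗ 1# * s ⊗ 1#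
    expand p q r s = trans (×-homo-+ 1# (p ℕ.* q) (r ℕ.* s)) (+-cong (×1-homo-* p q) (×1-homo-* r s))

  homomorphism : coefficients -Raw-AlmostCommutative⟶ fromCommutativeRing R
  homomorphism = record
    { ⟦_⟧ = ⟦_⟧ ; +-homo = +-homo ; *-homo = *-homo ; -‿homo = -‿homo ; 0-homo = refl ; 1-homo = refl }

  -- Coefficients are compared as integers, by cross-addition. In positive characteristic distinct
  -- integers may have equal images, so a failed comparison claims nothing.
  equal? : ∀ x y → Maybe (⟦ x ⟧ ≈ ⟦ y ⟧)
  equal? (a , b) (a′ , b′) with a ℕ.+ b′ ℕ.≟ a′ ℕ.+ b
  ... | no _   = nothing
  ... | yes eq = just (begin
    ⟦ a , b ⟧                      ≈⟨ ⟦⟧-difference a b ⟩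
    a ⊗ 1# - b ⊗ 1#                ≈⟨ +-identityʳ _ ⟨
    (a ⊗ 1# - b ⊗ 1#) + 0#         ≈⟨ +-congˡ (-‿inverseʳ _) ⟨
    (a ⊗ 1# - b ⊗ 1#) + (b′ ⊗ 1# - b′ ⊗ 1#) ≈⟨ +-congˡ (+-comm _ _) ⟩
    (a ⊗ 1# - b ⊗ 1#) + (- (b′ ⊗ 1#) + b′ ⊗ 1#) ≈⟨ +-congˡ (+-comm _ _) ⟩
    (a ⊗ 1# - b ⊗ 1#) + (b′ ⊗ 1# - b′ ⊗ 1#) ≈⟨ interchange _ _ _ _ ⟩
    (a ⊗ 1# + b′ ⊗ 1#) + (- (b ⊗ 1#) + - (b′ ⊗ 1#)) ≈⟨ +-congʳ (trans (sym (×-homo-+ 1# a b′)) (trans (reflexive (≡.cong (_⊗ 1#) eq)) (×-homo-+ 1# a′ b))) ⟩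
    (a′ ⊗ 1# + b ⊗ 1#) + (- (b ⊗ 1#) + - (b′ ⊗ 1#)) ≈⟨ +-congˡ (+-comm _ _) ⟩
    (a′ ⊗ 1# + b ⊗ 1#) + (- (b′ ⊗ 1#) + - (b ⊗ 1#)) ≈⟨ interchange _ _ _ _ ⟩
    (a′ ⊗ 1# - b′ ⊗ 1#) + (b ⊗ 1# - b ⊗ 1#) ≈⟨ +-congˡ (-‿inverseʳ _) ⟩
    (a′ ⊗ 1# - b′ ⊗ 1#) + 0#       ≈⟨ +-identityʳ _ ⟩
    a′ ⊗ 1# - b′ ⊗ 1#              ≈⟨ ⟦⟧-difference a′ b′ ⟨
    ⟦ a′ , b′ ⟧                    ∎)

  open import Algebra.Solver.Ring coefficients (fromCommutativeRing R) homomorphism equal? public hiding (⟦_⟧)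

module FiniteSums {c ℓ} (R : CommutativeRing c ℓ) where
  open CommutativeRing R hiding (zero)
  open LinAlg R
  open import Relation.Binary.Reasoning.Setoid setoid
  import Algebra.Properties.Semiring.Sum semiring as S

  sumFin≈sum : ∀ n (f : Fin n → Carrier) → sumFin n f ≈ S.sum f
  sumFin≈sum zero    f = refl
  sumFin≈sum (suc n) f = +-congˡ (sumFin≈sum n (f ∘ suc))

  sum-cong : ∀ n {f g : Fin n → Carrier} → (∀ i → f i ≈ g i) → sumFin n f ≈ sumFin n g
  sum-cong zero    eq = refl
  sum-cong (suc n) eq = +-cong (eq zero) (sum-cong n (eq ∘ suc))

  sum-zero : ∀ n {f : Fin n → Carrier} → (∀ i → f i ≈ 0#) → sumFin n f ≈ 0#
  sum-zero zero    eq = refl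
  sum-zero (suc n) eq = trans (+-cong (eq zero) (sum-zero n (eq ∘ suc))) (+-identityʳ _)

  sum-+ : ∀ n (f g : Fin n → Carrier) → sumFin n (λ i → f i + g i) ≈ sumFin n f + sumFin n g
  sum-+ n f g = begin
    sumFin n (λ i → f i + g i) ≈⟨ sumFin≈sum n _ ⟩
    S.sum (λ i → f i + g i)    ≈⟨ S.∑-distrib-+ f g ⟩
    S.sum f + S.sum g          ≈⟨ +-cong (sumFin≈sum n f) (sumFin≈sum n g) ⟨
    sumFin n f + sumFin n g    ∎

  sum-*ˡ : ∀ n x (f : Fin n → Carrier) → x * sumFin n f ≈ sumFin n (λ i → x * f i)
  sum-*ˡ n x f = trans (*-congˡ (sumFin≈sum n f)) (trans (S.*-distribˡ-sum x f) (sym (sumFin≈sum n _)))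

  sum-*ʳ : ∀ n x (f : Fin n → Carrier) → sumFin n f * x ≈ sumFin n (λ i → f i * x)
  sum-*ʳ n x f = trans (*-congʳ (sumFin≈sum n f)) (trans (S.*-distribʳ-sum x f) (sym (sumFin≈sum n _)))

  sum-comm : ∀ m n (f : Fin m → Fin n → Carrier) →
             sumFin m (λ i → sumFin n (f i)) ≈ sumFin n (λ j → sumFin m (λ i → f i j))
  sum-comm zero    n f = sym (sum-zero n (λ _ → refl))
  sum-comm (suc m) n f = trans (+-congˡ (sum-comm m n (f ∘ suc))) (sym (sum-+ n (f zero) _))

  sum-single : ∀ n (f : Fin n → Carrier) i → (∀ j → j ≢ i → f j ≈ 0#) → sumFin n f ≈ f i
  sum-single (suc n) f zero    off = trans (+-congˡ (sum-zero n (λ j → off (suc j) λ ()))) (+-identityʳ _)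
  sum-single (suc n) f (suc i) off =
    trans (+-cong (off zero λ ()) (sum-single n (f ∘ suc) i (λ j ne → off (suc j) (λ { ≡.refl → ne ≡.refl })))) (+-identityˡ _)

  I-diagonal : ∀ {n} (i : Fin n) → I i i ≈ 1#
  I-diagonal i with i ≟ i
  ... | yes _ = refl
  ... | no ne = ⊥-elim (ne ≡.refl)

  I-off : ∀ {n} {i j : Fin n} → i ≢ j → I i j ≈ 0#
  I-off {i = i} {j} ne with i ≟ j
  ... | yes eq = ⊥-elim (ne eq)
  ... | no _   = refl

  sum-Iˡ : ∀ n (f : Fin n → Carrier) i → sumFin n (λ j → I i j * f j) ≈ f i
  sum-Iˡ n f i = trans (sum-single n _ i (λ j ne → trans (*-congʳ (I-off (ne ∘ ≡.sym))) (zeroˡ _)))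
                       (trans (*-congʳ (I-diagonal i)) (*-identityˡ _))

  sum-Iʳ : ∀ n (f : Fin n → Carrier) i → sumFin n (λ j → f j * I j i) ≈ f i
  sum-Iʳ n f i = trans (sum-single n _ i (λ j ne → trans (*-congˡ (I-off ne)) (zeroʳ _)))
                       (trans (*-congˡ (I-diagonal i)) (*-identityʳ _))

-- The Cauchy–Binet formula

-- Alternation is stated for neighbouring columns because it then passes through a Laplace
-- expansion: deleting a third column keeps the two neighbours adjacent, and the terms that delete
-- one or the other carry opposite signs.
data Adjacent : ∀ {n} → Fin n → Fin n → Set where
  here  : ∀ {n} → Adjacent {suc (suc n)} zero (suc zero)
  there : ∀ {n} {i j : Fin n} → Adjacent i j → Adjacent (suc i) (suc j)

punchIn-adjacent : ∀ {n} {i j : Fin (suc n)} → Adjacent i j → (l : Fin (suc n)) → l ≢ i → l ≢ j →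
                   ∃[ i′ ] ∃[ j′ ] (Adjacent i′ j′ × punchIn l i′ ≡ i × punchIn l j′ ≡ j)
punchIn-adjacent here zero l≢i _ = ⊥-elim (l≢i ≡.refl)
punchIn-adjacent here (suc zero) _ l≢j = ⊥-elim (l≢j ≡.refl)
punchIn-adjacent {suc (suc n)} here (suc (suc l)) _ _ = zero , suc zero , here , ≡.refl , ≡.refl
punchIn-adjacent (there a) zero _ _ = _ , _ , a , ≡.refl , ≡.refl
punchIn-adjacent {suc n} (there a) (suc l) l≢i l≢j
  with i′ , j′ , a′ , eq , eq′ ← punchIn-adjacent a l (l≢i ∘ ≡.cong suc) (l≢j ∘ ≡.cong suc)
  = suc i′ , suc j′ , there a′ , ≡.cong suc eq , ≡.cong suc eq′

-- Deleting either of two neighbours leaves the same columns except in one position, where the other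
-- neighbour remains. If the two columns are equal, the two minors therefore coincide.
punchIn-adjacent-agree : ∀ {n} {i j : Fin (suc n)} → Adjacent i j → ∀ s →
                         punchIn i s ≡ punchIn j s ⊎ (punchIn i s ≡ j × punchIn j s ≡ i)
punchIn-adjacent-agree here zero = inj₂ (≡.refl , ≡.refl)
punchIn-adjacent-agree here (suc s) = inj₁ ≡.refl
punchIn-adjacent-agree {suc n} (there a) zero = inj₁ ≡.refl
punchIn-adjacent-agree {suc n} (there a) (suc s) with punchIn-adjacent-agree a s
... | inj₁ eq = inj₁ (≡.cong suc eq)
... | inj₂ (eq , eq′) = inj₂ (≡.cong suc eq , ≡.cong suc eq′)

module Determinants {c ℓ} (R : CommutativeRing c ℓ) where
  open CommutativeRing R hiding (zero)
  open LinAlg R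
  open FiniteSums R
  open IntegerCoefficients R using (solve; _:+_; _:*_; :-_; _:=_)
  open import Relation.Binary.Reasoning.Setoid setoid
  open import Algebra.Properties.Ring ring using (-‿distribˡ-*)
  open import Algebra.Properties.Group +-group using (identityʳ-unique)

  double-zero : ∀ {x} → x ≈ x + x → x ≈ 0#
  double-zero {x} eq = identityʳ-unique x x (sym eq)

  -- Opaque copies of sumFin, det and the identity matrix, whose defining clauses would
  -- otherwise unfold at successors and block the inference of summands and matrices.
  opaque
    ∑ : ∀ n → (Fin n → Carrier) → Carrier
    ∑ = sumFin

    sign : ∀ {n} → Fin n → Carrier
    sign j = alt j 1#

    Det : ∀ n → Mat n n → Carrier
    Det = det

    unit : ∀ {d} → Fin d → Fin d → Carrier
    unit t s = I s t

  opaque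
    unfolding ∑ sign Det unit

    ∑≡sumFin : ∀ n f → ∑ n f ≡ sumFin n f
    ∑≡sumFin n f = ≡.refl

    Det≡det : ∀ n M → Det n M ≡ det n M
    Det≡det n M = ≡.refl

    unit≡I : ∀ {d} (t s : Fin d) → unit t s ≡ I s t
    unit≡I t s = ≡.refl

    ∑-suc : ∀ n f → ∑ (suc n) f ≈ f zero + ∑ n (f ∘ suc)
    ∑-suc n f = refl

    ∑-one : ∀ f → ∑ 1 f ≈ f zero
    ∑-one f = +-identityʳ _

    ∑-empty : ∀ f → ∑ 0 f ≈ 0#
    ∑-empty f = refl

    ∑-cong : ∀ n {f g : Fin n → Carrier} → (∀ i → f i ≈ g i) → ∑ n f ≈ ∑ n g
    ∑-cong = sum-cong

    ∑-zero : ∀ n {f : Fin n → Carrier} → (∀ i → f i ≈ 0#) → ∑ n f ≈ 0#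
    ∑-zero = sum-zero

    ∑-+ : ∀ n (f g : Fin n → Carrier) → ∑ n (λ i → f i + g i) ≈ ∑ n f + ∑ n g
    ∑-+ = sum-+

    ∑-*ˡ : ∀ n x (f : Fin n → Carrier) → x * ∑ n f ≈ ∑ n (λ i → x * f i)
    ∑-*ˡ = sum-*ˡ

    ∑-*ʳ : ∀ n x (f : Fin n → Carrier) → ∑ n f * x ≈ ∑ n (λ i → f i * x)
    ∑-*ʳ = sum-*ʳ

    ∑-comm : ∀ m n (f : Fin m → Fin n → Carrier) → ∑ m (λ i → ∑ n (f i)) ≈ ∑ n (λ j → ∑ m (λ i → f i j))
    ∑-comm = sum-comm

    sign-zero : ∀ {n} → sign {suc n} zero ≈ 1#
    sign-zero = refl

    sign-suc : ∀ {n} (j : Fin n) → sign (suc j) ≈ - sign j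
    sign-suc j = refl

    alt≈sign-* : ∀ {n} (j : Fin n) x → alt j x ≈ sign j * x
    alt≈sign-* zero    x = sym (*-identityˡ x)
    alt≈sign-* (suc j) x = trans (-‿cong (alt≈sign-* j x)) (-‿distribˡ-* _ _)

    sign-adjacent : ∀ {n} {i j : Fin n} → Adjacent i j → sign j ≈ - sign i
    sign-adjacent here      = refl
    sign-adjacent (there a) = -‿cong (sign-adjacent a)

    Det-empty : ∀ M → Det 0 M ≈ 1#
    Det-empty M = refl

    Det-expand : ∀ n (M : Mat (suc n) (suc n)) →
      Det (suc n) M ≈ ∑ (suc n) (λ j → sign j * (M zero j * Det n (λ r s → M (suc r) (punchIn j s))))
    Det-expand n M = sum-cong (suc n) (λ j → alt≈sign-* j (M zero j * det n (λ r s → M (suc r) (punchIn j s))))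

    unit-diagonal : ∀ {d} (i : Fin d) → unit i i ≈ 1#
    unit-diagonal = I-diagonal

    unit-off : ∀ {d} {t s : Fin d} → s ≢ t → unit t s ≈ 0#
    unit-off = I-off

    unit-suc : ∀ {d} (t s : Fin d) → unit (suc t) (suc s) ≈ unit t s
    unit-suc t s with s ≟ t
    ... | yes ≡.refl = refl
    ... | no ne      = refl

    ·v-unit : ∀ {d′ d} (A : Mat d′ d) t i → (A ·v unit t) i ≈ A i t
    ·v-unit {d = d} A t i = sum-Iʳ d _ _

  ∑-adjacent : ∀ {n} {i j : Fin n} → Adjacent i j → (f : Fin n → Carrier) →
                 (∀ l → l ≢ i → l ≢ j → f l ≈ 0#) → f i + f j ≈ 0# → ∑ n f ≈ 0#
  ∑-adjacent {suc (suc n)} here f off eq = begin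
    ∑ (suc (suc n)) f ≈⟨ trans (∑-suc _ f) (+-congˡ (∑-suc _ _)) ⟩
    f zero + (f (suc zero) + ∑ n (λ l → f (suc (suc l)))) ≈⟨ +-assoc _ _ _ ⟨
    (f zero + f (suc zero)) + ∑ n (λ l → f (suc (suc l))) ≈⟨ +-cong eq (∑-zero n (λ l → off (suc (suc l)) (λ ()) (λ ()))) ⟩
    0# + 0#                                                    ≈⟨ +-identityʳ _ ⟩
    0#                                                         ∎
  ∑-adjacent {suc n} (there a) f off eq =
    trans (∑-suc n f) (trans (+-cong (off zero (λ ()) (λ ()))
                  (∑-adjacent a (f ∘ suc) (λ l l≢i l≢j → off (suc l) (l≢i ∘ Finₚ.suc-injective) (l≢j ∘ Finₚ.suc-injective)) eq))
          (+-identityʳ _))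

  Det-cong : ∀ n {M N : Mat n n} → (∀ a b → M a b ≈ N a b) → Det n M ≈ Det n N
  Det-cong zero    eq = trans (Det-empty _) (sym (Det-empty _))
  Det-cong (suc n) {M} {N} eq = begin
    Det (suc n) M ≈⟨ Det-expand n M ⟩
    _             ≈⟨ ∑-cong (suc n) (λ j → *-congˡ (*-cong (eq zero j) (Det-cong n (λ r s → eq (suc r) (punchIn j s))))) ⟩
    _             ≈⟨ Det-expand n N ⟨
    Det (suc n) N ∎

  -- Induction along the first row: the term of column `j` is linear through its entry, every other
  -- term through its minor, in which column `j` sits at `punchOut l≢j`. The form t · N + P covers
  -- additivity and homogeneity together.
  Det-linear : ∀ n (j : Fin n) t {M N P : Mat n n} → (∀ a → M a j ≈ t * N a j + P a j) →
               (∀ b → b ≢ j → ∀ a → M a b ≈ N a b × M a b ≈ P a b) → Det n M ≈ t * Det n N + Det n P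
  Det-linear (suc n) j t {M} {N} {P} atj off = begin
    Det (suc n) M                                                 ≈⟨ Det-expand n M ⟩
    ∑ (suc n) (term M)                                       ≈⟨ ∑-cong (suc n) termwise ⟩
    ∑ (suc n) (λ l → t * term N l + term P l)                ≈⟨ ∑-+ (suc n) (λ l → t * term N l) (term P) ⟩
    ∑ (suc n) (λ l → t * term N l) + ∑ (suc n) (term P) ≈⟨ +-congʳ (∑-*ˡ (suc n) t (term N)) ⟨
    t * ∑ (suc n) (term N) + ∑ (suc n) (term P)         ≈⟨ +-cong (*-congˡ (Det-expand n N)) (Det-expand n P) ⟨
    t * Det (suc n) N + Det (suc n) P                             ∎
    where
    minorAt : Mat (suc n) (suc n) → Fin (suc n) → Mat n n
    minorAt Q l r s = Q (suc r) (punchIn l s)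
    term : Mat (suc n) (suc n) → Fin (suc n) → Carrier
    term Q l = sign l * (Q zero l * Det n (minorAt Q l))
    termwise : ∀ l → term M l ≈ t * term N l + term P l
    termwise l with l ≟ j
    ... | yes ≡.refl = begin
      sign l * (M zero l * Det n (minorAt M l))
        ≈⟨ *-congˡ (*-congʳ (atj zero)) ⟩
      sign l * ((t * N zero l + P zero l) * Det n (minorAt M l))
        ≈⟨ solve 5 (λ σ t x y d → σ :* ((t :* x :+ y) :* d) := t :* (σ :* (x :* d)) :+ σ :* (y :* d)) refl (sign l) t (N zero l) (P zero l) _ ⟩
      t * (sign l * (N zero l * Det n (minorAt M l))) + sign l * (P zero l * Det n (minorAt M l))
        ≈⟨ +-cong (*-congˡ (*-congˡ (*-congˡ (Det-cong n (λ r s → proj₁ (off _ (Finₚ.punchInᵢ≢i l s) (suc r)))))))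
                  (*-congˡ (*-congˡ (Det-cong n (λ r s → proj₂ (off _ (Finₚ.punchInᵢ≢i l s) (suc r)))))) ⟩
      t * term N l + term P l ∎
    ... | no l≢j = begin
      sign l * (M zero l * Det n (minorAt M l))
        ≈⟨ *-congˡ (*-congˡ (Det-linear n (punchOut l≢j) t
             (λ r → ≡.subst (λ b → M (suc r) b ≈ t * N (suc r) b + P (suc r) b) (≡.sym (Finₚ.punchIn-punchOut l≢j)) (atj (suc r)))
             (λ s s≢ r → off (punchIn l s) (λ eq → s≢ (Finₚ.punchIn-injective l _ _ (≡.trans eq (≡.sym (Finₚ.punchIn-punchOut l≢j))))) (suc r)))) ⟩
      sign l * (M zero l * (t * Det n (minorAt N l) + Det n (minorAt P l)))
        ≈⟨ solve 5 (λ σ m t x y → σ :* (m :* (t :* x :+ y)) := t :* (σ :* (m :* x)) :+ σ :* (m :* y)) refl (sign l) (M zero l) t _ _ ⟩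
      t * (sign l * (M zero l * Det n (minorAt N l))) + sign l * (M zero l * Det n (minorAt P l))
        ≈⟨ +-cong (*-congˡ (*-congˡ (*-congʳ (proj₁ (off l l≢j zero))))) (*-congˡ (*-congʳ (proj₂ (off l l≢j zero)))) ⟩
      t * term N l + term P l ∎

  -- A zero column equals 1 times itself plus itself, so linearity gives det M = det M + det M.
  Det-zero-column : ∀ n (j : Fin n) {M : Mat n n} → (∀ a → M a j ≈ 0#) → Det n M ≈ 0#
  Det-zero-column n j {M} eq = double-zero (trans
    (Det-linear n j 1# {M} {M} {M} (λ a → trans (eq a) (sym (trans (+-cong (trans (*-identityˡ _) (eq a)) (eq a)) (+-identityʳ _))))
                (λ _ _ _ → refl , refl))
    (+-congʳ (*-identityˡ _)))

  Det-alternating : ∀ n {i j : Fin n} → Adjacent i j → {M : Mat n n} → (∀ a → M a i ≈ M a j) → Det n M ≈ 0#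
  Det-alternating (suc n) {i} {j} adj {M} eq = trans (Det-expand n M) (∑-adjacent adj _
    (λ l l≢i l≢j → let i′ , j′ , adj′ , eqᵢ , eqⱼ = punchIn-adjacent adj l l≢i l≢j in
       trans (*-congˡ (trans (*-congˡ (Det-alternating n adj′ (λ a →
         ≡.subst₂ (λ x y → M (suc a) x ≈ M (suc a) y) (≡.sym eqᵢ) (≡.sym eqⱼ) (eq (suc a))))) (zeroʳ _))) (zeroʳ _))
    (trans (+-congˡ (trans (*-cong (sign-adjacent adj) (*-cong (sym (eq zero)) (Det-cong n swapped))) (sym (-‿distribˡ-* _ _))))
           (-‿inverseʳ _)))
    where
    swapped : ∀ r s → M (suc r) (punchIn j s) ≈ M (suc r) (punchIn i s)
    swapped r s with punchIn-adjacent-agree adj s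
    ... | inj₁ e = reflexive (≡.cong (M (suc r)) (≡.sym e))
    ... | inj₂ (e , e′) = ≡.subst₂ (λ x y → M (suc r) x ≈ M (suc r) y) (≡.sym e′) (≡.sym e) (eq (suc r))

  -- Alternating multilinear forms and their expansion in minors

  record AlternatingMultilinear {k d} (φ : (Fin k → Fin d → Carrier) → Carrier) : Set (c ⊔ ℓ) where
    field
      congruent   : ∀ {p q} → (∀ i s → p i s ≈ q i s) → φ p ≈ φ q
      linear      : ∀ j t {p q r} → (∀ s → p j s ≈ t * q j s + r j s) →
                    (∀ i → i ≢ j → ∀ s → p i s ≈ q i s × p i s ≈ r i s) → φ p ≈ t * φ q + φ r
      alternating : ∀ {i j} → Adjacent i j → ∀ {p} → (∀ s → p i s ≈ p j s) → φ p ≈ 0#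
  open AlternatingMultilinear

  fix-first : ∀ {k d} {φ : (Fin (suc k) → Fin d → Carrier) → Carrier} → AlternatingMultilinear φ →
              ∀ x → AlternatingMultilinear (λ p → φ (x ◂ p))
  congruent   (fix-first A x) eq = congruent A λ { zero s → refl ; (suc i) s → eq i s }
  linear      (fix-first A x) j t atj off = linear A (suc j) t atj
    λ { zero _ s → refl , refl ; (suc i) ne s → off i (ne ∘ ≡.cong suc) s }
  alternating (fix-first A x) adj eq = alternating A (there adj) eq

  -- Additivity in each of the two first arguments turns φ(x+y, x+y, …) = 0 into antisymmetry.
  swap-first : ∀ {k d} {φ : (Fin (suc (suc k)) → Fin d → Carrier) → Carrier} → AlternatingMultilinear φ →
               ∀ x y p → φ (x ◂ y ◂ p) ≈ - φ (y ◂ x ◂ p)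
  swap-first {φ = φ} A x y p = inverseˡ-unique _ _ (begin
    φ (x ◂ y ◂ p) + φ (y ◂ x ◂ p)
      ≈⟨ +-cong (+-identityˡ _) (+-identityʳ _) ⟨
    (0# + φ (x ◂ y ◂ p)) + (φ (y ◂ x ◂ p) + 0#)
      ≈⟨ +-cong (+-congʳ (alternating A here (λ _ → refl))) (+-congˡ (alternating A here (λ _ → refl))) ⟨
    (φ (x ◂ x ◂ p) + φ (x ◂ y ◂ p)) + (φ (y ◂ x ◂ p) + φ (y ◂ y ◂ p))
      ≈⟨ +-cong (second x) (second y) ⟨
    φ (x ◂ z ◂ p) + φ (y ◂ z ◂ p)
      ≈⟨ +-congʳ (*-identityˡ _) ⟨
    1# * φ (x ◂ z ◂ p) + φ (y ◂ z ◂ p)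
      ≈⟨ linear A zero 1# (λ s → +-congʳ (sym (*-identityˡ _))) (λ { zero ne _ → ⊥-elim (ne ≡.refl) ; (suc _) _ _ → refl , refl }) ⟨
    φ (z ◂ z ◂ p)
      ≈⟨ alternating A here (λ _ → refl) ⟩
    0# ∎)
    where
    open import Algebra.Properties.Group +-group using (inverseˡ-unique)
    z = λ s → x s + y s
    second : ∀ w → φ (w ◂ z ◂ p) ≈ φ (w ◂ x ◂ p) + φ (w ◂ y ◂ p)
    second w = trans (linear A (suc zero) 1# (λ s → +-congʳ (sym (*-identityˡ _)))
                       (λ { zero _ _ → refl , refl ; (suc zero) ne _ → ⊥-elim (ne ≡.refl) ; (suc (suc _)) _ _ → refl , refl }))
                     (+-congʳ (*-identityˡ _))

  -- All arguments are expanded at once. Terms with `e` in two places vanish by alternation, so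
  -- besides `φ q` one term remains for each position of `e`; moving `e` to the front costs the
  -- sign.
  expand-along : ∀ {k d} {φ : (Fin (suc k) → Fin d → Carrier) → Carrier} → AlternatingMultilinear φ →
                 ∀ (e : Fin d → Carrier) (t : Fin (suc k) → Carrier) {p q} →
                 (∀ i s → p i s ≈ t i * e s + q i s) →
                 φ p ≈ φ q + ∑ (suc k) (λ j → sign j * (t j * φ (e ◂ (q ∘ punchIn j))))
  expand-along {zero} {φ = φ} A e t {p} {q} eq = begin
    φ p                       ≈⟨ linear A zero (t zero) (eq zero) (λ { zero ne _ → ⊥-elim (ne ≡.refl) }) ⟩
    t zero * φ (e ◂ _) + φ q  ≈⟨ +-comm _ _ ⟩
    φ q + t zero * φ (e ◂ _)  ≈⟨ +-congˡ (trans (∑-one _) (trans (*-congʳ sign-zero) (*-identityˡ _))) ⟨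
    φ q + ∑ 1 (λ j → sign j * (t j * φ (e ◂ (q ∘ punchIn j)))) ∎
  expand-along {suc k} {φ = φ} A e t {p} {q} eq = begin
    φ p
      ≈⟨ linear A zero (t zero) {q = e ◂ p′} {r = q zero ◂ p′} (eq zero) (λ { zero ne _ → ⊥-elim (ne ≡.refl) ; (suc i) _ _ → refl , refl }) ⟩
    t zero * φ (e ◂ p′) + φ (q zero ◂ p′)
      ≈⟨ +-cong (*-congˡ (expand-along (fix-first A e) e (t ∘ suc) (eq ∘ suc))) (expand-along (fix-first A (q zero)) e (t ∘ suc) (eq ∘ suc)) ⟩
    t zero * (φ (e ◂ q′) + ∑ (suc k) (λ j → sign j * (t (suc j) * φ (e ◂ e ◂ (q′ ∘ punchIn j)))))
      + (φ (q zero ◂ q′) + ∑ (suc k) (λ j → sign j * (t (suc j) * φ (q zero ◂ e ◂ (q′ ∘ punchIn j)))))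
      ≈⟨ +-cong (*-congˡ (trans (+-congˡ (∑-zero (suc k) (λ j → trans (*-congˡ (trans (*-congˡ (alternating A here (λ _ → refl))) (zeroʳ _))) (zeroʳ _)))) (+-identityʳ _)))
                (+-cong (congruent A (λ { zero _ → refl ; (suc _) _ → refl })) (∑-cong (suc k) swapped)) ⟩
    t zero * φ (e ◂ q′) + (φ q + ∑ (suc k) (λ j → sign (suc j) * (t (suc j) * φ (e ◂ (q ∘ punchIn (suc j))))))
      ≈⟨ solve 3 (λ a b c → a :+ (b :+ c) := b :+ (a :+ c)) refl _ _ _ ⟩
    φ q + (t zero * φ (e ◂ q′) + ∑ (suc k) (λ j → sign (suc j) * (t (suc j) * φ (e ◂ (q ∘ punchIn (suc j))))))
      ≈⟨ +-congˡ (trans (∑-suc _ _) (+-congʳ (trans (*-congʳ sign-zero) (*-identityˡ _)))) ⟨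
    φ q + ∑ (suc (suc k)) (λ j → sign j * (t j * φ (e ◂ (q ∘ punchIn j)))) ∎
    where
    p′ = p ∘ suc
    q′ = q ∘ suc
    swapped : ∀ j → sign j * (t (suc j) * φ (q zero ◂ e ◂ (q′ ∘ punchIn j))) ≈ sign (suc j) * (t (suc j) * φ (e ◂ (q ∘ punchIn (suc j))))
    swapped j = begin
      sign j * (t (suc j) * φ (q zero ◂ e ◂ (q′ ∘ punchIn j)))
        ≈⟨ *-congˡ (*-congˡ (trans (swap-first A (q zero) e (q′ ∘ punchIn j)) (-‿cong (congruent A λ { zero _ → refl ; (suc zero) _ → refl ; (suc (suc _)) _ → refl })))) ⟩
      sign j * (t (suc j) * - φ (e ◂ (q ∘ punchIn (suc j))))
        ≈⟨ solve 3 (λ σ a b → σ :* (a :* (:- b)) := (:- σ) :* (a :* b)) refl _ _ _ ⟩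
      - sign j * (t (suc j) * φ (e ◂ (q ∘ punchIn (suc j))))
        ≈⟨ *-congʳ (sign-suc j) ⟨
      sign (suc j) * (t (suc j) * φ (e ◂ (q ∘ punchIn (suc j)))) ∎

  minor : ∀ {k d} → (Fin k → Fin d → Carrier) → (Fin k → Fin d) → Carrier
  minor {k} p g = Det k (λ a b → p b (g a))

  sumOver : ∀ {a} {A : Set a} → List A → (A → Carrier) → Carrier
  sumOver L f = ∑ (length L) (f ∘ lookup L)

  sumOver-++ : ∀ {a} {A : Set a} (L M : List A) f → sumOver (L ++ M) f ≈ sumOver L f + sumOver M f
  sumOver-++ []      M f = sym (trans (+-congʳ (∑-empty _)) (+-identityˡ _))
  sumOver-++ (x ∷ L) M f = trans (∑-suc _ _) (trans (+-congˡ (sumOver-++ L M f))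
    (trans (sym (+-assoc _ _ _)) (+-congʳ (sym (∑-suc _ _)))))

  sumOver-map : ∀ {a b} {A : Set a} {B : Set b} (g : A → B) L f → sumOver (map g L) f ≈ sumOver L (f ∘ g)
  sumOver-map g []      f = trans (∑-empty _) (sym (∑-empty _))
  sumOver-map g (x ∷ L) f = trans (∑-suc _ _) (trans (+-congˡ (sumOver-map g L f)) (sym (∑-suc _ _)))

  -- Restriction of a form to the hyperplane of vectors with first coordinate 0, which is the
  -- induction step in the dimension.
  raise-alternating : ∀ {k d} {φ : (Fin k → Fin (suc d) → Carrier) → Carrier} → AlternatingMultilinear φ →
                      AlternatingMultilinear (λ p → φ (λ i → 0# ◂ p i))
  congruent   (raise-alternating A) eq = congruent A λ { i zero → refl ; i (suc s) → eq i s }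
  linear      (raise-alternating A) j t atj off = linear A j t
    (λ { zero → sym (trans (+-identityʳ _) (zeroʳ _)) ; (suc s) → atj s })
    (λ { i ne zero → refl , refl ; i ne (suc s) → off i ne s })
  alternating (raise-alternating A) adj eq = alternating A adj λ { zero → refl ; (suc s) → eq s }

  -- The coefficients of the expansion in basis vectors are the coordinates of p₁ ∧ ⋯ ∧ p_k.
  wedge-universal : ∀ k d {φ : (Fin k → Fin d → Carrier) → Carrier} → AlternatingMultilinear φ → ∀ p →
                    φ p ≈ sumOver (combos k d) (λ g → minor p g * φ (λ i → unit (g i)))
  wedge-universal zero d {φ} A p = trans (congruent A λ ()) (sym (trans (∑-one _) (trans (*-congʳ (Det-empty _)) (*-identityˡ _))))
  wedge-universal (suc k) zero A p = trans (double-zero (trans (linear A zero 1# (λ ()) (λ _ _ ())) (+-congʳ (*-identityˡ _)))) (sym (∑-empty _))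
  wedge-universal (suc k) (suc d) {φ} A p = begin
    φ p
      -- Splitting off the coordinate `zero` mirrors the recursion of `combos`: the first summand
      -- yields the subsets without `zero`, the sum over `j` those that contain it.
      ≈⟨ expand-along A (unit zero) (λ i → p i zero) {q = λ i → 0# ◂ q i} decompose ⟩
    φ (λ i → 0# ◂ q i) + ∑ (suc k) (λ j → sign j * (p j zero * φ (unit zero ◂ (λ i → 0# ◂ q (punchIn j i)))))
      ≈⟨ +-cong (wedge-universal (suc k) d (raise-alternating A) q)
                (∑-cong (suc k) (λ j → *-congˡ (*-congˡ (trans (congruent A (λ { zero _ → refl ; (suc _) _ → refl }))
                   (wedge-universal k d (raise-alternating (fix-first A (unit zero))) (q ∘ punchIn j)))))) ⟩
    sumOver (combos (suc k) d) (λ g → minor q g * φ (λ i → 0# ◂ unit (g i)))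
      + ∑ (suc k) (λ j → sign j * (p j zero * sumOver (combos k d) (λ g → minor (q ∘ punchIn j) g * Φ g)))
      ≈⟨ +-cong (∑-cong (length (combos (suc k) d)) (λ T → *-congˡ (congruent A (λ { i zero → sym (unit-off (λ ())) ; i (suc s) → sym (unit-suc _ s) }))))
                (∑-cong (suc k) (λ j → trans (*-congˡ (∑-*ˡ (length (combos k d)) _ _)) (∑-*ˡ (length (combos k d)) _ _))) ⟩
    sumOver (combos (suc k) d) (λ g → minor p (suc ∘ g) * φ (unit ∘ suc ∘ g))
      + ∑ (suc k) (λ j → sumOver (combos k d) (λ g → sign j * (p j zero * (minor (q ∘ punchIn j) g * Φ g))))
      ≈⟨ +-congˡ (∑-comm (suc k) (length (combos k d)) _) ⟩
    sumOver (combos (suc k) d) (λ g → minor p (suc ∘ g) * φ (unit ∘ suc ∘ g))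
      + sumOver (combos k d) (λ g → ∑ (suc k) (λ j → sign j * (p j zero * (minor (q ∘ punchIn j) g * Φ g))))
      ≈⟨ +-congˡ (∑-cong (length (combos k d)) (λ T → factor (lookup (combos k d) T))) ⟩
    sumOver (combos (suc k) d) (λ g → minor p (suc ∘ g) * φ (unit ∘ suc ∘ g))
      + sumOver (combos k d) (λ g → minor p (with-zero g) * φ (λ i → unit (with-zero g i)))
      ≈⟨ +-comm _ _ ⟩
    sumOver (combos k d) (λ g → minor p (with-zero g) * φ (λ i → unit (with-zero g i)))
      + sumOver (combos (suc k) d) (λ g → minor p (suc ∘ g) * φ (unit ∘ suc ∘ g))
      ≈⟨ +-cong (trans (sumOver-map _ (combos k d) term)
                       (∑-cong (length (combos k d)) (λ T → *-cong (Det-cong (suc k) λ { zero _ → refl ; (suc _) _ → refl })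
                                                                      (congruent A λ { zero _ → refl ; (suc _) _ → refl }))))
                (sumOver-map _ (combos (suc k) d) term) ⟨
    sumOver (map _ (combos k d)) term + sumOver (map _ (combos (suc k) d)) term
      ≈⟨ sumOver-++ (map _ (combos k d)) (map _ (combos (suc k) d)) term ⟨
    sumOver (combos (suc k) (suc d)) term ∎
    where
    term : (Fin (suc k) → Fin (suc d)) → Carrier
    term g = minor p g * φ (unit ∘ g)
    with-zero : (Fin k → Fin d) → Fin (suc k) → Fin (suc d)
    with-zero g = zero ◂ (suc ∘ g)
    q : Fin (suc k) → Fin d → Carrier
    q i = p i ∘ suc
    Φ : (Fin k → Fin d) → Carrier
    Φ g = φ (unit zero ◂ (λ i → 0# ◂ unit (g i)))
    decompose : ∀ i s → p i s ≈ p i zero * unit zero s + (0# ◂ q i) s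
    decompose i zero    = sym (trans (+-identityʳ _) (trans (*-congˡ (unit-diagonal zero)) (*-identityʳ _)))
    decompose i (suc s) = sym (trans (+-congʳ (trans (*-congˡ (unit-off (λ ()))) (zeroʳ _))) (+-identityˡ _))
    -- The sum over `j` is the Laplace expansion of the minor of `with-zero g` along its first row,
    -- which holds the coordinates `zero`.
    factor : ∀ g → ∑ (suc k) (λ j → sign j * (p j zero * (minor (q ∘ punchIn j) g * Φ g)))
                 ≈ minor p (with-zero g) * φ (λ i → unit (with-zero g i))
    factor g = begin
      ∑ (suc k) (λ j → sign j * (p j zero * (minor (q ∘ punchIn j) g * Φ g)))
        ≈⟨ ∑-cong (suc k) (λ j → solve 4 (λ a b c e → a :* (b :* (c :* e)) := (a :* (b :* c)) :* e) refl _ _ _ _) ⟩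
      ∑ (suc k) (λ j → (sign j * (p j zero * minor (q ∘ punchIn j) g)) * Φ g)
        ≈⟨ ∑-*ʳ (suc k) (Φ g) (λ j → sign j * (p j zero * minor (q ∘ punchIn j) g)) ⟨
      ∑ (suc k) (λ j → sign j * (p j zero * minor (q ∘ punchIn j) g)) * Φ g
        ≈⟨ *-cong (sym (Det-expand k (λ a b → p b (with-zero g a)))) (congruent A λ { zero _ → refl ; (suc i) zero → sym (unit-off (λ ())) ; (suc i) (suc s) → sym (unit-suc _ s) }) ⟩
      minor p (with-zero g) * φ (λ i → unit (with-zero g i)) ∎

  ·v-cong : ∀ {d′ d} (A : Mat d′ d) {x y : Fin d → Carrier} → (∀ l → x l ≈ y l) → ∀ i → (A ·v x) i ≈ (A ·v y) i
  ·v-cong {d = d} A eq i = sum-cong d (λ l → *-congˡ (eq l))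

  ·v-linear : ∀ {d′ d} (A : Mat d′ d) t {x y z : Fin d → Carrier} → (∀ l → x l ≈ t * y l + z l) →
              ∀ i → (A ·v x) i ≈ t * (A ·v y) i + (A ·v z) i
  ·v-linear {d = d} A t {x} {y} {z} eq i = begin
    sumFin d (λ l → A i l * x l)
      ≈⟨ sum-cong d (λ l → trans (*-congˡ (eq l)) (solve 4 (λ x t y z → x :* (t :* y :+ z) := t :* (x :* y) :+ x :* z) refl (A i l) t (y l) (z l))) ⟩
    sumFin d (λ l → t * (A i l * y l) + A i l * z l)
      ≈⟨ sum-+ d (λ l → t * (A i l * y l)) (λ l → A i l * z l) ⟩
    sumFin d (λ l → t * (A i l * y l)) + sumFin d (λ l → A i l * z l)
      ≈⟨ +-congʳ (sum-*ˡ d t (λ l → A i l * y l)) ⟨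
    t * (A ·v y) i + (A ·v z) i ∎

  wedge-alternating : ∀ {k d d′} (A : Mat d′ d) (g : Fin k → Fin d′) →
                      AlternatingMultilinear {k} {d} (λ p → minor (λ i → A ·v p i) g)
  congruent   (wedge-alternating {k} A g) eq = Det-cong k (λ a b → ·v-cong A (eq b) (g a))
  linear      (wedge-alternating {k} A g) j t atj off = Det-linear k j t (λ a → ·v-linear A t atj (g a))
    (λ b ne a → ·v-cong A (λ l → proj₁ (off b ne l)) (g a) , ·v-cong A (λ l → proj₂ (off b ne l)) (g a))
  alternating (wedge-alternating {k} A g) adj eq = Det-alternating k adj (λ a → ·v-cong A eq (g a))

  -- Each coordinate of the left side is an alternating multilinear form in `p`, and its values on
  -- unit vectors are the entries of the compound matrix; `wedge-universal` does the rest.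
  wedge-·v : ∀ k {d} (A : Mat d d) (p : Fin k → Fin d → Carrier) S →
             wedge (λ i → A ·v p i) S ≈ (compound k A ·v wedge p) S
  wedge-·v k {d} A p S = begin
    wedge (λ i → A ·v p i) S
      ≡⟨ Det≡det k _ ⟨
    minor (λ i → A ·v p i) (basisIdx S)
      ≈⟨ wedge-universal k d (wedge-alternating A (basisIdx S)) p ⟩
    ∑ (Dim k d) (λ T → minor p (basisIdx T) * minor (λ i → A ·v unit (basisIdx T i)) (basisIdx S))
      ≈⟨ ∑-cong (Dim k d) (λ T → trans (*-comm _ _) (*-cong
           (trans (Det-cong k (λ a b → ·v-unit A (basisIdx T b) (basisIdx S a))) (reflexive (Det≡det k _)))
           (reflexive (Det≡det k _)))) ⟩
    ∑ (Dim k d) (λ T → compound k A S T * wedge p T)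
      ≡⟨ ∑≡sumFin (Dim k d) _ ⟩
    (compound k A ·v wedge p) S ∎

  -- Cauchy-Binet is `wedge-·v` applied to the columns of `B` selected by `T`: their wedge is the
  -- column `T` of the compound of `B`.
  compound-· : ∀ k {d} (A B : Mat d d) S T → compound k (A · B) S T ≈ (compound k A · compound k B) S T
  compound-· k A B S T = wedge-·v k A (λ b j → B j (basisIdx T b)) S

  compound-cong : ∀ k {d} {A B : Mat d d} → (∀ i j → A i j ≈ B i j) → ∀ S T → compound k A S T ≈ compound k B S T
  compound-cong k {d} {A} {B} eq S T = ≡.subst₂ _≈_ (Det≡det k (λ a b → A (basisIdx S a) (basisIdx T b)))
    (Det≡det k (λ a b → B (basisIdx S a) (basisIdx T b))) (Det-cong k (λ a b → eq _ _))

  wedge-cong : ∀ {k d} {p q : Fin k → Fin d → Carrier} → (∀ i s → p i s ≈ q i s) → ∀ S → wedge p S ≈ wedge q S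
  wedge-cong {k} {d} {p} {q} eq S = ≡.subst₂ _≈_ (Det≡det k (λ a b → p b (basisIdx S a)))
    (Det≡det k (λ a b → q b (basisIdx S a))) (Det-cong k (λ a b → eq b _))

  -- Orthonormality of the standard basis of the exterior power

  Orthogonal : ∀ {k d} → (Fin k → Fin d) → (Fin k → Fin d) → Set ℓ
  Orthogonal g h = minor (λ i → unit (h i)) g ≈ 0# × minor (λ i → unit (g i)) h ≈ 0#

  Det-zero-row : ∀ n {M : Mat (suc n) (suc n)} → (∀ b → M zero b ≈ 0#) → Det (suc n) M ≈ 0#
  Det-zero-row n {M} eq = trans (Det-expand n M) (∑-zero (suc n) (λ j → trans (*-congˡ (trans (*-congʳ (eq j)) (zeroˡ _))) (zeroʳ _)))

  Normal : ∀ {k d} → (Fin k → Fin d) → Set ℓ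
  Normal g = minor (λ i → unit (g i)) g ≈ 1#

  -- These minors are the entries of the compound of the identity. Two subsets containing `zero`
  -- reduce to smaller ones by expansion along the first row, two avoiding it by a shift, and a
  -- mixed pair leaves a zero row or a zero column. `Orthogonal` records both orders because
  -- `AllPairs` meets each pair once.
  combos-orthonormal : ∀ k d → All Normal (combos k d) × AllPairs Orthogonal (combos k d)
  combos-orthonormal zero    d       = Det-empty _ ∷ [] , [] ∷ []
  combos-orthonormal (suc k) zero    = [] , []
  combos-orthonormal (suc k) (suc d)
    with norm , orth ← combos-orthonormal k d | norm′ , orth′ ← combos-orthonormal (suc k) d =
    Allₚ.++⁺ (Allₚ.map⁺ (All.map (λ {g} → trans (leading g g (≡.refl , λ _ → ≡.refl) (≡.refl , λ _ → ≡.refl))) norm))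
             (Allₚ.map⁺ (All.map (λ {g} → trans (raised g g)) norm′)) ,
    AllPairsₚ.++⁺
      (AllPairsₚ.map⁺ (AllPairs.map (λ {g} {h} (e , e′) →
        trans (leading g h (≡.refl , λ _ → ≡.refl) (≡.refl , λ _ → ≡.refl)) e ,
        trans (leading h g (≡.refl , λ _ → ≡.refl) (≡.refl , λ _ → ≡.refl)) e′) orth))
      (AllPairsₚ.map⁺ (AllPairs.map (λ {g} {h} (e , e′) → trans (raised g h) e , trans (raised h g) e′) orth′))
      (Allₚ.map⁺ (All.universal (λ g → Allₚ.map⁺ (All.universal (λ h →
        Det-zero-row k {λ a b → unit (suc (h b)) _} (λ b → unit-off (λ ())) ,
        Det-zero-column (suc k) zero {λ a b → unit _ (suc (h a))} (λ a → unit-off (λ ()))) _)) _))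
    where
    -- The pattern lambdas inside `combos` have no name to refer to, so they enter through the
    -- equations that they satisfy.
    Extends : (Fin k → Fin d) → (Fin (suc k) → Fin (suc d)) → Set
    Extends g G = G zero ≡ zero × (∀ a → G (suc a) ≡ suc (g a))
    raised : ∀ (g h : Fin (suc k) → Fin d) → minor (λ i → unit (suc (h i))) (λ i → suc (g i)) ≈ minor (λ i → unit (h i)) g
    raised g h = Det-cong (suc k) (λ a b → unit-suc (h b) (g a))
    leading : ∀ (g h : Fin k → Fin d) {G H : Fin (suc k) → Fin (suc d)} →
              Extends g G → Extends h H →
              minor (λ i → unit (H i)) G ≈ minor (λ i → unit (h i)) g
    leading g h {G} {H} (eqG , eqsG) (eqH , eqsH) = begin
      minor (λ i → unit (H i)) G
        ≈⟨ Det-expand k (λ a b → unit (H b) (G a)) ⟩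
      ∑ (suc k) (λ j → sign j * (unit (H j) (G zero) * Det k (λ r s → unit (H (punchIn j s)) (G (suc r)))))
        ≈⟨ ∑-suc k _ ⟩
      sign {suc k} zero * (unit (H zero) (G zero) * Det k (λ r s → unit (H (suc s)) (G (suc r))))
        + ∑ k (λ j → sign (suc j) * (unit (H (suc j)) (G zero) * Det k (λ r s → unit (H (punchIn (suc j) s)) (G (suc r)))))
        ≈⟨ +-cong (trans (*-cong sign-zero (*-cong (trans (reflexive (≡.cong₂ unit eqH eqG)) (unit-diagonal zero))
                     (Det-cong k (λ r s → trans (reflexive (≡.cong₂ unit (eqsH s) (eqsG r))) (unit-suc (h s) (g r))))))
                     (trans (*-identityˡ _) (*-identityˡ _)))
                  (∑-zero k (λ j → trans (*-congˡ (trans (*-congʳ (trans (reflexive (≡.cong₂ unit (eqsH j) eqG)) (unit-off (λ ())))) (zeroˡ _))) (zeroʳ _))) ⟩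
      minor (λ i → unit (h i)) g + 0#
        ≈⟨ +-identityʳ _ ⟩
      minor (λ i → unit (h i)) g ∎

  orthonormal-lookup : ∀ {k d} (L : List (Fin k → Fin d)) → All Normal L → AllPairs Orthogonal L →
                       ∀ i j → minor (λ b → unit (lookup L j b)) (lookup L i) ≈ unit j i
  orthonormal-lookup (g ∷ L) (n ∷ ns) (o ∷ os) zero    zero    = trans n (sym (unit-diagonal zero))
  orthonormal-lookup (g ∷ L) (n ∷ ns) (o ∷ os) zero    (suc j) = trans (proj₁ (All.lookup o (∈-lookup j))) (sym (unit-off (λ ())))
  orthonormal-lookup (g ∷ L) (n ∷ ns) (o ∷ os) (suc i) zero    = trans (proj₂ (All.lookup o (∈-lookup i))) (sym (unit-off (λ ())))
  orthonormal-lookup (g ∷ L) (n ∷ ns) (o ∷ os) (suc i) (suc j) = trans (orthonormal-lookup L ns os i j) (sym (unit-suc j i))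

  wedge-basis : ∀ {k d} (S T : Fin (Dim k d)) → wedge {k} {d} (λ i s → I s (basisIdx T i)) S ≈ I S T
  wedge-basis {k} {d} S T = let norm , orth = combos-orthonormal k d in begin
    wedge {k} {d} (λ i s → I s (basisIdx T i)) S      ≡⟨ Det≡det k _ ⟨
    Det k (λ a b → I (basisIdx S a) (basisIdx T b))   ≈⟨ Det-cong k (λ a b → reflexive (unit≡I (basisIdx T b) (basisIdx S a))) ⟨
    minor (λ i → unit (basisIdx T i)) (basisIdx S)    ≈⟨ orthonormal-lookup (combos k d) norm orth S T ⟩
    unit T S                                          ≡⟨ unit≡I T S ⟩
    I S T                                             ∎

  compound-I : ∀ k {d} (S T : Fin (Dim k d)) → compound k {d} I S T ≈ I S T
  compound-I k {d} S T = wedge-basis {k} {d} S T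

-- Spans and elimination without decidable equality

private variable
  p q : Level
  J J′ : Set

excluded-middle : ∀ {a} {A : Set a} → ¬ ¬ Dec A
excluded-middle k = k (no (λ x → k (yes x)))

¬¬-∀Fin : ∀ n {P : Fin n → Set p} → (∀ i → ¬ ¬ P i) → ¬ ¬ (∀ i → P i)
¬¬-∀Fin zero    h k = k λ ()
¬¬-∀Fin (suc n) h k = h zero λ p₀ → ¬¬-∀Fin n (h ∘ suc) λ ps → k λ { zero → p₀ ; (suc i) → ps i }

¬¬-decidable : ∀ n (P : Fin n → Set p) → ¬ ¬ (∀ i → Dec (P i))
¬¬-decidable n P = ¬¬-∀Fin n (λ i → excluded-middle)

x∉p-x : ∀ {n} (Y : Subset n) x → x ∉ Y ∖ x
x∉p-x (y ∷ Y) zero    ()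
x∉p-x (y ∷ Y) (suc x) (there x∈) = x∉p-x Y x x∈

∣p∣≤1+∣p-x∣ : ∀ {n} (Y : Subset n) x → ∣ Y ∣ ℕ.≤ suc ∣ Y ∖ x ∣
∣p∣≤1+∣p-x∣ (inside  ∷ Y) zero    = ℕ.s≤s (ℕₚ.≤-reflexive (≡.cong ∣_∣ (≡.sym (p─⊥≡p Y))))
∣p∣≤1+∣p-x∣ (outside ∷ Y) zero    = ℕₚ.m≤n⇒m≤1+n (ℕₚ.≤-reflexive (≡.cong ∣_∣ (≡.sym (p─⊥≡p Y))))
∣p∣≤1+∣p-x∣ (inside  ∷ Y) (suc x) = ℕ.s≤s (∣p∣≤1+∣p-x∣ Y x)
∣p∣≤1+∣p-x∣ (outside ∷ Y) (suc x) = ∣p∣≤1+∣p-x∣ Y x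

positive⇒nonempty : ∀ {n} (Y : Subset n) → 0 ℕ.< ∣ Y ∣ → Nonempty Y
positive⇒nonempty {n} Y pos with nonempty? Y
... | yes ne = ne
... | no em  = ⊥-elim (ℕₚ.<⇒≢ pos (≡.sym (≡.trans (≡.cong ∣_∣ (Empty-unique em)) (∣⊥∣≡0 n))))

module LinearAlgebra {c ℓ} (F : Field c ℓ) where
  open Field F hiding (zero)
  open LinAlg commutativeRing
  open FiniteSums commutativeRing
  open IntegerCoefficients commutativeRing using (solve; _:+_; _:*_; :-_; _:-_; _:=_; con)
  open import Relation.Binary.Reasoning.Setoid setoid
  open import Algebra.Properties.Ring ring using (-‿distribˡ-*)

  cancel-nonzero : ∀ {x y} → ¬ (x ≈ 0#) → x * y ≈ 0# → y ≈ 0#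
  cancel-nonzero {x} {y} x≉0 xy≈0 with q , xq≈1 ← inverse x x≉0 = begin
    y           ≈⟨ *-identityˡ y ⟨
    1# * y      ≈⟨ *-congʳ xq≈1 ⟨
    x * q * y   ≈⟨ solve 3 (λ x q y → x :* q :* y := q :* (x :* y)) refl x q y ⟩
    q * (x * y) ≈⟨ *-congˡ xy≈0 ⟩
    q * 0#      ≈⟨ zeroʳ q ⟩
    0#          ∎

  private variable
    u v w : J → Carrier

  -- The inductive form admits generating sets that are not finite families, such as all edge
  -- vectors or all displacements; `coefficients` recovers a coefficient vector when the generators
  -- are a finite family.
  data Span {J : Set} (S : Pred (J → Carrier) p) : Pred (J → Carrier) (c ⊔ ℓ ⊔ p) where
    null : (∀ j → v j ≈ 0#) → Span S v
    term : ∀ t → S u → Span S v → (∀ j → w j ≈ t * u j + v j) → Span S w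

  module _ {S : Pred (J → Carrier) p} where

    span-gen : S u → Span S u
    span-gen s = term 1# s (null (λ _ → refl)) (λ j → sym (trans (+-identityʳ _) (*-identityˡ _)))

    span-axpy : ∀ t → Span S u → Span S v → (∀ j → w j ≈ t * u j + v j) → Span S w
    span-axpy {v = v} t (null eq) (null eq′) eq″ = null (λ j → trans (eq″ j) (trans (+-cong (trans (*-congˡ (eq j)) (zeroʳ t)) (eq′ j)) (+-identityʳ _)))
    span-axpy t (null eq) (term {u = u} {v = v} r s sp eq′) eq″ = term r s sp
      (λ j → trans (eq″ j) (trans (+-congʳ (trans (*-congˡ (eq j)) (zeroʳ t))) (trans (+-identityˡ _) (eq′ j))))
    span-axpy {v = v₀} t (term {u = u} {v = v} r s sp eq) sp′ eq″ = term (t * r) s (span-axpy t sp sp′ (λ _ → refl))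
      (λ j → trans (eq″ j) (trans (+-congʳ (*-congˡ (eq j)))
        (solve 5 (λ t r u v w → t :* (r :* u :+ v) :+ w := t :* r :* u :+ (t :* v :+ w)) refl t r (u j) (v j) (v₀ j))))

    span-+ : Span S u → Span S v → Span S (λ j → u j + v j)
    span-+ su sv = span-axpy 1# su sv (λ j → +-congʳ (sym (*-identityˡ _)))

    span-* : ∀ t → Span S u → Span S (λ j → t * u j)
    span-* t su = span-axpy t su (null {v = λ _ → 0#} (λ _ → refl)) (λ j → sym (+-identityʳ _))

    span-resp : (∀ j → v j ≈ u j) → Span S u → Span S v
    span-resp eq su = span-axpy 1# su (null {v = λ _ → 0#} (λ _ → refl)) (λ j → trans (eq j) (sym (trans (+-identityʳ _) (*-identityˡ _))))

    span-neg : Span S u → Span S (λ j → - u j)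
    span-neg su = span-resp (λ j → solve 1 (λ x → :- x := :- con (1 , 0) :* x) refl _) (span-* (- 1#) su)

    span-difference : Span S u → Span S v → Span S (λ j → u j - v j)
    span-difference su sv = span-+ su (span-neg sv)

    span-∑ : ∀ n (f : Fin n → J → Carrier) → (∀ i → Span S (f i)) → Span S (λ j → sumFin n (λ i → f i j))
    span-∑ zero    f h = null (λ _ → refl)
    span-∑ (suc n) f h = span-+ (h zero) (span-∑ n (f ∘ suc) (h ∘ suc))

  span-trans : ∀ {p q} {S : Pred (J → Carrier) p} {T : Pred (J → Carrier) q} →
               (∀ {u} → S u → Span T u) → Span S v → Span T v
  span-trans h (null eq)        = null eq
  span-trans h (term t s sp eq) = span-axpy t (h s) (span-trans h sp) eq

  Member : ∀ {N} → Subset N → (Fin N → J → Carrier) → Pred (J → Carrier) ℓ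
  Member Y x u = ∃[ e ] (e ∈ Y × ∀ j → u j ≈ x e j)

  SupportedOn : ∀ {N} → Subset N → (Fin N → Carrier) → Set ℓ
  SupportedOn Y co = ∀ e → e ∉ Y → co e ≈ 0#

  span-member : ∀ {N} {Y : Subset N} (x : Fin N → J → Carrier) {e} → e ∈ Y → Span (Member Y x) (x e)
  span-member x e∈Y = span-gen (_ , e∈Y , λ _ → refl)

  coefficients : ∀ {N} {Y : Subset N} {x : Fin N → J → Carrier} → Span (Member Y x) v →
                 ∃[ co ] (SupportedOn Y co × ∀ j → v j ≈ sumFin N (λ e → co e * x e j))
  coefficients {N = N} (null eq) = (λ _ → 0#) , (λ _ _ → refl) , λ j → trans (eq j) (sym (sum-zero N (λ _ → zeroˡ _)))
  coefficients {N = N} {Y} {x} (term {u = u} {v = v} {w = w} t (e₀ , e₀∈Y , u≈) sp eq) with co , supp , v≈ ← coefficients sp =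
    (λ e → t * I e₀ e + co e) ,
    (λ e e∉Y → trans (+-cong (trans (*-congˡ (I-off (λ { ≡.refl → e∉Y e₀∈Y }))) (zeroʳ t)) (supp e e∉Y)) (+-identityʳ _)) ,
    λ j → begin
      w j
        ≈⟨ eq j ⟩
      t * u j + v j
        ≈⟨ +-cong (*-congˡ (u≈ j)) (v≈ j) ⟩
      t * x e₀ j + sumFin N (λ e → co e * x e j)
        ≈⟨ +-congʳ (*-congˡ (sum-Iˡ N (λ e → x e j) e₀)) ⟨
      t * sumFin N (λ e → I e₀ e * x e j) + sumFin N (λ e → co e * x e j)
        ≈⟨ +-congʳ (sum-*ˡ N t _) ⟩
      sumFin N (λ e → t * (I e₀ e * x e j)) + sumFin N (λ e → co e * x e j)
        ≈⟨ sum-+ N _ _ ⟨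
      sumFin N (λ e → t * (I e₀ e * x e j) + co e * x e j)
        ≈⟨ sum-cong N (λ e → solve 4 (λ t i x c → t :* (i :* x) :+ c :* x := (t :* i :+ c) :* x) refl t _ (x e j) (co e)) ⟩
      sumFin N (λ e → (t * I e₀ e + co e) * x e j) ∎

  span-combination : ∀ {N} {Y : Subset N} {x : Fin N → J → Carrier} {co} → SupportedOn Y co →
                     (∀ j → v j ≈ sumFin N (λ e → co e * x e j)) → Span (Member Y x) v
  span-combination {N = N} {Y} {x} {co} supp eq = span-resp eq (span-∑ N (λ e j → co e * x e j) spanned)
    where
    spanned : ∀ e → Span (Member Y x) (λ j → co e * x e j)
    spanned e with e ∈? Y
    ... | yes e∈Y = span-* (co e) (span-member x e∈Y)
    ... | no  e∉Y = null (λ j → trans (*-congʳ (supp e e∉Y)) (zeroˡ _))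

  Relation : ∀ {N} → (Fin N → J → Carrier) → (Fin N → Carrier) → Set ℓ
  Relation {N = N} x co = ∀ j → sumFin N (λ e → co e * x e j) ≈ 0#

  NontrivialOn : ∀ {N} → Subset N → (Fin N → Carrier) → Set ℓ
  NontrivialOn Y co = SupportedOn Y co × ∃[ e ] (e ∈ Y × ¬ (co e ≈ 0#))

  -- Gaussian elimination, one column at a time: a column without pivot is dropped, and a pivot
  -- removes one row along with its column, so the surplus of rows persists. The search for a pivot
  -- needs zero tests, whence the double negation.
  wide-dependent : ∀ {M N} (X : Subset M) (Y : Subset N) (A : Fin N → Fin M → Carrier) →
    (∀ e f → e ∈ Y → f ∉ X → A e f ≈ 0#) → ∣ X ∣ ℕ.< ∣ Y ∣ → ¬ ¬ ∃ λ co → NontrivialOn Y co × Relation A co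
  wide-dependent [] Y A supp lt k with e₀ , e₀∈Y ← positive⇒nonempty Y lt =
    k (I e₀ , ((λ e e∉Y → I-off (λ { ≡.refl → e∉Y e₀∈Y })) , e₀ , e₀∈Y , λ eq → 1≉0 (trans (sym (I-diagonal e₀)) eq)) , λ ())
  wide-dependent {N = N} (outside ∷ X) Y A supp lt k =
    wide-dependent X Y (λ e f → A e (suc f)) (λ e f e∈Y f∉X → supp e (suc f) e∈Y (λ { (there f∈X) → f∉X f∈X })) lt
      λ { (co , nt@(off , _) , rel) → k (co , nt , λ { zero → sum-zero N (column co off) ; (suc f) → rel f }) }
    where
    column : ∀ co → SupportedOn Y co → ∀ e → co e * A e zero ≈ 0#
    column co off e with e ∈? Y
    ... | yes e∈Y = trans (*-congˡ (supp e zero e∈Y λ ())) (zeroʳ _)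
    ... | no  e∉Y = trans (*-congʳ (off e e∉Y)) (zeroˡ _)
  wide-dependent {N = N} (inside ∷ X) Y A supp lt k = ¬¬-decidable N (λ e → A e zero ≈ 0#) cases
    where
    suppˢ : ∀ e f → e ∈ Y → f ∉ X → A e (suc f) ≈ 0#
    suppˢ e f e∈Y f∉X = supp e (suc f) e∈Y (λ { (there f∈X) → f∉X f∈X })
    cases : ¬ (∀ e → Dec (A e zero ≈ 0#))
    cases dec with Finₚ.any? (λ e → (e ∈? Y) ×-dec ¬? (dec e))
    ... | no none = wide-dependent X Y (λ e f → A e (suc f)) suppˢ (ℕₚ.<-trans (ℕₚ.n<1+n _) lt)
      λ { (co , nt@(off , _) , rel) → k (co , nt , λ { zero → sum-zero N (column co off) ; (suc f) → rel f }) }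
      where
      column : ∀ co → SupportedOn Y co → ∀ e → co e * A e zero ≈ 0#
      column co off e with e ∈? Y | dec e
      ... | no  e∉Y | _       = trans (*-congʳ (off e e∉Y)) (zeroˡ _)
      ... | yes e∈Y | yes eq  = trans (*-congˡ eq) (zeroʳ _)
      ... | yes e∈Y | no  neq = ⊥-elim (none (e , e∈Y , neq))
    ... | yes (e₀ , e₀∈Y , pivot≉0) with q , pq≈1 ← inverse (A e₀ zero) pivot≉0 =
      wide-dependent X (Y ∖ e₀) A′
        (λ e f e∈ f∉X → trans (+-cong (suppˢ e f (p─q⊆p Y _ e∈) f∉X) (-‿cong (trans (*-congˡ (suppˢ e₀ f e₀∈Y f∉X)) (zeroʳ _)))) (-‿inverseʳ _))
        (ℕ.s≤s⁻¹ (ℕₚ.≤-trans lt (∣p∣≤1+∣p-x∣ Y e₀))) extend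
      where
      A′ : Fin N → Fin _ → Carrier
      A′ e f = A e (suc f) - A e zero * q * A e₀ (suc f)
      extend : ¬ ∃ λ co → NontrivialOn (Y ∖ e₀) co × Relation A′ co
      extend (co′ , (off , e₁ , e₁∈ , co′≉0) , rel) = k (co , ((λ e e∉Y → trans (co-off e (λ { ≡.refl → e∉Y e₀∈Y })) (off e (e∉Y ∘ p─q⊆p Y _))) ,
          e₁ , p─q⊆p Y _ e₁∈ , λ eq → co′≉0 (trans (sym (co-off e₁ (λ { ≡.refl → x∉p-x Y e₀ e₁∈ }))) eq)) , relation)
        where
        -- `s` is what the smaller relation leaves in the pivot column; the coefficient `- (s * q)`
        -- of the pivot row cancels it.
        s = sumFin N (λ e → co′ e * A e zero)
        co : Fin N → Carrier
        co e = co′ e + - (s * q) * I e₀ e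
        co-off : ∀ e → e₀ ≢ e → co e ≈ co′ e
        co-off e ne = trans (+-congˡ (trans (*-congˡ (I-off ne)) (zeroʳ _))) (+-identityʳ _)
        expand : ∀ f → sumFin N (λ e → co e * A e f) ≈ sumFin N (λ e → co′ e * A e f) + - (s * q) * A e₀ f
        expand f = begin
          sumFin N (λ e → (co′ e + - (s * q) * I e₀ e) * A e f)
            ≈⟨ sum-cong N (λ e → solve 4 (λ c r i a → (c :+ r :* i) :* a := c :* a :+ r :* (i :* a)) refl (co′ e) (- (s * q)) _ (A e f)) ⟩
          sumFin N (λ e → co′ e * A e f + - (s * q) * (I e₀ e * A e f))
            ≈⟨ sum-+ N _ _ ⟩
          sumFin N (λ e → co′ e * A e f) + sumFin N (λ e → - (s * q) * (I e₀ e * A e f))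
            ≈⟨ +-congˡ (trans (sym (sum-*ˡ N _ _)) (*-congˡ (sum-Iˡ N (λ e → A e f) e₀))) ⟩
          sumFin N (λ e → co′ e * A e f) + - (s * q) * A e₀ f ∎
        relation : Relation A co
        relation zero = begin
          sumFin N (λ e → co e * A e zero) ≈⟨ expand zero ⟩
          s + - (s * q) * A e₀ zero        ≈⟨ solve 3 (λ s q p → s :+ (:- (s :* q)) :* p := s :- s :* (p :* q)) refl s q (A e₀ zero) ⟩
          s - s * (A e₀ zero * q)          ≈⟨ +-congˡ (-‿cong (trans (*-congˡ pq≈1) (*-identityʳ s))) ⟩
          s - s                            ≈⟨ -‿inverseʳ s ⟩
          0#                               ∎
        relation (suc f) = begin
          sumFin N (λ e → co e * A e (suc f))
            ≈⟨ expand (suc f) ⟩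
          sumFin N (λ e → co′ e * A e (suc f)) + - (s * q) * A e₀ (suc f)
            ≈⟨ +-congˡ (solve 3 (λ s q a → (:- (s :* q)) :* a := s :* (:- (q :* a))) refl s q (A e₀ (suc f))) ⟩
          sumFin N (λ e → co′ e * A e (suc f)) + s * - (q * A e₀ (suc f))
            ≈⟨ +-congˡ (sum-*ʳ N _ _) ⟩
          sumFin N (λ e → co′ e * A e (suc f)) + sumFin N (λ e → co′ e * A e zero * - (q * A e₀ (suc f)))
            ≈⟨ sum-+ N _ _ ⟨
          sumFin N (λ e → co′ e * A e (suc f) + co′ e * A e zero * - (q * A e₀ (suc f)))
            ≈⟨ sum-cong N (λ e → solve 5 (λ c x a q b → c :* x :+ c :* a :* (:- (q :* b)) := c :* (x :- a :* q :* b)) refl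
                 (co′ e) (A e (suc f)) (A e zero) q (A e₀ (suc f))) ⟩
          sumFin N (λ e → co′ e * A′ e f)
            ≈⟨ rel f ⟩
          0# ∎

  -- The Steinitz bound: a relation among the coefficient rows of the `b e` is a relation among the
  -- `b e` themselves.
  span-dependent : ∀ {M N} (X : Subset M) (Y : Subset N) (x : Fin M → J → Carrier) (b : Fin N → J → Carrier) →
    (∀ e → e ∈ Y → Span (Member X x) (b e)) → ∣ X ∣ ℕ.< ∣ Y ∣ → ¬ ¬ ∃ λ co → NontrivialOn Y co × Relation b co
  span-dependent {M = M} {N} X Y x b spanned lt k =
    wide-dependent X Y (λ e → proj₁ (row e)) (λ e f _ → proj₁ (proj₂ (row e)) f) lt
      λ { (co , nt@(off , _) , rel) → k (co , nt , λ j → begin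
        sumFin N (λ e → co e * b e j)
          ≈⟨ sum-cong N (λ e → replace co off e j) ⟩
        sumFin N (λ e → co e * sumFin M (λ f → proj₁ (row e) f * x f j))
          ≈⟨ sum-cong N (λ e → trans (sum-*ˡ M _ _) (sum-cong M (λ f → sym (*-assoc _ _ _)))) ⟩
        sumFin N (λ e → sumFin M (λ f → co e * proj₁ (row e) f * x f j))
          ≈⟨ sum-comm N M _ ⟩
        sumFin M (λ f → sumFin N (λ e → co e * proj₁ (row e) f * x f j))
          ≈⟨ sum-cong M (λ f → trans (sym (sum-*ʳ N _ _)) (trans (*-congʳ (rel f)) (zeroˡ _))) ⟩
        sumFin M (λ f → 0#)
          ≈⟨ sum-zero M (λ _ → refl) ⟩
        0# ∎) }
    where
    row : ∀ e → ∃[ co ] (SupportedOn X co × (e ∈ Y → ∀ j → b e j ≈ sumFin M (λ f → co f * x f j)))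
    row e with e ∈? Y
    ... | no e∉Y = (λ _ → 0#) , (λ _ _ → refl) , λ e∈Y → ⊥-elim (e∉Y e∈Y)
    ... | yes e∈Y with co , off , eq ← coefficients (spanned e e∈Y) = co , off , λ _ → eq
    replace : ∀ co → SupportedOn Y co → ∀ e j → co e * b e j ≈ co e * sumFin M (λ f → proj₁ (row e) f * x f j)
    replace co off e j = case e ∈? Y of λ where
      (yes e∈Y) → *-congˡ (proj₂ (proj₂ (row e)) e∈Y j)
      (no  e∉Y) → trans (trans (*-congʳ (off e e∉Y)) (zeroˡ _)) (sym (trans (*-congʳ (off e e∉Y)) (zeroˡ _)))

  -- Closure under ring operations without inverses is what expresses that elimination stays
  -- polynomial in its input.
  record Subring {q} (A : Pred Carrier q) : Set (c ⊔ ℓ ⊔ q) where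
    field
      respects : ∀ {x y} → x ≈ y → A x → A y
      has-0    : A 0#
      has-1    : A 1#
      has-+    : ∀ {x y} → A x → A y → A (x + y)
      has-*    : ∀ {x y} → A x → A y → A (x * y)
      has-neg  : ∀ {x} → A x → A (- x)

    has-∑ : ∀ n {f : Fin n → Carrier} → (∀ i → A (f i)) → A (sumFin n f)
    has-∑ zero    h = has-0
    has-∑ (suc n) h = has-+ (h zero) (has-∑ n (h ∘ suc))

    has-I : ∀ {n} (i j : Fin n) → A (I i j)
    has-I i j with i ≟ j
    ... | yes _ = has-1
    ... | no  _ = has-0

  ·v-combination : ∀ {M L N} (P : Mat L M) (co : Fin N → Carrier) (x : Fin N → Fin M → Carrier) {z : Fin M → Carrier} →
    (∀ l → z l ≈ sumFin N (λ e → co e * x e l)) → ∀ s → (P ·v z) s ≈ sumFin N (λ e → co e * (P ·v x e) s)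
  ·v-combination {M} {L} {N} P co x {z} eq s = begin
    sumFin M (λ l → P s l * z l)
      ≈⟨ sum-cong M (λ l → trans (*-congˡ (eq l)) (sum-*ˡ N (P s l) (λ e → co e * x e l))) ⟩
    sumFin M (λ l → sumFin N (λ e → P s l * (co e * x e l)))
      ≈⟨ sum-comm M N (λ l e → P s l * (co e * x e l)) ⟩
    sumFin N (λ e → sumFin M (λ l → P s l * (co e * x e l)))
      ≈⟨ sum-cong N (λ e → trans (sum-cong M (λ l → solve 3 (λ p c x → p :* (c :* x) := c :* (p :* x)) refl (P s l) (co e) (x e l)))
                                 (sym (sum-*ˡ M (co e) (λ l → P s l * x e l)))) ⟩
    sumFin N (λ e → co e * (P ·v x e) s) ∎

  -- Since the kernel is exactly the span, membership in the span turns into equations whose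
  -- coefficients lie in `A`.
  record Eliminator {q} (A : Pred Carrier q) {N M} (Y : Subset N) (x : Fin N → Fin M → Carrier) : Set (c ⊔ ℓ ⊔ q) where
    field
      P       : Mat M M
      entries : ∀ s l → A (P s l)
      kills   : ∀ e → e ∈ Y → ∀ s → (P ·v x e) s ≈ 0#
      kernel  : ∀ z → (∀ s → (P ·v z) s ≈ 0#) → Span (Member Y x) z

    kills-span : ∀ {z} → Span (Member Y x) z → ∀ s → (P ·v z) s ≈ 0#
    kills-span {z} sp s with co , supp , eq ← coefficients sp = trans (·v-combination P co x eq s) (sum-zero N kill)
      where
      kill : ∀ e → co e * (P ·v x e) s ≈ 0#
      kill e with e ∈? Y
      ... | yes e∈Y = trans (*-congˡ (kills e e∈Y s)) (zeroʳ _)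
      ... | no  e∉Y = trans (*-congʳ (supp e e∉Y)) (zeroˡ _)

  member-tail : ∀ {N b} {Y : Subset N} {x : Fin (suc N) → J → Carrier} → Span (Member Y (x ∘ suc)) v → Span (Member (b ∷ Y) x) v
  member-tail = span-trans λ { (e , e∈Y , eq) → span-gen (suc e , there e∈Y , eq) }

  dot : ∀ {M} → (Fin M → Carrier) → (Fin M → Carrier) → Carrier
  dot {M} w y = sumFin M (λ s → w s * y s)

  Independent WeaklyIndependent : ∀ {N} → Subset N → (Fin N → J → Carrier) → Set (c ⊔ ℓ)
  Independent       Y x = ∀ co → SupportedOn Y co → Relation x co → ∀ e → co e ≈ 0#
  WeaklyIndependent Y x = ∀ co → SupportedOn Y co → Relation x co → ∀ e → ¬ ¬ (co e ≈ 0#)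

  relation-tail : ∀ {N} {x : Fin (suc N) → J → Carrier} co → Relation x co → co zero ≈ 0# → Relation (x ∘ suc) (co ∘ suc)
  relation-tail co rel eq j = trans (sym (trans (+-congʳ (trans (*-congʳ eq) (zeroˡ _))) (+-identityˡ _))) (rel j)

  -- Applying `P` to a relation kills all vectors but the first and leaves co₀ · P x₀ = 0; pairing
  -- with `weights` makes the factor of co₀ an invertible scalar. `P` is an arbitrary matrix here so
  -- that the image under `ι` of a matrix over `F` can be used.
  independent-∷ : ∀ {N M L} {Y : Subset N} (x : Fin (suc N) → Fin M → Carrier) (P : Mat L M) →
    (∀ e → e ∈ Y → ∀ s → (P ·v x (suc e)) s ≈ 0#) → (weights : Fin L → Carrier) → ¬ (dot weights (P ·v x zero) ≈ 0#) →
    Independent Y (x ∘ suc) → Independent (inside ∷ Y) x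
  independent-∷ {N} {M} {L} {Y} x P kills weights pivot≉0 strong co supp rel = λ where
      zero    → co₀≈0
      (suc e) → strong (co ∘ suc) (λ e e∉ → supp (suc e) (λ { (there e∈) → e∉ e∈ })) (relation-tail {x = x} co rel co₀≈0) e
    where
    y = P ·v x zero
    vanish : ∀ s → co zero * y s ≈ 0#
    vanish s = begin
      co zero * y s
        ≈⟨ +-identityʳ _ ⟨
      co zero * y s + 0#
        ≈⟨ +-congˡ (sum-zero N kill) ⟨
      sumFin (suc N) (λ e → co e * (P ·v x e) s)
        ≈⟨ ·v-combination P co x (λ l → sym (rel l)) s ⟨
      (P ·v (λ _ → 0#)) s
        ≈⟨ sum-zero M (λ l → zeroʳ _) ⟩
      0# ∎
      where
      kill : ∀ e → co (suc e) * (P ·v x (suc e)) s ≈ 0#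
      kill e with e ∈? Y
      ... | yes e∈Y = trans (*-congˡ (kills e e∈Y s)) (zeroʳ _)
      ... | no  e∉Y = trans (*-congʳ (supp (suc e) (λ { (there e∈) → e∉Y e∈ }))) (zeroˡ _)
    co₀≈0 : co zero ≈ 0#
    co₀≈0 = cancel-nonzero pivot≉0 (begin
      dot weights y * co zero
        ≈⟨ sum-*ʳ L (co zero) (λ s → weights s * y s) ⟩
      sumFin L (λ s → weights s * y s * co zero)
        ≈⟨ sum-zero L (λ s → trans (*-assoc _ _ _) (trans (*-congˡ (trans (*-comm _ _) (vanish s))) (zeroʳ _))) ⟩
      0# ∎)

  module Elimination {q} {A : Pred Carrier q} (subring : Subring A) where
    open Subring subring
    open Eliminator

    eliminator-[] : ∀ {M} (x : Fin 0 → Fin M → Carrier) → Eliminator A [] x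
    P       (eliminator-[] x) = I
    entries (eliminator-[] x) = has-I
    kills   (eliminator-[] x) e ()
    kernel  (eliminator-[] {M} x) z eq = null (λ j → trans (sym (sum-Iˡ M z j)) (eq j))

    eliminator-outside : ∀ {N M} {Y : Subset N} {x : Fin (suc N) → Fin M → Carrier} →
                         Eliminator A Y (x ∘ suc) → Eliminator A (outside ∷ Y) x
    P       (eliminator-outside E) = P E
    entries (eliminator-outside E) = entries E
    kills   (eliminator-outside E) (suc e) (there e∈Y) = kills E e e∈Y
    kernel  (eliminator-outside E) z eq = member-tail (kernel E z eq)

    eliminator-redundant : ∀ {N M} {Y : Subset N} {x : Fin (suc N) → Fin M → Carrier} (E : Eliminator A Y (x ∘ suc)) →
                           (∀ s → (P E ·v x zero) s ≈ 0#) → Eliminator A (inside ∷ Y) x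
    P       (eliminator-redundant E eq) = P E
    entries (eliminator-redundant E eq) = entries E
    kills   (eliminator-redundant E eq) zero    _           = eq
    kills   (eliminator-redundant E eq) (suc e) (there e∈Y) = kills E e e∈Y
    kernel  (eliminator-redundant E eq) z eq′ = member-tail (kernel E z eq′)

    -- With y = P x₀, θ = wᵀP and λ = w · y, the new matrix is the fraction-free update λP − yθ.
    eliminator-pivot : ∀ {N M} {Y : Subset N} {x : Fin (suc N) → Fin M → Carrier} (E : Eliminator A Y (x ∘ suc)) →
                       (∀ l → A (x zero l)) → (w : Fin M → Carrier) → (∀ s → A (w s)) →
                       ¬ (dot w (P E ·v x zero) ≈ 0#) → Eliminator A (inside ∷ Y) x
    eliminator-pivot {N} {M} {Y} {x} E Ax₀ w Aw pivot≉0 = record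
      { P       = P′
      ; entries = λ s l → has-+ (has-* Apivot (entries E s l)) (has-neg (has-* (Ay s) (Aθ l)))
      ; kills   = λ { zero _ s → trans (update (x zero) s) (trans (+-congˡ (-‿cong (trans (*-comm _ _) (*-congʳ (θ· (x zero)))))) (-‿inverseʳ _))
                    ; (suc e) (there e∈Y) s → trans (update (x (suc e)) s) (trans (+-cong (trans (*-congˡ (kills E e e∈Y s)) (zeroʳ _))
                        (-‿cong (trans (*-congˡ (trans (θ· _) (sum-zero M (λ s → trans (*-congˡ (kills E e e∈Y s)) (zeroʳ _))))) (zeroʳ _)))) (-‿inverseʳ _)) }
      -- If λP - yθ kills z, then P kills λz - (θ · z) x₀, which therefore lies in the span of the
      -- later vectors. Dividing by λ affects only coefficients of the span, not the entries
      -- confined to `A`.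
      ; kernel  = λ z eq → scale-back z (span-resp (λ l → solve 2 (λ a b → a := (a :- b) :+ b) refl (pivot * z l) (dot θ z * x zero l))
          (span-+ (member-tail (kernel E (λ l → pivot * z l - dot θ z * x zero l)
            (λ s → trans (split z s) (trans (sym (update z s)) (eq s)))))
          (span-* (dot θ z) (span-member x here)))) }
      where
      y = P E ·v x zero
      pivot = dot w y
      θ : Fin M → Carrier
      θ l = sumFin M (λ s → w s * P E s l)
      P′ : Mat M M
      P′ s l = pivot * P E s l - y s * θ l
      Ay : ∀ s → A (y s)
      Ay s = has-∑ M (λ l → has-* (entries E s l) (Ax₀ l))
      Apivot = has-∑ M (λ s → has-* (Aw s) (Ay s))
      Aθ : ∀ l → A (θ l)
      Aθ l = has-∑ M (λ s → has-* (Aw s) (entries E s l))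
      θ· : ∀ z → dot θ z ≈ dot w (P E ·v z)
      θ· z = begin
        sumFin M (λ l → θ l * z l)
          ≈⟨ sum-cong M (λ l → sum-*ʳ M (z l) (λ s → w s * P E s l)) ⟩
        sumFin M (λ l → sumFin M (λ s → w s * P E s l * z l))
          ≈⟨ sum-comm M M (λ l s → w s * P E s l * z l) ⟩
        sumFin M (λ s → sumFin M (λ l → w s * P E s l * z l))
          ≈⟨ sum-cong M (λ s → trans (sum-cong M (λ l → *-assoc _ _ _)) (sym (sum-*ˡ M (w s) (λ l → P E s l * z l)))) ⟩
        dot w (P E ·v z) ∎
      update : ∀ z s → (P′ ·v z) s ≈ pivot * (P E ·v z) s - y s * dot θ z
      update z s = begin
        sumFin M (λ l → (pivot * P E s l - y s * θ l) * z l)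
          ≈⟨ sum-cong M (λ l → solve 5 (λ λ′ p y t z → (λ′ :* p :- y :* t) :* z := λ′ :* (p :* z) :+ (:- y) :* (t :* z)) refl pivot (P E s l) (y s) (θ l) (z l)) ⟩
        sumFin M (λ l → pivot * (P E s l * z l) + - y s * (θ l * z l))
          ≈⟨ sum-+ M (λ l → pivot * (P E s l * z l)) (λ l → - y s * (θ l * z l)) ⟩
        sumFin M (λ l → pivot * (P E s l * z l)) + sumFin M (λ l → - y s * (θ l * z l))
          ≈⟨ +-cong (sum-*ˡ M pivot (λ l → P E s l * z l)) (sum-*ˡ M (- y s) (λ l → θ l * z l)) ⟨
        pivot * (P E ·v z) s + - y s * dot θ z
          ≈⟨ +-congˡ (-‿distribˡ-* _ _) ⟨
        pivot * (P E ·v z) s - y s * dot θ z ∎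
      split : ∀ z s → (P E ·v (λ l → pivot * z l - dot θ z * x zero l)) s ≈ pivot * (P E ·v z) s - y s * dot θ z
      split z s = begin
        sumFin M (λ l → P E s l * (pivot * z l - dot θ z * x zero l))
          ≈⟨ sum-cong M (λ l → solve 5 (λ p λ′ z d x → p :* (λ′ :* z :- d :* x) := λ′ :* (p :* z) :+ (:- d) :* (p :* x)) refl (P E s l) pivot (z l) (dot θ z) (x zero l)) ⟩
        sumFin M (λ l → pivot * (P E s l * z l) + - dot θ z * (P E s l * x zero l))
          ≈⟨ sum-+ M (λ l → pivot * (P E s l * z l)) (λ l → - dot θ z * (P E s l * x zero l)) ⟩
        sumFin M (λ l → pivot * (P E s l * z l)) + sumFin M (λ l → - dot θ z * (P E s l * x zero l))
          ≈⟨ +-cong (sum-*ˡ M pivot (λ l → P E s l * z l)) (sum-*ˡ M (- dot θ z) (λ l → P E s l * x zero l)) ⟨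
        pivot * (P E ·v z) s + - dot θ z * y s
          ≈⟨ solve 4 (λ a b d y → a :* b :+ (:- d) :* y := a :* b :- y :* d) refl pivot _ (dot θ z) (y s) ⟩
        pivot * (P E ·v z) s - y s * dot θ z ∎
      scale-back : ∀ z → Span (Member (inside ∷ Y) x) (λ l → pivot * z l) → Span (Member (inside ∷ Y) x) z
      scale-back z sp with r , pr≈1 ← inverse pivot pivot≉0 = span-resp
        (λ l → sym (trans (solve 3 (λ r p z → r :* (p :* z) := p :* r :* z) refl r pivot (z l)) (trans (*-congʳ pr≈1) (*-identityˡ _))))
        (span-* r sp)

    dot-I : ∀ {M} (s : Fin M) y → dot (I s) y ≈ y s
    dot-I {M} s y = sum-Iˡ M y s

    eliminator-exists : ∀ {N M} (Y : Subset N) (x : Fin N → Fin M → Carrier) → (∀ e → e ∈ Y → ∀ l → A (x e l)) → ¬ ¬ Eliminator A Y x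
    eliminator-exists []            x Ax k = k (eliminator-[] x)
    eliminator-exists (outside ∷ Y) x Ax k =
      eliminator-exists Y (x ∘ suc) (λ e e∈Y → Ax (suc e) (there e∈Y)) λ E → k (eliminator-outside E)
    eliminator-exists {M = M} (inside ∷ Y) x Ax k =
      eliminator-exists Y (x ∘ suc) (λ e e∈Y → Ax (suc e) (there e∈Y)) λ E →
      ¬¬-decidable M (λ s → (P E ·v x zero) s ≈ 0#) λ dec → case Finₚ.all? dec of λ where
        (yes eq) → k (eliminator-redundant E eq)
        (no neq) → let s , y≉0 = Finₚ.¬∀⟶∃¬ M _ dec neq in
          k (eliminator-pivot E (Ax zero here) (I s) (has-I s) (λ eq → y≉0 (trans (sym (dot-I s _)) eq)))

    Combinable : Set (c ⊔ ℓ ⊔ q)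
    Combinable = ∀ {M} (y : Fin M → Carrier) → (∀ s → A (y s)) →
                 Σ (Fin M → Carrier) λ w → (∀ s → A (w s)) × (dot w y ≈ 0# → ∀ s → y s ≈ 0#)

    -- Strong independence needs an invertible pivot, not merely one of several candidates that cannot
    -- all vanish; combining all candidates into a single element provides it.
    independent : Combinable → ∀ {N M} (Y : Subset N) (x : Fin N → Fin M → Carrier) → (∀ e → e ∈ Y → ∀ l → A (x e l)) →
                  WeaklyIndependent Y x → Eliminator A Y x × Independent Y x
    independent combine [] x Ax weak = eliminator-[] x , λ _ _ _ ()
    independent combine {suc N} {M} (b ∷ Y) x Ax weak
      with E , strong ← independent combine Y (x ∘ suc) (λ e e∈Y → Ax (suc e) (there e∈Y))
             (λ co supp rel e → weak (0# ◂ co) (λ { zero _ → refl ; (suc e) e∉ → supp e (e∉ ∘ there) })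
               (λ j → trans (+-cong (zeroˡ _) (rel j)) (+-identityˡ _)) (suc e)) = step b Ax weak
      where
      step : ∀ b → (∀ e → e ∈ b ∷ Y → ∀ l → A (x e l)) → WeaklyIndependent (b ∷ Y) x →
             Eliminator A (b ∷ Y) x × Independent (b ∷ Y) x
      step outside Ax weak = eliminator-outside E , λ co supp rel → λ where
        zero    → supp zero λ ()
        (suc e) → strong (co ∘ suc) (λ e e∉ → supp (suc e) (λ { (there e∈) → e∉ e∈ })) (relation-tail {x = x} co rel (supp zero λ ())) e
      step inside Ax weak = eliminator-pivot E (Ax zero here) weights Aw pivot≉0 ,
                            independent-∷ x (P E) (kills E) weights pivot≉0 strong
        where
        y = P E ·v x zero
        combination = combine y (λ s → has-∑ M (λ l → has-* (entries E s l) (Ax zero here l)))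
        weights = proj₁ combination
        Aw = proj₁ (proj₂ combination)
        pivot≉0 : ¬ (dot weights y ≈ 0#)
        -- A vanishing combination means that P x₀ vanishes, hence that x₀ lies in the span of the
        -- later vectors. This is a relation with coefficient -1 at x₀, which already weak
        -- independence excludes.
        pivot≉0 eq with co , supp , x₀≈ ← coefficients (kernel E (x zero) (proj₂ (proj₂ combination) eq)) =
          weak (- 1# ◂ co) (λ { zero e∉ → ⊥-elim (e∉ here) ; (suc e) e∉ → supp e (e∉ ∘ there) })
            (λ j → trans (+-congˡ (sym (x₀≈ j))) (trans (+-congʳ (trans (sym (-‿distribˡ-* _ _)) (-‿cong (*-identityˡ _)))) (-‿inverseˡ _)))
            zero (λ eq′ → 1≉0 (trans (solve 0 (con (1 , 0) := :- (:- con (1 , 0))) refl) (trans (-‿cong eq′) -0#≈0#)))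
          where open import Algebra.Properties.Ring ring using (-0#≈0#)

-- Polynomials at a generic point

module Polynomials {c₁ ℓ₁ c₂ ℓ₂} (F : Field c₁ ℓ₁) (K : Field c₂ ℓ₂) (ι : Field.Carrier F → Field.Carrier K)
                   (embedding : IsFieldEmbedding F K ι) (N : ℕ) where
  private module F = Field F
  open Field K hiding (zero)
  open LinAlg commutativeRing
  open FiniteSums commutativeRing
  open IntegerCoefficients commutativeRing using (solve; _:+_; _:*_; _:=_)
  open RingMorphisms F.rawRing rawRing using (module IsRingHomomorphism)
  open IsRingHomomorphism embedding
  open import Relation.Binary.Reasoning.Setoid setoid
  open import Algebra.Properties.Ring ring using (-1*x≈-x)

  Exponents : Set
  Exponents = Fin N → ℕ

  Terms : Set c₁
  Terms = List (F.Carrier × Exponents)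

  Point : Set c₂
  Point = Fin N → Carrier

  monomial : Exponents → Point → Carrier
  monomial e τ = prodFin N (λ i → pow (τ i) (e i))

  evaluate : Terms → Point → Carrier
  evaluate L τ = sumList (map (λ x → ι (proj₁ x) * monomial (proj₂ x) τ) L)

  Apart : F.Carrier × Exponents → F.Carrier × Exponents → Set
  Apart x y = ∃[ i ] (proj₂ x i ≢ proj₂ y i)

  prod-cong : ∀ n {f g : Fin n → Carrier} → (∀ i → f i ≈ g i) → prodFin n f ≈ prodFin n g
  prod-cong zero    eq = refl
  prod-cong (suc n) eq = *-cong (eq zero) (prod-cong n (eq ∘ suc))

  prod-* : ∀ n (f g : Fin n → Carrier) → prodFin n (λ i → f i * g i) ≈ prodFin n f * prodFin n g
  prod-* zero    f g = sym (*-identityˡ _)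
  prod-* (suc n) f g = trans (*-congˡ (prod-* n (f ∘ suc) (g ∘ suc)))
    (solve 4 (λ a b c d → (a :* b) :* (c :* d) := (a :* c) :* (b :* d)) refl _ _ _ _)

  prod-one : ∀ n {f : Fin n → Carrier} → (∀ i → f i ≈ 1#) → prodFin n f ≈ 1#
  prod-one zero    eq = refl
  prod-one (suc n) eq = trans (*-cong (eq zero) (prod-one n (eq ∘ suc))) (*-identityˡ _)

  prod-single : ∀ n (f : Fin n → Carrier) i → (∀ j → j ≢ i → f j ≈ 1#) → prodFin n f ≈ f i
  prod-single (suc n) f zero    off = trans (*-congˡ (prod-one n (λ j → off (suc j) λ ()))) (*-identityʳ _)
  prod-single (suc n) f (suc i) off =
    trans (*-cong (off zero λ ()) (prod-single n (f ∘ suc) i (λ j ne → off (suc j) (ne ∘ Finₚ.suc-injective)))) (*-identityˡ _)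

  pow-+ : ∀ x a b → pow x (a ℕ.+ b) ≈ pow x a * pow x b
  pow-+ x zero    b = sym (*-identityˡ _)
  pow-+ x (suc a) b = trans (*-congˡ (pow-+ x a b)) (sym (*-assoc _ _ _))

  monomial-+ : ∀ e e′ τ → monomial (λ i → e i ℕ.+ e′ i) τ ≈ monomial e τ * monomial e′ τ
  monomial-+ e e′ τ = trans (prod-cong N (λ i → pow-+ (τ i) (e i) (e′ i))) (prod-* N _ _)

  evaluate-++ : ∀ L M τ → evaluate (L ++ M) τ ≈ evaluate L τ + evaluate M τ
  evaluate-++ []      M τ = sym (+-identityˡ _)
  evaluate-++ (x ∷ L) M τ = trans (+-congˡ (evaluate-++ L M τ)) (sym (+-assoc _ _ _))

  times : F.Carrier × Exponents → Terms → Terms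
  times (a , e) = map (λ { (b , e′) → a F.* b , λ i → e i ℕ.+ e′ i })

  evaluate-times : ∀ a e L τ → evaluate (times (a , e) L) τ ≈ (ι a * monomial e τ) * evaluate L τ
  evaluate-times a e []             τ = sym (zeroʳ _)
  evaluate-times a e ((b , e′) ∷ L) τ = begin
    ι (a F.* b) * monomial (λ i → e i ℕ.+ e′ i) τ + evaluate (times (a , e) L) τ
      ≈⟨ +-cong (*-cong (*-homo a b) (monomial-+ e e′ τ)) (evaluate-times a e L τ) ⟩
    ι a * ι b * (monomial e τ * monomial e′ τ) + ι a * monomial e τ * evaluate L τ
      ≈⟨ solve 5 (λ a b m m′ r → a :* b :* (m :* m′) :+ a :* m :* r := a :* m :* (b :* m′ :+ r)) refl (ι a) (ι b) _ _ _ ⟩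
    ι a * monomial e τ * (ι b * monomial e′ τ + evaluate L τ) ∎

  product : Terms → Terms → Terms
  product []      M = []
  product (x ∷ L) M = times x M ++ product L M

  evaluate-product : ∀ L M τ → evaluate (product L M) τ ≈ evaluate L τ * evaluate M τ
  evaluate-product []            M τ = sym (zeroˡ _)
  evaluate-product ((a , e) ∷ L) M τ = begin
    evaluate (times (a , e) M ++ product L M) τ
      ≈⟨ evaluate-++ (times (a , e) M) (product L M) τ ⟩
    evaluate (times (a , e) M) τ + evaluate (product L M) τ
      ≈⟨ +-cong (evaluate-times a e M τ) (evaluate-product L M τ) ⟩
    ι a * monomial e τ * evaluate M τ + evaluate L τ * evaluate M τ
      ≈⟨ distribʳ _ _ _ ⟨
    (ι a * monomial e τ + evaluate L τ) * evaluate M τ ∎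

  -- `AlgIndep` speaks of lists with pairwise distinct exponents, so like terms are merged. Only
  -- exponents are compared; a coefficient that cancels simply stays in the list.
  insert : F.Carrier × Exponents → Terms → Terms
  insert x [] = x ∷ []
  insert (a , e) ((b , e′) ∷ L) with Finₚ.all? (λ i → e i ℕ.≟ e′ i)
  ... | yes _ = (a F.+ b , e′) ∷ L
  ... | no  _ = (b , e′) ∷ insert (a , e) L

  evaluate-insert : ∀ x L τ → evaluate (insert x L) τ ≈ ι (proj₁ x) * monomial (proj₂ x) τ + evaluate L τ
  evaluate-insert x [] τ = refl
  evaluate-insert (a , e) ((b , e′) ∷ L) τ with Finₚ.all? (λ i → e i ℕ.≟ e′ i)
  ... | yes eq = begin
    ι (a F.+ b) * monomial e′ τ + evaluate L τ
      ≈⟨ +-congʳ (trans (*-congʳ (+-homo a b)) (distribʳ _ _ _)) ⟩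
    ι a * monomial e′ τ + ι b * monomial e′ τ + evaluate L τ
      ≈⟨ +-assoc _ _ _ ⟩
    ι a * monomial e′ τ + (ι b * monomial e′ τ + evaluate L τ)
      ≈⟨ +-congʳ (*-congˡ (prod-cong N (λ i → reflexive (≡.cong (pow (τ i)) (≡.sym (eq i)))))) ⟩
    ι a * monomial e τ + (ι b * monomial e′ τ + evaluate L τ) ∎
  ... | no  _ = trans (+-congˡ (evaluate-insert (a , e) L τ))
    (solve 3 (λ a b c → a :+ (b :+ c) := b :+ (a :+ c)) refl _ _ _)

  insert-apart : ∀ {y} x {L} → Apart y x → All (Apart y) L → All (Apart y) (insert x L)
  insert-apart x {[]} ap [] = ap ∷ []
  insert-apart {y} (a , e) {(b , e′) ∷ L} ap (ap′ ∷ aps) with Finₚ.all? (λ i → e i ℕ.≟ e′ i)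
  ... | yes _ = ap′ ∷ aps
  ... | no  _ = ap′ ∷ insert-apart {y} (a , e) ap aps

  insert-pairwise : ∀ x {L} → AllPairs Apart L → AllPairs Apart (insert x L)
  insert-pairwise x {[]} [] = [] ∷ []
  insert-pairwise (a , e) {(b , e′) ∷ L} (ap ∷ aps) with Finₚ.all? (λ i → e i ℕ.≟ e′ i)
  ... | yes _  = ap ∷ aps
  ... | no neq with i , ne ← Finₚ.¬∀⟶∃¬ N _ (λ i → e i ℕ.≟ e′ i) neq =
    insert-apart {b , e′} (a , e) (i , ne ∘ ≡.sym) ap ∷ insert-pairwise (a , e) aps

  normalise : Terms → Terms
  normalise = foldr insert []

  normalise-pairwise : ∀ L → AllPairs Apart (normalise L)
  normalise-pairwise []      = []
  normalise-pairwise (x ∷ L) = insert-pairwise x (normalise-pairwise L)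

  evaluate-normalise : ∀ L τ → evaluate (normalise L) τ ≈ evaluate L τ
  evaluate-normalise []      τ = refl
  evaluate-normalise (x ∷ L) τ = trans (evaluate-insert x (normalise L) τ) (+-congˡ (evaluate-normalise L τ))

  evaluate-zero : ∀ {L} → All (λ x → proj₁ x F.≈ F.0#) L → ∀ τ → evaluate L τ ≈ 0#
  evaluate-zero []         τ = refl
  evaluate-zero (eq ∷ eqs) τ = trans (+-cong (trans (*-congʳ (trans (⟦⟧-cong eq) 0#-homo)) (zeroˡ _)) (evaluate-zero eqs τ)) (+-identityʳ _)

  -- The list must represent the function at every point, not only at the generic one;
  -- specialisation depends on this.
  Polynomial : (Point → Carrier) → Set _
  Polynomial f = ∃[ L ] (∀ τ → f τ ≈ evaluate L τ)

  poly-resp : ∀ {f g} → (∀ τ → g τ ≈ f τ) → Polynomial f → Polynomial g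
  poly-resp eq (L , p) = L , λ τ → trans (eq τ) (p τ)

  poly-+ : ∀ {f g} → Polynomial f → Polynomial g → Polynomial (λ τ → f τ + g τ)
  poly-+ (L , p) (M , q) = L ++ M , λ τ → trans (+-cong (p τ) (q τ)) (sym (evaluate-++ L M τ))

  poly-* : ∀ {f g} → Polynomial f → Polynomial g → Polynomial (λ τ → f τ * g τ)
  poly-* (L , p) (M , q) = product L M , λ τ → trans (*-cong (p τ) (q τ)) (sym (evaluate-product L M τ))

  poly-ι : ∀ a → Polynomial (λ _ → ι a)
  poly-ι a = (a , λ _ → 0) ∷ [] , λ τ → sym (trans (+-identityʳ _) (trans (*-congˡ (prod-one N (λ _ → refl))) (*-identityʳ _)))

  poly-0 : Polynomial (λ _ → 0#)
  poly-0 = [] , λ _ → refl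

  poly-1 : Polynomial (λ _ → 1#)
  poly-1 = poly-resp (λ _ → sym 1#-homo) (poly-ι F.1#)

  poly-neg : ∀ {f} → Polynomial f → Polynomial (λ τ → - f τ)
  poly-neg p = poly-resp (λ τ → trans (sym (-1*x≈-x _)) (*-congʳ (sym (trans (-‿homo _) (-‿cong 1#-homo))))) (poly-* (poly-ι (F.- F.1#)) p)

  only : Fin N → ℕ → Exponents
  only i n j = if ⌊ i ≟ j ⌋ then n else 0

  only-self : ∀ i n → only i n i ≡ n
  only-self i n with i ≟ i
  ... | yes _ = ≡.refl
  ... | no ne = ⊥-elim (ne ≡.refl)

  poly-var : ∀ i → Polynomial (λ τ → τ i)
  poly-var i = (F.1# , only i 1) ∷ [] , λ τ → sym (begin
    ι F.1# * monomial (only i 1) τ + 0# ≈⟨ +-identityʳ _ ⟩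
    ι F.1# * monomial (only i 1) τ      ≈⟨ *-cong 1#-homo (prod-single N _ i (off τ)) ⟩
    1# * pow (τ i) (only i 1 i)         ≈⟨ *-identityˡ _ ⟩
    pow (τ i) (only i 1 i)              ≡⟨ ≡.cong (pow (τ i)) (only-self i 1) ⟩
    τ i * 1#                            ≈⟨ *-identityʳ _ ⟩
    τ i                                 ∎)
    where
    off : ∀ τ j → j ≢ i → pow (τ j) (only i 1 j) ≈ 1#
    off τ j ne with i ≟ j
    ... | yes eq = ⊥-elim (ne (≡.sym eq))
    ... | no _   = refl

  poly-∑ : ∀ n {f : Fin n → Point → Carrier} → (∀ i → Polynomial (f i)) → Polynomial (λ τ → sumFin n (λ i → f i τ))
  poly-∑ zero    p = poly-0
  poly-∑ (suc n) p = poly-+ (p zero) (poly-∑ n (p ∘ suc))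

  poly-alt : ∀ {n} (j : Fin n) {f} → Polynomial f → Polynomial (λ τ → alt j (f τ))
  poly-alt zero    p = p
  poly-alt (suc j) p = poly-neg (poly-alt j p)

  poly-det : ∀ n {M : Point → Mat n n} → (∀ a b → Polynomial (λ τ → M τ a b)) → Polynomial (λ τ → det n (M τ))
  poly-det zero    p = poly-1
  poly-det (suc n) p = poly-∑ (suc n) (λ j → poly-alt j (poly-* (p zero j) (poly-det n (λ r s → p (suc r) (punchIn j s)))))

  -- The values taken by a polynomial simultaneously at all points of a family.
  Value : ∀ {i} {Index : Set i} → (Index → Point) → Carrier → Set _
  Value points x = ∃[ f ] (Polynomial f × ∀ i → f (points i) ≈ x)

  value-subring : ∀ {i} {Index : Set i} (points : Index → Point) → LinearAlgebra.Subring K (Value points)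
  value-subring points = record
    { respects = λ { eq (f , p , v) → f , p , λ i → trans (v i) eq }
    ; has-0    = _ , poly-0 , λ _ → refl
    ; has-1    = _ , poly-1 , λ _ → refl
    ; has-+    = λ { (f , p , v) (g , q , u) → _ , poly-+ p q , λ i → +-cong (v i) (u i) }
    ; has-*    = λ { (f , p , v) (g , q , u) → _ , poly-* p q , λ i → *-cong (v i) (u i) }
    ; has-neg  = λ { (f , p , v) → _ , poly-neg p , λ i → -‿cong (v i) }
    }

  module AtGenericPoint (t : Point) (generic : AlgIndep F K ι t) where

    -- After merging like terms, algebraic independence makes every coefficient zero, and then the
    -- value is zero at any point.
    vanish-everywhere : ∀ {f} → Polynomial f → f t ≈ 0# → ∀ τ → f τ ≈ 0#
    vanish-everywhere (L , p) eq τ = trans (p τ) (trans (sym (evaluate-normalise L τ)) (evaluate-zero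
      (generic (normalise L) (normalise-pairwise L) (trans (evaluate-normalise L t) (trans (sym (p t)) eq))) τ))

    degree : Fin N → Terms → ℕ
    degree i = foldr (λ x d → proj₂ x i ℕ.⊔ d) 0

    degree-bound : ∀ i L → All (λ x → proj₂ x i ℕ.≤ degree i L) L
    degree-bound i []      = []
    degree-bound i (x ∷ L) = ℕₚ.m≤m⊔n _ _ ∷ All.map (λ le → ℕₚ.≤-trans le (ℕₚ.m≤n⊔m (proj₂ x i) _)) (degree-bound i L)

    -- Multiplying g by a power of one variable beyond the degree of f separates the monomials of f from those of g.
    separate : Fin N → ∀ {f g} → Polynomial f → Polynomial g →
               ∃[ h ] (Polynomial h × (f t + h t * g t ≈ 0# → f t ≈ 0# × g t ≈ 0#))
    separate i {f} {g} (L , p) (M , q) = h , h-poly , split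
      where
      L′ = normalise L
      M′ = normalise M
      -- One more than the degree of `f` in the variable `i`: every shifted exponent exceeds all
      -- those of `f` there.
      n = suc (degree i L′)
      shifted = times (F.1# , only i n) M′
      h : Point → Carrier
      h τ = ι F.1# * monomial (only i n) τ
      h-poly : Polynomial h
      h-poly = (F.1# , only i n) ∷ [] , λ τ → sym (+-identityʳ _)
      pairwise : AllPairs Apart (L′ ++ shifted)
      pairwise = AllPairsₚ.++⁺ (normalise-pairwise L)
        (AllPairsₚ.map⁺ (AllPairs.map (λ { {x} {y} (j , ne) → j , λ eq → ne (ℕₚ.+-cancelˡ-≡ (only i n j) _ _ eq) }) (normalise-pairwise M)))
        (All.map (λ le → Allₚ.map⁺ (All.universal (λ y → i , overshoot (proj₂ y i) le) M′)) (degree-bound i L′))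
        where
        overshoot : ∀ {a} b → a ℕ.≤ degree i L′ → a ≢ only i n i ℕ.+ b
        overshoot b le eq = ℕₚ.<⇒≱ (ℕ.s≤s le) (ℕₚ.≤-trans (ℕₚ.m≤m+n n b)
          (ℕₚ.≤-reflexive (≡.sym (≡.trans eq (≡.cong (ℕ._+ b) (only-self i n))))))
      split : f t + h t * g t ≈ 0# → f t ≈ 0# × g t ≈ 0#
      split eq = trans (p t) (trans (sym (evaluate-normalise L t)) (evaluate-zero (Allₚ.++⁻ˡ L′ zeros) t)) ,
                 trans (q t) (trans (sym (evaluate-normalise M t)) (evaluate-zero
                   (All.map (λ eq → F.trans (F.sym (F.*-identityˡ _)) eq) (Allₚ.map⁻ (Allₚ.++⁻ʳ L′ zeros))) t))
        where
        zeros : All (λ x → proj₁ x F.≈ F.0#) (L′ ++ shifted)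
        zeros = generic (L′ ++ shifted) pairwise (begin
          evaluate (L′ ++ shifted) t              ≈⟨ evaluate-++ L′ shifted t ⟩
          evaluate L′ t + evaluate shifted t      ≈⟨ +-cong (trans (evaluate-normalise L t) (sym (p t)))
                                                       (trans (evaluate-times F.1# (only i n) M′ t) (*-congˡ (trans (evaluate-normalise M t) (sym (q t))))) ⟩
          f t + h t * g t                         ≈⟨ eq ⟩
          0#                                      ∎)

    open LinearAlgebra K using (dot; Subring; module Elimination)

    Generic : Carrier → Set _
    Generic = Value {Index = Unit} (λ _ → t)

    generic-subring : Subring Generic
    generic-subring = value-subring (λ _ → t)

    -- Once the tail is condensed into a single scalar only two candidates remain, and `separate`
    -- joins them. Each condensed scalar is again a polynomial value at `t`, so the recursion can
    -- continue.
    combinable : Fin N → Elimination.Combinable generic-subring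
    combinable i {zero}  y Ay = (λ ()) , (λ ()) , λ _ ()
    combinable i {suc M} y Ay
      with w , Aw , decide ← combinable i (y ∘ suc) (Ay ∘ suc)
      with f , p , v ← Ay zero
      with g , q , u ← Subring.has-∑ generic-subring M (λ s → Subring.has-* generic-subring (Aw s) (Ay (suc s)))
      with h , r , sep ← separate i p q
      = (1# ◂ λ s → h t * w s) ,
        (λ { zero → Subring.has-1 generic-subring ; (suc s) → Subring.has-* generic-subring (h , r , λ _ → refl) (Aw s) }) ,
        λ eq → let f≈0 , g≈0 = sep (trans (sym (expand (v ∗) (u ∗))) eq) in
          λ { zero → trans (sym (v ∗)) f≈0 ; (suc s) → decide (trans (sym (u ∗)) g≈0) s }
      where
      expand : ∀ {x z h} {w : Fin M → Carrier} → x ≈ y zero → z ≈ dot w (y ∘ suc) → 1# * y zero + sumFin M (λ s → h * w s * y (suc s)) ≈ x + h * z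
      expand eq eq′ = +-cong (trans (*-identityˡ _) (sym eq))
        (trans (sum-cong M (λ s → *-assoc _ _ _)) (trans (sym (sum-*ˡ M _ _)) (*-congˡ (sym eq′))))

-- Bases surviving a field extension

module Extension {c₁ ℓ₁ c₂ ℓ₂} (F : Field c₁ ℓ₁) (K : Field c₂ ℓ₂) (ι : Field.Carrier F → Field.Carrier K)
                 (embedding : IsFieldEmbedding F K ι) where
  private
    module F = Field F
    module K = Field K
    module LF where
      open LinAlg F.commutativeRing public
      open LinearAlgebra F public
      open FiniteSums F.commutativeRing public
    module LK where
      open LinAlg K.commutativeRing public
      open LinearAlgebra K public
      open FiniteSums K.commutativeRing public
  open RingMorphisms F.rawRing K.rawRing using (module IsRingHomomorphism)
  open IsRingHomomorphism embedding
  open import Relation.Binary.Reasoning.Setoid K.setoid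

  ι-nonzero : ∀ {x} → ¬ (x F.≈ F.0#) → ¬ (ι x K.≈ K.0#)
  ι-nonzero x≉0 ιx≈0 with y , xy≈1 ← F.inverse _ x≉0 = K.1≉0 (begin
    K.1#          ≈⟨ 1#-homo ⟨
    ι F.1#        ≈⟨ ⟦⟧-cong xy≈1 ⟨
    ι (_ F.* y)   ≈⟨ *-homo _ y ⟩
    ι _ K.* ι y   ≈⟨ K.*-congʳ ιx≈0 ⟩
    K.0# K.* ι y  ≈⟨ K.zeroˡ _ ⟩
    K.0#          ∎)

  ι-- : ∀ x y → ι (x F.- y) K.≈ ι x K.- ι y
  ι-- x y = K.trans (+-homo _ _) (K.+-congˡ (-‿homo _))

  ι-∑ : ∀ n (f : Fin n → F.Carrier) → ι (LF.sumFin n f) K.≈ LK.sumFin n (ι ∘ f)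
  ι-∑ zero    f = 0#-homo
  ι-∑ (suc n) f = K.trans (+-homo _ _) (K.+-congˡ (ι-∑ n (f ∘ suc)))

  ι-I : ∀ {n} (i j : Fin n) → ι (LF.I i j) K.≈ LK.I i j
  ι-I i j with i ≟ j
  ... | yes _ = 1#-homo
  ... | no _  = 0#-homo

  ι-·v : ∀ {m n} (A : LF.Mat m n) v s → ι ((A LF.·v v) s) K.≈ ((λ i j → ι (A i j)) LK.·v (ι ∘ v)) s
  ι-·v {n = n} A v s = K.trans (ι-∑ n _) (LK.sum-cong n (λ l → *-homo _ _))

  ι-alt : ∀ {n} (j : Fin n) x → ι (LF.alt j x) K.≈ LK.alt j (ι x)
  ι-alt zero    x = K.refl
  ι-alt (suc j) x = K.trans (-‿homo _) (K.-‿cong (ι-alt j x))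

  ι-det : ∀ n (M : LF.Mat n n) → ι (LF.det n M) K.≈ LK.det n (λ i j → ι (M i j))
  ι-det zero    M = 1#-homo
  ι-det (suc n) M = K.trans (ι-∑ (suc n) (λ j → LF.alt j (M zero j F.* LF.det n (minor j)))) (LK.sum-cong (suc n) λ j → begin
    ι (LF.alt j (M zero j F.* LF.det n (minor j)))           ≈⟨ ι-alt j (M zero j F.* LF.det n (minor j)) ⟩
    LK.alt j (ι (M zero j F.* LF.det n (minor j)))           ≈⟨ alt≈ j (K.trans (*-homo _ _) (K.*-congˡ (ι-det n (minor j)))) ⟩
    LK.alt j (ι (M zero j) K.* LK.det n (λ r s → ι (minor j r s))) ∎)
    where
    minor : Fin (suc n) → LF.Mat n n
    minor j r s = M (suc r) (punchIn j s)
    alt≈ : ∀ {n} (j : Fin n) {x y} → x K.≈ y → LK.alt j x K.≈ LK.alt j y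
    alt≈ zero    eq = eq
    alt≈ (suc j) eq = K.-‿cong (alt≈ j eq)

  -- Independence over `F` is what `HasDim` asks for, independence over `K` is what the count of
  -- points uses. `generator` keeps the basis inside the generating family, so that its vectors
  -- remain displacements of closed walks.
  record Basis {N D} (G : Fin N → Fin D → F.Carrier) : Set (c₁ ⊔ ℓ₁ ⊔ c₂ ⊔ ℓ₂) where
    field
      size         : ℕ
      vector       : Fin size → Fin D → F.Carrier
      generator    : ∀ l → ∃[ e ] vector l ≡ G e
      spans        : ∀ e → LF.Span (LF.Member ⊤ vector) (G e)
      independent  : LF.Independent ⊤ vector
      independentᴷ : LK.Independent ⊤ (λ l s → ι (vector l s))

  -- A generator is added when the current elimination matrix does not kill it. The image of that
  -- matrix under `ι` kills the earlier vectors over `K` and, since `ι` preserves being nonzero,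
  -- still moves the new one; the same test thus certifies independence over both fields.
  basis-exists : ∀ {N D} (G : Fin N → Fin D → F.Carrier) → ¬ ¬ Basis G
  basis-exists {N} {D} G k = extend N G λ { (B , _) → k B }
    where
    everything : LF.Subring (λ _ → Unit)
    everything = record
      { respects = λ _ _ → ∗ ; has-0 = ∗ ; has-1 = ∗
      ; has-+ = λ _ _ → ∗ ; has-* = λ _ _ → ∗ ; has-neg = λ _ → ∗ }
    open LF.Elimination everything
    open LF.Eliminator
    extend : ∀ N (G : Fin N → Fin D → F.Carrier) → ¬ ¬ (Σ[ B ∈ Basis G ] LF.Eliminator (λ _ → Unit) ⊤ (Basis.vector B))
    extend zero G k = k (record { size = 0 ; vector = λ () ; generator = λ () ; spans = λ () ; independent = λ _ _ _ () ; independentᴷ = λ _ _ _ () } , eliminator-[] _)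
    extend (suc N) G k = extend N (G ∘ suc) λ { (B , E) →
      ¬¬-decidable D (λ s → (P E LF.·v G zero) s F.≈ F.0#) λ dec → case Finₚ.all? dec of λ where
        (yes eq) → k (record
          { size         = Basis.size B
          ; vector       = Basis.vector B
          ; generator    = λ l → let e , eq = Basis.generator B l in suc e , eq
          ; spans        = λ { zero → kernel E (G zero) eq ; (suc e) → Basis.spans B e }
          ; independent  = Basis.independent B
          ; independentᴷ = Basis.independentᴷ B
          } , E)
        (no neq) → let s , y≉0 = Finₚ.¬∀⟶∃¬ D _ dec neq in k (enlarge B E s y≉0) }
      where
      enlarge : ∀ (B : Basis (G ∘ suc)) (E : LF.Eliminator (λ _ → Unit) ⊤ (Basis.vector B)) s → ¬ ((P E LF.·v G zero) s F.≈ F.0#) →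
                Σ[ B ∈ Basis G ] LF.Eliminator (λ _ → Unit) ⊤ (Basis.vector B)
      enlarge B E s y≉0 = record
          { size         = suc (Basis.size B)
          ; vector       = vectors
          ; generator    = λ { zero → zero , ≡.refl ; (suc l) → let e , eq = Basis.generator B l in suc e , eq }
          ; spans        = λ { zero → LF.span-gen (zero , here , λ _ → F.refl) ; (suc e) → LF.member-tail {x = vectors} (Basis.spans B e) }
          ; independent  = LF.independent-∷ vectors (P E) (kills E) (LF.I s) pivot≉0 (Basis.independent B)
          ; independentᴷ = LK.independent-∷ (λ l s → ι (vectors l s)) (λ i j → ι (P E i j))
              (λ e e∈ s → K.trans (K.sym (ι-·v (P E) (Basis.vector B e) s)) (K.trans (⟦⟧-cong (kills E e e∈ s)) 0#-homo))
              (LK.I s) pivotᴷ≉0 (Basis.independentᴷ B)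
          } , eliminator-pivot {x = vectors} E (λ _ → ∗) (LF.I s) (λ _ → ∗) pivot≉0
        where
        vectors = G zero ◂ Basis.vector B
        pivot≉0 : ¬ (LF.dot (LF.I s) (P E LF.·v G zero) F.≈ F.0#)
        pivot≉0 eq = y≉0 (F.trans (F.sym (LF.sum-Iˡ D _ s)) eq)
        pivotᴷ≉0 : ¬ (LK.dot (LK.I s) ((λ i j → ι (P E i j)) LK.·v (ι ∘ G zero)) K.≈ K.0#)
        pivotᴷ≉0 eq = ι-nonzero y≉0 (K.trans (ι-·v (P E) (G zero) s) (K.trans (K.sym (LK.sum-Iˡ D _ s)) eq))

-- Enumerated subsets and families indexed by blocks

enumerate : ∀ {n} (Y : Subset n) → Fin ∣ Y ∣ → Fin n
enumerate (inside  ∷ Y) zero    = zero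
enumerate (inside  ∷ Y) (suc a) = suc (enumerate Y a)
enumerate (outside ∷ Y) a       = suc (enumerate Y a)

enumerate-∈ : ∀ {n} (Y : Subset n) a → enumerate Y a ∈ Y
enumerate-∈ (inside  ∷ Y) zero    = here
enumerate-∈ (inside  ∷ Y) (suc a) = there (enumerate-∈ Y a)
enumerate-∈ (outside ∷ Y) a       = there (enumerate-∈ Y a)

enumerate-injective : ∀ {n} (Y : Subset n) {a b} → enumerate Y a ≡ enumerate Y b → a ≡ b
enumerate-injective (inside  ∷ Y) {zero}  {zero}  eq = ≡.refl
enumerate-injective (inside  ∷ Y) {suc a} {suc b} eq = ≡.cong suc (enumerate-injective Y (Finₚ.suc-injective eq))
enumerate-injective (outside ∷ Y) eq = enumerate-injective Y (Finₚ.suc-injective eq)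

enumerate-surjective : ∀ {n} (Y : Subset n) {v} → v ∈ Y → ∃[ a ] enumerate Y a ≡ v
enumerate-surjective (inside  ∷ Y) here       = zero , ≡.refl
enumerate-surjective (inside  ∷ Y) (there v∈) with a , eq ← enumerate-surjective Y v∈ = suc a , ≡.cong suc eq
enumerate-surjective (outside ∷ Y) (there v∈) with a , eq ← enumerate-surjective Y v∈ = a , ≡.cong suc eq

joinΣ : ∀ n (s : Fin n → ℕ) i → Fin (s i) → Fin (sumℕ n s)
joinΣ (suc n) s zero    l = l ↑ˡ sumℕ n (s ∘ suc)
joinΣ (suc n) s (suc i) l = s zero ↑ʳ joinΣ n (s ∘ suc) i l

splitΣ : ∀ n (s : Fin n → ℕ) → Fin (sumℕ n s) → Σ[ i ∈ Fin n ] Fin (s i)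
splitΣ (suc n) s b with splitAt (s zero) b
... | inj₁ l = zero , l
... | inj₂ b′ with i , l ← splitΣ n (s ∘ suc) b′ = suc i , l

splitΣ-joinΣ : ∀ n (s : Fin n → ℕ) i l → splitΣ n s (joinΣ n s i l) ≡ (i , l)
splitΣ-joinΣ (suc n) s zero    l rewrite Finₚ.splitAt-↑ˡ (s zero) l (sumℕ n (s ∘ suc)) = ≡.refl
splitΣ-joinΣ (suc n) s (suc i) l
  rewrite Finₚ.splitAt-↑ʳ (s zero) (sumℕ n (s ∘ suc)) (joinΣ n (s ∘ suc) i l)
        | splitΣ-joinΣ n (s ∘ suc) i l = ≡.refl

joinΣ-splitΣ : ∀ n (s : Fin n → ℕ) b → joinΣ n s (proj₁ (splitΣ n s b)) (proj₂ (splitΣ n s b)) ≡ b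
joinΣ-splitΣ (suc n) s b with splitAt (s zero) b in eq
... | inj₁ l  = Finₚ.splitAt⁻¹-↑ˡ eq
... | inj₂ b′ = ≡.trans (≡.cong (s zero ↑ʳ_) (joinΣ-splitΣ n (s ∘ suc) b′)) (Finₚ.splitAt⁻¹-↑ʳ eq)

-- Indexing a p × D block followed by c blocks of sizes s.
module Blocks (p D c : ℕ) (s : Fin c → ℕ) where

  index₁ : Fin p → Fin D → Fin (p ℕ.* D ℕ.+ sumℕ c s)
  index₁ q T = combine q T ↑ˡ sumℕ c s

  index₂ : ∀ i → Fin (s i) → Fin (p ℕ.* D ℕ.+ sumℕ c s)
  index₂ i l = (p ℕ.* D) ↑ʳ joinΣ c s i l

  index-cases : ∀ j → (∃[ q ] ∃[ T ] index₁ q T ≡ j) ⊎ (∃[ i ] ∃[ l ] index₂ i l ≡ j)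
  index-cases j with splitAt (p ℕ.* D) j in eq
  ... | inj₁ a = inj₁ (_ , _ , ≡.trans (≡.cong (_↑ˡ sumℕ c s) (Finₚ.combine-remQuot {p} D a)) (Finₚ.splitAt⁻¹-↑ˡ eq))
  ... | inj₂ b = inj₂ (_ , _ , ≡.trans (≡.cong ((p ℕ.* D) ↑ʳ_) (joinΣ-splitΣ c s b)) (Finₚ.splitAt⁻¹-↑ʳ eq))

  module _ {a} {A : Set a} (f : Fin p → Fin D → A) (g : ∀ i → Fin (s i) → A) where

    block : Fin (p ℕ.* D ℕ.+ sumℕ c s) → A
    block j = [ (λ a → f (proj₁ (remQuot D a)) (proj₂ (remQuot {p} D a))) , (λ b → g (proj₁ (splitΣ c s b)) (proj₂ (splitΣ c s b))) ]′ (splitAt (p ℕ.* D) j)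

    block-index₁ : ∀ q T → block (index₁ q T) ≡ f q T
    block-index₁ q T rewrite Finₚ.splitAt-↑ˡ (p ℕ.* D) (combine q T) (sumℕ c s) =
      ≡.cong (λ i → f (proj₁ i) (proj₂ i)) (Finₚ.remQuot-combine q T)

    block-index₂ : ∀ i l → block (index₂ i l) ≡ g i l
    block-index₂ i l rewrite Finₚ.splitAt-↑ʳ (p ℕ.* D) (sumℕ c s) (joinΣ c s i l) | splitΣ-joinΣ c s i l = ≡.refl

    block-elim : ∀ {ℓ} (P : A → Set ℓ) → (∀ q T → P (f q T)) → (∀ i l → P (g i l)) → ∀ j → P (block j)
    block-elim P h₁ h₂ j with splitAt (p ℕ.* D) j
    ... | inj₁ a = h₁ _ _
    ... | inj₂ b = h₂ _ _

module BlockSums {c ℓ} (R : CommutativeRing c ℓ) where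
  open CommutativeRing R hiding (zero)
  open LinAlg R

  sum-splitAt : ∀ m n (f : Fin (m ℕ.+ n) → Carrier) → sumFin (m ℕ.+ n) f ≈ sumFin m (λ i → f (i ↑ˡ n)) + sumFin n (λ j → f (m ↑ʳ j))
  sum-splitAt zero    n f = sym (+-identityˡ _)
  sum-splitAt (suc m) n f = trans (+-congˡ (sum-splitAt m n (f ∘ suc))) (sym (+-assoc _ _ _))

  sum-joinΣ : ∀ n (s : Fin n → ℕ) (f : Fin (sumℕ n s) → Carrier) →
              sumFin (sumℕ n s) f ≈ sumFin n (λ i → sumFin (s i) (λ l → f (joinΣ n s i l)))
  sum-joinΣ zero    s f = refl
  sum-joinΣ (suc n) s f = trans (sum-splitAt (s zero) _ f) (+-congˡ (sum-joinΣ n (s ∘ suc) _))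

-- Walks and components of gain graphs

select : ∀ {n} {P : Fin n → Set p} → (∀ i → Dec (P i)) → Subset n
select dec = tabulate (⌊_⌋ ∘ dec)

∈-select⁺ : ∀ {n} {P : Fin n → Set p} (dec : ∀ i → Dec (P i)) {i} → P i → i ∈ select dec
∈-select⁺ dec {i} pᵢ = lookup⇒[]= i _ (≡.trans (lookup∘tabulate (⌊_⌋ ∘ dec) i) (true-on i pᵢ))
  where
  true-on : ∀ i → _ → ⌊ dec i ⌋ ≡ inside
  true-on i pᵢ with dec i
  ... | yes _ = ≡.refl
  ... | no ¬p = ⊥-elim (¬p pᵢ)

∈-select⁻ : ∀ {n} {P : Fin n → Set p} (dec : ∀ i → Dec (P i)) {i} → i ∈ select dec → P i
∈-select⁻ dec {i} i∈ with dec i | ≡.trans (≡.sym (lookup∘tabulate (⌊_⌋ ∘ dec) i)) ([]=⇒lookup i∈)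
... | yes pᵢ | _ = pᵢ
... | no _   | ()

avoid : ∀ {n} c → (Fin c → Fin n) → Subset n → Subset n
avoid zero    f Y = Y
avoid (suc c) f Y = avoid c (f ∘ suc) (Y ∖ f zero)

∈-avoid⁺ : ∀ {n} c (f : Fin c → Fin n) {Y : Subset n} {v} → v ∈ Y → (∀ i → f i ≢ v) → v ∈ avoid c f Y
∈-avoid⁺ zero    f v∈ ne = v∈
∈-avoid⁺ (suc c) f v∈ ne = ∈-avoid⁺ c (f ∘ suc) (x∈p∧x≢y⇒x∈p-y v∈ (ne zero ∘ ≡.sym)) (ne ∘ suc)

∈-avoid⁻ : ∀ {n} c (f : Fin c → Fin n) {Y : Subset n} {v} → v ∈ avoid c f Y → v ∈ Y × (∀ i → f i ≢ v)
∈-avoid⁻ zero    f v∈ = v∈ , λ ()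
∈-avoid⁻ (suc c) f {Y} {v} v∈ with v∈′ , ne ← ∈-avoid⁻ c (f ∘ suc) v∈ =
  p─q⊆p Y _ v∈′ , λ { zero ≡.refl → x∉p-x Y (f zero) v∈′ ; (suc i) → ne i }

-- With the bases of the components as `f` and the vertices of X as `Y`, this counts the vertices
-- that carry a full copy of the representation space.
∣avoid∣ : ∀ {n} c (f : Fin c → Fin n) {Y : Subset n} → (∀ i → f i ∈ Y) → (∀ i j → i ≢ j → f i ≢ f j) →
          ∣ avoid c f Y ∣ ℕ.+ c ≡ ∣ Y ∣
∣avoid∣ zero    f f∈ inj = ℕₚ.+-identityʳ _
∣avoid∣ (suc c) f {Y} f∈ inj = ≡.trans (ℕₚ.+-suc _ c) (≡.trans
  (≡.cong suc (∣avoid∣ c (f ∘ suc) (λ i → x∈p∧x≢y⇒x∈p-y (f∈ (suc i)) (inj (suc i) zero λ ())) (λ i j ne → inj (suc i) (suc j) (ne ∘ Finₚ.suc-injective))))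
  (ℕₚ.≤-antisym (x∈p⇒∣p-x∣<∣p∣ (f∈ zero)) (∣p∣≤1+∣p-x∣ Y (f zero))))

module GainWalks {a b} (Γ : Group a b) {n m : ℕ} (src tgt : Fin m → Fin n) (ψ : Fin m → Group.Carrier Γ) where
  open Group Γ
  open GainGraph Γ src tgt ψ
  open import Algebra.Properties.Group Γ using (⁻¹-anti-homo-∙; ⁻¹-involutive; ε⁻¹≈ε)

  private variable
    X Y : Subset m
    u v w : Fin n

  Touches : Subset m → Fin n → Set
  Touches X v = ∃[ e ] (e ∈ X × (src e ≡ v ⊎ tgt e ≡ v))

  ∈V⁺ : Touches X v → v ∈ V X
  ∈V⁺ {X} = ∈-select⁺ (λ v → Finₚ.any? (λ e → (e ∈? X) ×-dec ((src e ≟ v) ⊎-dec (tgt e ≟ v))))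

  ∈V⁻ : v ∈ V X → Touches X v
  ∈V⁻ {X = X} = ∈-select⁻ (λ v → Finₚ.any? (λ e → (e ∈? X) ×-dec ((src e ≟ v) ⊎-dec (tgt e ≟ v))))

  V-mono : X ⊆ Y → V X ⊆ V Y
  V-mono X⊆Y v∈ with e , e∈ , end ← ∈V⁻ v∈ = ∈V⁺ (e , X⊆Y e∈ , end)

  src∈V : ∀ {e} → e ∈ X → src e ∈ V X
  src∈V e∈ = ∈V⁺ (_ , e∈ , inj₁ ≡.refl)

  tgt∈V : ∀ {e} → e ∈ X → tgt e ∈ V X
  tgt∈V e∈ = ∈V⁺ (_ , e∈ , inj₂ ≡.refl)

  infixr 5 _⊕_
  _⊕_ : Walk X u v → Walk X v w → Walk X u w
  []         ⊕ q = q
  fwd e e∈ p ⊕ q = fwd e e∈ (p ⊕ q)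
  bwd e e∈ p ⊕ q = bwd e e∈ (p ⊕ q)

  gain-⊕ : (p : Walk X u v) (q : Walk X v w) → gain (p ⊕ q) ≈ gain p ∙ gain q
  gain-⊕ []           q = sym (identityˡ _)
  gain-⊕ (fwd e e∈ p) q = trans (∙-congˡ (gain-⊕ p q)) (sym (assoc _ _ _))
  gain-⊕ (bwd e e∈ p) q = trans (∙-congˡ (gain-⊕ p q)) (sym (assoc _ _ _))

  reverse : Walk X u v → Walk X v u
  reverse []           = []
  reverse (fwd e e∈ p) = reverse p ⊕ bwd e e∈ []
  reverse (bwd e e∈ p) = reverse p ⊕ fwd e e∈ []

  gain-reverse : (p : Walk X u v) → gain (reverse p) ≈ gain p ⁻¹
  gain-reverse []           = sym ε⁻¹≈ε
  gain-reverse (fwd e e∈ p) = trans (gain-⊕ (reverse p) (bwd e e∈ [])) (trans (∙-cong (gain-reverse p) (identityʳ _)) (sym (⁻¹-anti-homo-∙ _ _)))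
  gain-reverse (bwd e e∈ p) = trans (gain-⊕ (reverse p) (fwd e e∈ []))
    (trans (∙-cong (gain-reverse p) (trans (identityʳ _) (sym (⁻¹-involutive _)))) (sym (⁻¹-anti-homo-∙ _ _)))

  -- The component of one edge is peeled off and the rest, which has fewer edges, is treated by
  -- induction. Reachability is decided under double negation, as the result serves a contradiction
  -- only.
  components-exist : ∀ X → ¬ ¬ ∃ (Components X)
  components-exist X = bounded ∣ X ∣ X ℕₚ.≤-refl
    where
    bounded : ∀ N X → ∣ X ∣ ℕ.≤ N → ¬ ¬ ∃ (Components X)
    bounded N X le k with nonempty? X
    ... | no empty = k (0 , record
      { comp = λ () ; base = λ () ; base∈ = λ () ; nonempty = λ () ; connected = λ () ; sub = λ ()
      ; cover = λ e e∈ → ⊥-elim (empty (e , e∈)) ; disjoint = λ () })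
    bounded zero    X le k | yes (e₀ , e₀∈) = ℕₚ.n≮0 (ℕₚ.≤-trans (x∈p⇒∣p-x∣<∣p∣ e₀∈) le)
    bounded (suc N) X le k | yes (e₀ , e₀∈) = ¬¬-decidable n (Walk X (src e₀)) λ dec → peel dec
      where
      peel : ¬ (∀ v → Dec (Walk X (src e₀) v))
      peel dec = bounded N rest (ℕ.s≤s⁻¹ (ℕₚ.≤-trans (p⊂q⇒∣p∣<∣q∣ (rest⊆ , e₀ , e₀∈ , λ e₀∈r → proj₂ (rest⁻ e₀∈r) [])) le)) prepend
        where
        reached rest : Subset m
        -- Testing the source suffices: an edge with reachable source has a reachable target through
        -- itself, and conversely.
        reached = select (λ e → (e ∈? X) ×-dec dec (src e))
        rest    = select (λ e → (e ∈? X) ×-dec ¬? (dec (src e)))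
        reached⁺ : ∀ {e} → e ∈ X → Walk X (src e₀) (src e) → e ∈ reached
        reached⁺ e∈ p = ∈-select⁺ (λ e → (e ∈? X) ×-dec dec (src e)) (e∈ , p)
        reached⁻ : ∀ {e} → e ∈ reached → e ∈ X × Walk X (src e₀) (src e)
        reached⁻ = ∈-select⁻ (λ e → (e ∈? X) ×-dec dec (src e))
        rest⁺ : ∀ {e} → e ∈ X → ¬ Walk X (src e₀) (src e) → e ∈ rest
        rest⁺ e∈ ¬p = ∈-select⁺ (λ e → (e ∈? X) ×-dec ¬? (dec (src e))) (e∈ , ¬p)
        rest⁻ : ∀ {e} → e ∈ rest → e ∈ X × ¬ Walk X (src e₀) (src e)
        rest⁻ = ∈-select⁻ (λ e → (e ∈? X) ×-dec ¬? (dec (src e)))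
        rest⊆ : rest ⊆ X
        rest⊆ e∈ = proj₁ (rest⁻ e∈)
        reachable : v ∈ V reached → Walk X (src e₀) v
        reachable v∈ with ∈V⁻ v∈
        ... | e , e∈ , inj₁ ≡.refl = proj₂ (reached⁻ e∈)
        ... | e , e∈ , inj₂ ≡.refl = let e∈X , p = reached⁻ e∈ in p ⊕ fwd e e∈X []
        -- The prefix walk is carried along as evidence that the source of each further edge is
        -- reachable from `src e₀`.
        restrict : Walk X (src e₀) u → Walk X u v → Walk reached u v
        restrict p []           = []
        restrict p (fwd e e∈ q) = fwd e (reached⁺ e∈ p) (restrict (p ⊕ fwd e e∈ []) q)
        restrict p (bwd e e∈ q) = bwd e (reached⁺ e∈ (p ⊕ bwd e e∈ [])) (restrict (p ⊕ bwd e e∈ []) q)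
        separated : v ∈ V reached → v ∉ V rest
        separated v∈ v∈′ with ∈V⁻ v∈′
        ... | f , f∈ , inj₁ ≡.refl = proj₂ (rest⁻ f∈) (reachable v∈)
        ... | f , f∈ , inj₂ ≡.refl = let f∈X , unreached = rest⁻ f∈ in unreached (reachable v∈ ⊕ bwd f f∈X [])
        prepend : ¬ ∃ (Components rest)
        prepend (c , C) = k (suc c , record
          { comp      = reached ◂ comp
          ; base      = src e₀ ◂ base
          ; base∈     = λ { zero → src∈V (reached⁺ e₀∈ []) ; (suc i) → base∈ i }
          ; nonempty  = λ { zero → e₀ , reached⁺ e₀∈ [] ; (suc i) → nonempty i }
          ; connected = λ { zero u v u∈ v∈ → restrict (reachable u∈) (reverse (reachable u∈) ⊕ reachable v∈) ; (suc i) → connected i }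
          ; sub       = λ { zero e∈ → proj₁ (reached⁻ e∈) ; (suc i) e∈ → rest⊆ (sub i e∈) }
          ; cover     = covered
          ; disjoint  = λ { zero zero ne → ⊥-elim (ne ≡.refl)
                          ; zero (suc j) _ v v∈ v∈′ → separated v∈ (V-mono (sub j) v∈′)
                          ; (suc i) zero _ v v∈ v∈′ → separated v∈′ (V-mono (sub i) v∈)
                          ; (suc i) (suc j) ne → disjoint i j (ne ∘ ≡.cong suc) }
          })
          where
          open Components C
          covered : ∀ e → e ∈ X → ∃[ i ] (e ∈ (reached ◂ comp) i)
          covered e e∈ with dec (src e)
          ... | yes p = zero , reached⁺ e∈ p
          ... | no ¬p with i , e∈i ← cover e (rest⁺ e∈ ¬p) = suc i , e∈i

-- The space spanned by the edges of a gain graph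

-- Bases are distinct vertices, so |V(X)| = x + c with x other vertices, and the truncated
-- subtraction in f loses nothing.
scaled-difference : ∀ k x y {z} → x ℕ.+ y ≡ z → k ℕ.* z ℕ.∸ k ℕ.* y ≡ x ℕ.* k
scaled-difference k x y ≡.refl rewrite ℕₚ.*-distribˡ-+ k x y =
  ≡.trans (ℕₚ.m+n∸n≡m (k ℕ.* x) (k ℕ.* y)) (ℕₚ.*-comm k x)

module GainSpace {a b c ℓ} (Γ : Group a b) (F : Field c ℓ) (D : ℕ)
                 (R : Group.Carrier Γ → LinAlg.Mat (Field.commutativeRing F) D D) (representation : IsRepresentation Γ F D R)
                 {n m : ℕ} (src tgt : Fin m → Fin n) (ψ : Fin m → Group.Carrier Γ) where
  private module Γ = Group Γ
  open Field F hiding (zero)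
  open LinAlg commutativeRing
  open LinearAlgebra F
  open FiniteSums commutativeRing
  open IntegerCoefficients commutativeRing using (solve; _:+_; _:*_; :-_; _:-_; _:=_)
  open Determinants commutativeRing using (·v-linear; double-zero)
  open import Relation.Binary.Reasoning.Setoid setoid
  open IsRepresentation representation
  open GainGraph Γ src tgt ψ
  open GainWalks Γ src tgt ψ

  Vector : Set c
  Vector = Fin D → Carrier

  basis : Fin D → Vector
  basis T s = I T s

  basis-spans : ∀ z → Span (Member ⊤ basis) z
  basis-spans z = span-combination (λ e e∉ → ⊥-elim (e∉ ∈⊤)) (λ s → sym (sum-Iʳ D z s))

  Linear : ((J → Carrier) → (J′ → Carrier)) → Set _
  Linear L = ∀ t {x y z} → (∀ j → z j ≈ t * x j + y j) → ∀ j → L z j ≈ t * L x j + L y j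

  module _ {L : (J → Carrier) → (J′ → Carrier)} (linear : Linear L) where

    linear-null : ∀ {v} → (∀ j → v j ≈ 0#) → ∀ j → L v j ≈ 0#
    linear-null eq j = double-zero (trans (linear 1# (λ j → trans (eq j) (sym (trans (+-cong (trans (*-identityˡ _) (eq j)) (eq j)) (+-identityʳ _)))) j)
                                          (+-congʳ (*-identityˡ _)))

    linear-cong : ∀ {v w} → (∀ j → v j ≈ w j) → ∀ j → L v j ≈ L w j
    linear-cong {v} {w} eq j = trans (linear 1# {w} {λ _ → 0#} (λ j → trans (eq j) (sym (trans (+-identityʳ _) (*-identityˡ _)))) j)
      (trans (+-cong (*-identityˡ _) (linear-null (λ _ → refl) j)) (+-identityʳ _))

    span-linear : ∀ {S : Pred (J → Carrier) p} {T : Pred (J′ → Carrier) q} {v} →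
                  (∀ {u} → S u → Span T (L u)) → Span S v → Span T (L v)
    span-linear h (null eq)        = null (linear-null eq)
    span-linear h (term t s sp eq) = span-axpy t (h s) (span-linear h sp) (linear t eq)

  act : Γ.Carrier → Vector → Vector
  act γ z = R γ ·v z

  act-linear : ∀ γ → Linear (act γ)
  act-linear γ t eq = ·v-linear (R γ) t eq

  act-cong : ∀ {γ δ} → γ Γ.≈ δ → ∀ z s → act γ z s ≈ act δ z s
  act-cong eq z s = sum-cong D (λ l → *-congʳ (cong eq s l))

  act-ε : ∀ z s → act Γ.ε z s ≈ z s
  act-ε z s = trans (sum-cong D (λ l → *-congʳ (unit s l))) (sum-Iˡ D z s)

  act-∙ : ∀ γ δ z s → act (γ Γ.∙ δ) z s ≈ act γ (act δ z) s
  act-∙ γ δ z s = begin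
    sumFin D (λ l → R (γ Γ.∙ δ) s l * z l)
      ≈⟨ sum-cong D (λ l → trans (*-congʳ (hom γ δ s l)) (sum-*ʳ D (z l) (λ r → R γ s r * R δ r l))) ⟩
    sumFin D (λ l → sumFin D (λ r → R γ s r * R δ r l * z l))
      ≈⟨ sum-comm D D (λ l r → R γ s r * R δ r l * z l) ⟩
    sumFin D (λ r → sumFin D (λ l → R γ s r * R δ r l * z l))
      ≈⟨ sum-cong D (λ r → trans (sum-cong D (λ l → *-assoc _ _ _)) (sym (sum-*ˡ D (R γ s r) (λ l → R δ r l * z l)))) ⟩
    sumFin D (λ r → R γ s r * act δ z r) ∎

  at : Fin n → Vector → Fin n × Fin D → Carrier
  at v z (u , s) = I v u * z s

  at-linear : ∀ v → Linear (at v)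
  at-linear v t eq (u , s) = trans (*-congˡ (eq s)) (solve 4 (λ i t x y → i :* (t :* x :+ y) := t :* (i :* x) :+ i :* y) refl (I v u) t _ _)

  -- For a non-loop edge this is the vector x̂ with `z` in place of the wedge of the points, for a
  -- loop its negative. Allowing any gain between any two vertices lets whole walks be treated like
  -- single edges.
  transport : Fin n → Fin n → Γ.Carrier → Vector → Fin n × Fin D → Carrier
  transport u v γ z j = at v z j - at u (act γ z) j

  transport-linear : ∀ u v γ → Linear (transport u v γ)
  transport-linear u v γ t eq j = trans (+-cong (at-linear v t eq j) (-‿cong (at-linear u t (act-linear γ t eq) j)))
    (solve 5 (λ t x y x′ y′ → (t :* x :+ y) :- (t :* x′ :+ y′) := t :* (x :- x′) :+ (y :- y′)) refl t _ _ _ _)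

  transport-cong : ∀ u v {γ δ} → γ Γ.≈ δ → ∀ z j → transport u v γ z j ≈ transport u v δ z j
  transport-cong u v eq z j = +-congˡ (-‿cong (linear-cong (at-linear u) (act-cong eq z) j))

  transport-ε : ∀ v z j → transport v v Γ.ε z j ≈ 0#
  transport-ε v z j = trans (+-congˡ (-‿cong (linear-cong (at-linear v) (act-ε z) j))) (-‿inverseʳ _)

  -- Telescoping through `v`, where the two occurrences of `act δ z` cancel.
  transport-∙ : ∀ u v w γ δ z j → transport u w (γ Γ.∙ δ) z j ≈ transport v w δ z j + transport u v γ (act δ z) j
  transport-∙ u v w γ δ z j = trans (+-congˡ (-‿cong (linear-cong (at-linear u) (act-∙ γ δ z) j)))
    (solve 3 (λ x y z → x :- z := (x :- y) :+ (y :- z)) refl (at w z j) (at v (act δ z) j) _)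

  transport-⁻¹ : ∀ u v γ z j → transport v u (γ Γ.⁻¹) z j ≈ - transport u v γ (act (γ Γ.⁻¹) z) j
  transport-⁻¹ u v γ z j = inverseˡ-unique _ _ (begin
    transport v u (γ Γ.⁻¹) z j + transport u v γ (act (γ Γ.⁻¹) z) j ≈⟨ transport-∙ u v u γ (γ Γ.⁻¹) z j ⟨
    transport u u (γ Γ.∙ γ Γ.⁻¹) z j                                ≈⟨ transport-cong u u (Γ.inverseʳ γ) z j ⟩
    transport u u Γ.ε z j                                           ≈⟨ transport-ε u z j ⟩
    0#                                                              ∎)
    where open import Algebra.Properties.Group +-group using (inverseˡ-unique)

  edge-vector : Fin m → Vector → Fin n × Fin D → Carrier
  edge-vector e = transport (src e) (tgt e) (ψ e)

  EdgeVector : Subset m → Pred (Fin n × Fin D → Carrier) _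
  EdgeVector X u = ∃[ e ] (e ∈ X × ∃[ z ] (∀ j → u j ≈ edge-vector e z j))

  edge-mono : ∀ {X Y} → X ⊆ Y → ∀ {v} → Span (EdgeVector X) v → Span (EdgeVector Y) v
  edge-mono X⊆Y = span-trans λ { (e , e∈ , z , eq) → span-gen (e , X⊆Y e∈ , z , eq) }

  walk-span : ∀ {X u v} (w : Walk X u v) z → Span (EdgeVector X) (transport u v (gain w) z)
  walk-span {u = u} []   z = null (transport-ε u z)
  walk-span {v = v} (fwd e e∈ w) z = span-resp (transport-∙ _ _ v (ψ e) (gain w) z)
    (span-+ (walk-span w z) (span-gen (e , e∈ , _ , λ _ → refl)))
  walk-span {v = v} (bwd e e∈ w) z = span-resp
    (λ j → trans (transport-∙ _ _ v (ψ e Γ.⁻¹) (gain w) z j) (+-congˡ (transport-⁻¹ _ _ (ψ e) _ j)))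
    (span-difference (walk-span w z) (span-gen (e , e∈ , _ , λ _ → refl)))

  displacement : Γ.Carrier → Vector → Vector
  displacement γ z s = act γ z s - z s

  displacement-linear : ∀ γ → Linear (displacement γ)
  displacement-linear γ t eq s = trans (+-cong (act-linear γ t eq s) (-‿cong (eq s)))
    (solve 5 (λ t x y x′ y′ → (t :* x :+ y) :- (t :* x′ :+ y′) := t :* (x :- x′) :+ (y :- y′)) refl t _ _ _ _)

  Displacement : Pred Γ.Carrier p → Pred Vector _
  Displacement Y u = ∃[ γ ] (Y γ × ∃[ z ] (∀ s → u s ≈ displacement γ z s))

  transport-loop : ∀ v γ z j → transport v v γ z j ≈ - at v (displacement γ z) j
  transport-loop v γ z (u , s) = solve 3 (λ i x y → i :* x :- i :* y := :- (i :* (y :- x))) refl (I v u) (z s) (act γ z s)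

  -- Every walk factors, up to a displacement of the base, through the chosen potentials, so the
  -- fundamental closed walks generate all displacements.
  module Fundamental {X : Subset m} (connected : Connected X) (b₀ : Fin n) (b₀∈ : b₀ ∈ V X) where

    -- A total potential: the gain of a chosen walk from `b₀`, with the dummy value ε off V(X). At
    -- `b₀` the empty walk is forced, so that the potential disappears from statements about closed
    -- walks.
    path : ∀ v → Σ[ γ ∈ Γ.Carrier ] (v ∈ V X → Σ[ w ∈ Walk X b₀ v ] (gain w ≡ γ)) × (b₀ ≡ v → γ ≡ Γ.ε)
    path v with b₀ ≟ v
    ... | yes ≡.refl = Γ.ε , (λ _ → [] , ≡.refl) , λ _ → ≡.refl
    ... | no ne with v ∈? V X
    ...   | yes v∈ = gain (connected b₀ v b₀∈ v∈) , (λ _ → connected b₀ v b₀∈ v∈ , ≡.refl) , λ eq → ⊥-elim (ne eq)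
    ...   | no v∉  = Γ.ε , (λ v∈ → ⊥-elim (v∉ v∈)) , λ _ → ≡.refl

    potential : Fin n → Γ.Carrier
    potential v = proj₁ (path v)

    -- The fundamental closed walk: out to the source, along `e`, back from the target. Edges
    -- outside `X` receive the empty walk, so that the generators can be indexed by all edges.
    loop : ∀ e → Walk X b₀ b₀
    loop e with e ∈? X
    ... | no _   = []
    ... | yes e∈ = proj₁ (proj₁ (proj₂ (path (src e))) (src∈V e∈)) ⊕ fwd e e∈ [] ⊕ reverse (proj₁ (proj₁ (proj₂ (path (tgt e))) (tgt∈V e∈)))

    gain-loop : ∀ {e} → e ∈ X → gain (loop e) Γ.∙ potential (tgt e) Γ.≈ potential (src e) Γ.∙ ψ e
    gain-loop {e} e∈ with e ∈? X
    ... | no e∉ = ⊥-elim (e∉ e∈)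
    ... | yes e∈′ with p , eqₚ ← proj₁ (proj₂ (path (src e))) (src∈V e∈′) | q , eq ← proj₁ (proj₂ (path (tgt e))) (tgt∈V e∈′) =
      Γ.trans (Γ.∙-congʳ (Γ.trans (gain-⊕ p _) (Γ.∙-cong (Γ.reflexive eqₚ) (Γ.∙-congˡ (Γ.trans (gain-reverse q) (Γ.⁻¹-cong (Γ.reflexive eq)))))))
      (Γ.trans (Γ.assoc _ _ _) (Γ.∙-congˡ (Γ.trans (Γ.assoc _ _ _) (Γ.trans (Γ.∙-congˡ (Γ.inverseˡ _)) (Γ.identityʳ _)))))

    generator : Fin (m ℕ.* D) → Vector
    generator a = let e , T = remQuot D a in displacement (gain (loop e)) (basis T)

    generator-displacement : ∀ a → Displacement (⟨ X ⟩at b₀) (generator a)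
    generator-displacement a = let e , T = remQuot {m} D a in _ , (loop e , Γ.refl) , basis T , λ _ → refl

    loop-span : ∀ e z → Span (Member ⊤ generator) (displacement (gain (loop e)) z)
    loop-span e z = span-linear (displacement-linear (gain (loop e)))
      (λ { (T , _ , eq) → span-resp (linear-cong (displacement-linear (gain (loop e))) eq) (member T) }) (basis-spans z)
      where
      member : ∀ T → Span (Member ⊤ generator) (displacement (gain (loop e)) (basis T))
      member T = ≡.subst (λ i → Span (Member ⊤ generator) (displacement (gain (loop (proj₁ i))) (basis (proj₂ i))))
        (Finₚ.remQuot-combine e T) (span-member generator {combine e T} ∈⊤)

    -- By `gain-loop` this is the displacement of `act (potential (tgt e)) z` by the fundamental
    -- closed walk of `e`.
    edge-span : ∀ {e} → e ∈ X → ∀ z →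
                Span (Member ⊤ generator) (λ s → act (potential (src e)) (act (ψ e) z) s - act (potential (tgt e)) z s)
    edge-span {e} e∈ z = span-resp
      (λ s → +-congʳ (trans (sym (act-∙ _ _ z s)) (trans (sym (act-cong (gain-loop e∈) z s)) (act-∙ _ _ z s))))
      (loop-span e (act (potential (tgt e)) z))

    -- The differences of `edge-span` telescope along the walk. A backward edge contributes the
    -- negative of one, taken at the image of the remaining vector under the inverse gain.
    walk-displacement : ∀ {u v} (w : Walk X u v) z →
      Span (Member ⊤ generator) (λ s → act (potential u) (act (gain w) z) s - act (potential v) z s)
    walk-displacement {u} []   z = null (λ s → trans (+-congʳ (linear-cong (act-linear (potential u)) (act-ε z) s)) (-‿inverseʳ _))
    walk-displacement (fwd e e∈ w) z = span-resp
      (λ s → trans (+-congʳ (linear-cong (act-linear _) (act-∙ (ψ e) (gain w) z) s)) (solve 3 (λ x y z → x :- z := (x :- y) :+ (y :- z)) refl _ _ _))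
      (span-+ (edge-span e∈ (act (gain w) z)) (walk-displacement w z))
    walk-displacement (bwd e e∈ w) z = span-resp
      (λ s → trans (+-cong (linear-cong (act-linear _) (act-∙ (ψ e Γ.⁻¹) (gain w) z) s) refl)
        (trans (solve 3 (λ x y z → x :- z := (y :- z) :- (y :- x)) refl _ (act (potential (src e)) (act (gain w) z) s) _)
               (+-congˡ (-‿cong (+-congʳ (linear-cong (act-linear _) (λ r → trans (sym (act-ε _ r))
                 (trans (sym (act-cong (Γ.inverseʳ (ψ e)) _ r)) (act-∙ _ _ _ r))) s))))))
      (span-difference (walk-displacement w z) (edge-span e∈ (act (ψ e Γ.⁻¹) (act (gain w) z))))

    displacement-span : ∀ {u} → Displacement (⟨ X ⟩at b₀) u → Span (Member ⊤ generator) u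
    displacement-span {u} (γ , (w , γ≈) , z , eq) = span-resp
      (λ s → trans (eq s) (+-cong (trans (act-cong γ≈ z s) (sym (act-base _ s))) (-‿cong (sym (act-base z s)))))
      (walk-displacement w z)
      where
      act-base : ∀ z s → act (potential b₀) z s ≈ z s
      act-base z s = trans (act-cong (Γ.reflexive (proj₂ (proj₂ (path b₀)) ≡.refl)) z s) (act-ε z s)

  module Family {X : Subset m} {c} (C : Components X c) (ds : Fin c → ℕ) (d : ∀ i → Fin (ds i) → Vector) where
    open Components C

    base-distinct : ∀ i j → i ≢ j → base i ≢ base j
    base-distinct i j ne eq = disjoint i j ne (base i) (base∈ i) (≡.subst (_∈ V (comp j)) (≡.sym eq) (base∈ j))

    home : ∀ {v} → v ∈ V X → ∃[ i ] (v ∈ V (comp i))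
    home v∈ with ∈V⁻ v∈
    ... | e , e∈ , end = let i , e∈i = cover e e∈ in i , ∈V⁺ (e , e∈i , end)

    opaque
      V∖bases : Subset n
      V∖bases = avoid c base (V X)

      ∣V∖bases∣ : ∣ V∖bases ∣ ℕ.+ c ≡ ∣ V X ∣
      ∣V∖bases∣ = ∣avoid∣ c base (λ i → V-mono (sub i) (base∈ i)) base-distinct

      ∈V∖bases : ∀ {v} → v ∈ V X → (∀ i → base i ≢ v) → v ∈ V∖bases
      ∈V∖bases = ∈-avoid⁺ c base

      V∖bases-home : ∀ {v} → v ∈ V∖bases → ∃[ i ] (v ∈ V (comp i))
      V∖bases-home v∈ = home (proj₁ (∈-avoid⁻ c base v∈))

      V∖bases≢base : ∀ {v} → v ∈ V∖bases → ∀ i → base i ≢ v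
      V∖bases≢base v∈ = proj₂ (∈-avoid⁻ c base v∈)

    vertex : Fin ∣ V∖bases ∣ → Fin n
    vertex = enumerate V∖bases

    opaque
      vertex-component : Fin ∣ V∖bases ∣ → Fin c
      vertex-component q = proj₁ (V∖bases-home (enumerate-∈ V∖bases q))

      vertex∈ : ∀ q → vertex q ∈ V (comp (vertex-component q))
      vertex∈ q = proj₂ (V∖bases-home (enumerate-∈ V∖bases q))

      vertex≢base : ∀ q i → base i ≢ vertex q
      vertex≢base q = V∖bases≢base (enumerate-∈ V∖bases q)

      vertex-path : ∀ q → Walk (comp (vertex-component q)) (base (vertex-component q)) (vertex q)
      vertex-path q = connected _ _ _ (base∈ _) (vertex∈ q)

    vertex-vector : Fin ∣ V∖bases ∣ → Fin D → Fin n × Fin D → Carrier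
    vertex-vector q T = transport (base (vertex-component q)) (vertex q) (gain (vertex-path q)) (basis T)

    base-vector : (i : Fin c) → Fin (ds i) → Fin n × Fin D → Carrier
    base-vector i l = at (base i) (d i l)

    size : ℕ
    size = ∣ V∖bases ∣ ℕ.* D ℕ.+ sumℕ c ds

    size≡ : size ≡ (D ℕ.* ∣ V X ∣ ℕ.∸ D ℕ.* c) ℕ.+ sumℕ c ds
    size≡ = ≡.cong (ℕ._+ sumℕ c ds) (≡.sym (scaled-difference D ∣ V∖bases ∣ c ∣V∖bases∣))

    open Blocks ∣ V∖bases ∣ D c ds public

    family : Fin size → Fin n × Fin D → Carrier
    family = block vertex-vector base-vector

    family-index₁ : ∀ q T → family (index₁ q T) ≡ vertex-vector q T
    family-index₁ = block-index₁ vertex-vector base-vector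

    family-index₂ : ∀ i l → family (index₂ i l) ≡ base-vector i l
    family-index₂ = block-index₂ vertex-vector base-vector

    vertex-at-vertex : ∀ q T q′ T′ → vertex-vector q T (vertex q′ , T′) ≈ I q q′ * I T T′
    vertex-at-vertex q T q′ T′ = begin
      I (vertex q) (vertex q′) * I T T′ - I (base i) (vertex q′) * act γ (basis T) T′
        ≈⟨ +-cong (*-congʳ (same-vertex q q′)) (-‿cong (trans (*-congʳ (I-off (vertex≢base q′ i))) (zeroˡ _))) ⟩
      I q q′ * I T T′ - 0#
        ≈⟨ trans (+-congˡ -0#≈0#) (+-identityʳ _) ⟩
      I q q′ * I T T′ ∎
      where
      open import Algebra.Properties.Ring ring using (-0#≈0#)
      i = vertex-component q
      γ = gain (vertex-path q)
      same-vertex : ∀ q q′ → I (vertex q) (vertex q′) ≈ I q q′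
      same-vertex q q′ with q ≟ q′
      ... | yes ≡.refl = I-diagonal (vertex q)
      ... | no ne      = I-off (ne ∘ enumerate-injective V∖bases)

    base-at-vertex : ∀ i l q T → base-vector i l (vertex q , T) ≈ 0#
    base-at-vertex i l q T = trans (*-congʳ (I-off (vertex≢base q i))) (zeroˡ _)

    base-at-base : ∀ i l s → base-vector i l (base i , s) ≈ d i l s
    base-at-base i l s = trans (*-congʳ (I-diagonal (base i))) (*-identityˡ _)

    base-at-other : ∀ i l {i′} s → i ≢ i′ → base-vector i l (base i′ , s) ≈ 0#
    base-at-other i l s ne = trans (*-congʳ (I-off (base-distinct i _ ne))) (zeroˡ _)

    family-edge-span : (∀ i l → Displacement (⟨ comp i ⟩at (base i)) (d i l)) → ∀ j → Span (EdgeVector X) (family j)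
    family-edge-span disp = block-elim vertex-vector base-vector (Span (EdgeVector X))
      (λ q T → edge-mono (sub _) (walk-span (vertex-path q) (basis T)))
      λ i l → let γ , (w , γ≈) , z , eq = disp i l in span-resp
        (λ j → trans (linear-cong (at-linear (base i)) eq j) (sym (trans (-‿cong (trans (transport-cong _ _ (Γ.sym γ≈) z j) (transport-loop _ γ z j))) (-‿involutive _))))
        (span-neg (edge-mono (sub i) (walk-span w z)))
      where open import Algebra.Properties.Ring ring using (-‿involutive)

    module _ (spanned : ∀ i u → Displacement (⟨ comp i ⟩at (base i)) u → InSpanFam (d i) u) where

      member₁ : ∀ q T → Span (Member ⊤ family) (vertex-vector q T)
      member₁ q T = ≡.subst (Span (Member ⊤ family)) (family-index₁ q T) (span-member family ∈⊤)

      member₂ : ∀ i l → Span (Member ⊤ family) (base-vector i l)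
      member₂ i l = ≡.subst (Span (Member ⊤ family)) (family-index₂ i l) (span-member family ∈⊤)

      closed-walk-span : ∀ i (w : Walk (comp i) (base i) (base i)) z → Span (Member ⊤ family) (transport (base i) (base i) (gain w) z)
      closed-walk-span i w z = span-resp (transport-loop (base i) (gain w) z) (span-neg
        (span-linear (at-linear (base i)) {S = Member ⊤ (d i)}
          (λ { (l , _ , eq) → span-resp (linear-cong (at-linear (base i)) eq) (member₂ i l) })
          (let co , eq = spanned i _ (gain w , (w , Γ.refl) , z , λ _ → refl) in
            span-combination (λ e e∉ → ⊥-elim (e∉ ∈⊤)) eq)))

      same-component : ∀ {i i′ v} → v ∈ V (comp i) → v ∈ V (comp i′) → i ≡ i′
      same-component {i} {i′} v∈ v∈′ with i ≟ i′
      ... | yes eq = eq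
      ... | no ne  = ⊥-elim (disjoint i i′ ne _ v∈ v∈′)

      -- A base lying in the component `i` is `base i`, and then the walk is closed. For any other
      -- vertex, `w` differs from the chosen walk `g` by the closed walk `w ⊕ reverse g`.
      path-span : ∀ i {v} → v ∈ V (comp i) → (w : Walk (comp i) (base i) v) → ∀ z → Span (Member ⊤ family) (transport (base i) v (gain w) z)
      path-span i {v} v∈ w z with Finₚ.any? (λ i′ → base i′ ≟ v)
      ... | yes (i′ , ≡.refl) with ≡.refl ← same-component {i} {i′} v∈ (base∈ i′) = closed-walk-span i w z
      ... | no  notBase with q , ≡.refl ← enumerate-surjective V∖bases (∈V∖bases (V-mono (sub i) v∈) (λ i′ eq → notBase (i′ , eq))) =
        through (same-component (vertex∈ q) v∈) (vertex-path q) vertex-span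
        where
        vertex-span : ∀ z → Span (Member ⊤ family) (transport (base (vertex-component q)) (vertex q) (gain (vertex-path q)) z)
        vertex-span z = span-linear (transport-linear _ _ _)
          (λ { (T , _ , eq) → span-resp (linear-cong (transport-linear _ _ _) eq) (member₁ q T) }) (basis-spans z)
        -- The index `i′` is generalised, with its walk and the span hypothesis, so that the
        -- equality of components can be matched with `refl`.
        through : ∀ {i′} → i′ ≡ i → (g : Walk (comp i′) (base i′) (vertex q)) →
                  (∀ z → Span (Member ⊤ family) (transport (base i′) (vertex q) (gain g) z)) →
                  Span (Member ⊤ family) (transport (base i) (vertex q) (gain w) z)
        through ≡.refl g sp = span-resp
          (λ j → trans (transport-cong _ _ factor z j) (transport-∙ (base i) (base i) (vertex q) (gain (w ⊕ reverse g)) (gain g) z j))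
          (span-+ (sp z) (closed-walk-span i (w ⊕ reverse g) (act (gain g) z)))
          where
          factor : gain w Γ.≈ gain (w ⊕ reverse g) Γ.∙ gain g
          factor = Γ.sym (Γ.trans (Γ.∙-congʳ (Γ.trans (gain-⊕ w (reverse g)) (Γ.∙-congˡ (gain-reverse g))))
            (Γ.trans (Γ.assoc _ _ _) (Γ.trans (Γ.∙-congˡ (Γ.inverseˡ _)) (Γ.identityʳ _))))

      -- An edge is the difference of two walks from the base of its component: one that ends with
      -- the edge and one that stops before it.
      edge-family-span : ∀ {e} → e ∈ X → ∀ z → Span (Member ⊤ family) (edge-vector e z)
      edge-family-span {e} e∈ z with i , e∈i ← cover e e∈ =
        let w = connected i (base i) (src e) (base∈ i) (src∈V e∈i) in span-resp
          (λ j → trans (solve 2 (λ x y → x := (x :+ y) :- y) refl _ (transport (base i) (src e) (gain w) (act (ψ e) z) j))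
            (+-congʳ (trans (sym (transport-∙ (base i) (src e) (tgt e) (gain w) (ψ e) z j))
              (transport-cong _ _ (Γ.trans (Γ.∙-congˡ (Γ.sym (Γ.identityʳ _))) (Γ.sym (gain-⊕ w (fwd e e∈i [])))) z j))))
          (span-difference (path-span i (tgt∈V e∈i) (w ⊕ fwd e e∈i []) z) (path-span i (src∈V e∈i) w (act (ψ e) z)))

-- Independence over the extension field and existence of the dimensions

module GainDimension {a b c₁ ℓ₁ c₂ ℓ₂} (Γ : Group a b) (F : Field c₁ ℓ₁) (K : Field c₂ ℓ₂)
                     (ι : Field.Carrier F → Field.Carrier K) (embedding : IsFieldEmbedding F K ι)
                     (D : ℕ) (R : Group.Carrier Γ → LinAlg.Mat (Field.commutativeRing F) D D) (representation : IsRepresentation Γ F D R)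
                     {n m : ℕ} (src tgt : Fin m → Fin n) (ψ : Fin m → Group.Carrier Γ) where
  private
    module F = Field F
    module K = Field K
  open GainGraph Γ src tgt ψ
  open GainSpace Γ F D R representation src tgt ψ
  open Extension F K ι embedding
  open RingMorphisms F.rawRing K.rawRing using (module IsRingHomomorphism)
  open IsRingHomomorphism embedding
  private
    module LF where
      open LinAlg F.commutativeRing public
      open LinearAlgebra F public
      open FiniteSums F.commutativeRing public
    module LK where
      open LinAlg K.commutativeRing public
      open LinearAlgebra K public
      open FiniteSums K.commutativeRing public
      open BlockSums K.commutativeRing public
  open import Relation.Binary.Reasoning.Setoid K.setoid

  module _ {X : Subset m} {c} (C : Components X c) (ds : Fin c → ℕ) (d : ∀ i → Fin (ds i) → Vector) where
    open Components C
    open Family C ds d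

    -- On the non-base vertices the vertex vectors form an identity matrix and the base vectors
    -- vanish, which isolates each vertex coefficient. With these gone, evaluation at `base i`
    -- leaves a relation among the vectors `d i` alone.
    family-independent : (∀ i → LK.Independent ⊤ (λ l s → ι (d i l s))) → LK.Independent ⊤ (λ j x → ι (family j x))
    family-independent independent co _ rel j = case index-cases j of λ where
        (inj₁ (q , T , ≡.refl)) → vertex-coefficient q T
        (inj₂ (i , l , ≡.refl)) → independent i (λ l → co (index₂ i l)) (λ e e∉ → ⊥-elim (e∉ ∈⊤)) (base-relation i) l
      where
      vertex-coefficient : ∀ q T → co (index₁ q T) K.≈ K.0#
      vertex-coefficient q T = begin
        co (index₁ q T)
          ≈⟨ K.*-identityʳ _ ⟨
        co (index₁ q T) K.* K.1#
          ≈⟨ K.*-congˡ (K.trans (⟦⟧-cong (F.trans (F.reflexive (≡.cong-app (family-index₁ q T) _)) (F.trans (vertex-at-vertex q T q T)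
               (F.trans (F.*-cong (LF.I-diagonal q) (LF.I-diagonal T)) (F.*-identityˡ _))))) 1#-homo) ⟨
        co (index₁ q T) K.* ι (family (index₁ q T) (vertex q , T))
          ≈⟨ LK.sum-single size (λ j → co j K.* ι (family j (vertex q , T))) (index₁ q T) off ⟨
        LK.sumFin size (λ j → co j K.* ι (family j (vertex q , T)))
          ≈⟨ rel (vertex q , T) ⟩
        K.0# ∎
        where
        off : ∀ j → j ≢ index₁ q T → co j K.* ι (family j (vertex q , T)) K.≈ K.0#
        off j ne = K.trans (K.*-congˡ (K.trans (⟦⟧-cong (other (index-cases j))) 0#-homo)) (K.zeroʳ _)
          where
          other : (∃[ q ] ∃[ T ] index₁ q T ≡ j) ⊎ (∃[ i ] ∃[ l ] index₂ i l ≡ j) → family j (vertex q , T) F.≈ F.0#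
          other (inj₂ (i , l , ≡.refl)) = F.trans (F.reflexive (≡.cong-app (family-index₂ i l) _)) (base-at-vertex i l q T)
          other (inj₁ (q′ , T′ , ≡.refl)) = F.trans (F.reflexive (≡.cong-app (family-index₁ q′ T′) _)) (F.trans (vertex-at-vertex q′ T′ q T) (different (q′ ≟ q)))
            where
            different : Dec (q′ ≡ q) → LF.I q′ q F.* LF.I T′ T F.≈ F.0#
            different (no q≢)      = F.trans (F.*-congʳ (LF.I-off q≢)) (F.zeroˡ _)
            different (yes ≡.refl) = F.trans (F.*-congˡ (LF.I-off (λ { ≡.refl → ne ≡.refl }))) (F.zeroʳ _)

      base-relation : ∀ i s → LK.sumFin (ds i) (λ l → co (index₂ i l) K.* ι (d i l s)) K.≈ K.0#
      base-relation i s = begin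
        LK.sumFin (ds i) (λ l → co (index₂ i l) K.* ι (d i l s))
          ≈⟨ LK.sum-cong (ds i) (λ l → K.*-congˡ (⟦⟧-cong (F.trans (F.reflexive (≡.cong-app (family-index₂ i l) _)) (base-at-base i l s)))) ⟨
        LK.sumFin (ds i) (λ l → value (index₂ i l))
          ≈⟨ LK.sum-single c (λ i′ → LK.sumFin (ds i′) (λ l → value (index₂ i′ l))) i (λ i′ ne → LK.sum-zero (ds i′) (λ l →
               K.trans (K.*-congˡ (K.trans (⟦⟧-cong (F.trans (F.reflexive (≡.cong-app (family-index₂ i′ l) _)) (base-at-other i′ l s ne))) 0#-homo)) (K.zeroʳ _))) ⟨
        LK.sumFin c (λ i′ → LK.sumFin (ds i′) (λ l → value (index₂ i′ l)))
          ≈⟨ LK.sum-joinΣ c ds (λ b → value ((∣ V∖bases ∣ ℕ.* D) ↑ʳ b)) ⟨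
        LK.sumFin (sumℕ c ds) (λ b → value ((∣ V∖bases ∣ ℕ.* D) ↑ʳ b))
          ≈⟨ K.+-identityˡ _ ⟨
        K.0# K.+ LK.sumFin (sumℕ c ds) (λ b → value ((∣ V∖bases ∣ ℕ.* D) ↑ʳ b))
          ≈⟨ K.+-congʳ (LK.sum-zero (∣ V∖bases ∣ ℕ.* D) (λ a → K.trans (K.*-congʳ (K.trans
               (K.reflexive (≡.cong (λ a → co (a ↑ˡ sumℕ c ds)) (≡.sym (Finₚ.combine-remQuot {∣ V∖bases ∣} D a)))) (vertex-coefficient _ _))) (K.zeroˡ _))) ⟨
        LK.sumFin (∣ V∖bases ∣ ℕ.* D) (λ a → value (a ↑ˡ sumℕ c ds)) K.+ LK.sumFin (sumℕ c ds) (λ b → value ((∣ V∖bases ∣ ℕ.* D) ↑ʳ b))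
          ≈⟨ LK.sum-splitAt (∣ V∖bases ∣ ℕ.* D) (sumℕ c ds) value ⟨
        LK.sumFin size value
          ≈⟨ rel (base i , s) ⟩
        K.0# ∎
        where
        value : Fin size → K.Carrier
        value j = co j K.* ι (family j (base i , s))

  record DisplacementBasis {p} (Y : Pred (Group.Carrier Γ) p) : Set (a ⊔ b ⊔ c₁ ⊔ ℓ₁ ⊔ c₂ ⊔ ℓ₂ ⊔ p) where
    field
      dimension    : ℕ
      vector       : Fin dimension → Vector
      displaced    : ∀ l → Displacement Y (vector l)
      independentᴷ : LK.Independent ⊤ (λ l s → ι (vector l s))
      hasDim       : LF.HasDim (Displacement Y) dimension

  -- A basis chosen among the finitely many generators has the dimension of all displacements,
  -- because `displacement-span` brings every closed walk back to those generators.
  displacement-basis : ∀ {X} → Connected X → ∀ b₀ → b₀ ∈ V X → ¬ ¬ DisplacementBasis (⟨ X ⟩at b₀)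
  displacement-basis {X} connected b₀ b₀∈ k = basis-exists generator λ B → let open Basis B hiding (generator) in
    let displaced = λ l → ≡.subst (Displacement (⟨ X ⟩at b₀)) (≡.sym (proj₂ (Basis.generator B l))) (generator-displacement _) in k (record
    { dimension    = size
    ; vector       = vector
    ; displaced    = displaced
    ; independentᴷ = independentᴷ
    ; hasDim       = vector ,
        (λ l → (F.1# , vector l) ∷ [] , displaced l ∷ [] , λ s → F.sym (F.trans (F.+-identityʳ _) (F.*-identityˡ _))) ,
        (λ co rel → independent co (λ e e∉ → ⊥-elim (e∉ ∈⊤)) rel) ,
        λ u disp → let co , _ , eq = LF.coefficients (LF.span-trans (λ { (e , _ , eq) → LF.span-resp eq (spans e) }) (displacement-span disp)) in co , eq
    })
    where open Fundamental connected b₀ b₀∈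

-- The generic exterior representation

open import Data.Nat using (_≤_; _*_)

module ExteriorGains {a b c₁ ℓ₁ c₂ ℓ₂} (Γ : Group a b) (F : Field c₁ ℓ₁) (K : Field c₂ ℓ₂)
                     (ι : Field.Carrier F → Field.Carrier K) (embedding : IsFieldEmbedding F K ι)
                     (d : ℕ) (ρ : Group.Carrier Γ → LinAlg.Mat (Field.commutativeRing F) d d) (representation : IsRepresentation Γ F d ρ)
                     (k : ℕ) (n m : ℕ) (src tgt : Fin m → Fin n) (ψ : Fin m → Group.Carrier Γ)
                     (t : Fin (m * k * d) → Field.Carrier K) (generic : AlgIndep F K ι t) where
  private
    module Γ = Group Γ
    module F = Field F
    module LF where
      open LinAlg F.commutativeRing public
      open LinearAlgebra F public
      open FiniteSums F.commutativeRing public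
      open Determinants F.commutativeRing public
  open Field K hiding (zero; _*_)
  open Field K using () renaming (_*_ to _·_)
  open LinAlg commutativeRing hiding (_·_)
  open LinearAlgebra K
  open FiniteSums commutativeRing
  open Determinants commutativeRing using (wedge-·v; wedge-basis; wedge-cong)
  open IntegerCoefficients commutativeRing using (solve; _:+_; _:*_; :-_; _:-_; _:=_; con)
  open RingMorphisms F.rawRing rawRing using (module IsRingHomomorphism)
  open IsRingHomomorphism embedding
  open Extension F K ι embedding using (ι-det; ι--; ι-I)
  open import Relation.Binary.Reasoning.Setoid setoid
  open import Algebra.Properties.Ring ring using (-0#≈0#)

  R : Γ.Carrier → LF.Mat (Dim k d) (Dim k d)
  R γ = LF.compound k (ρ γ)

  compound-representation : IsRepresentation Γ F (Dim k d) R
  compound-representation = record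
    { cong = λ eq → LF.compound-cong k (R.cong eq)
    ; hom  = λ x y S T → F.trans (LF.compound-cong k (R.hom x y) S T) (LF.compound-· k (ρ x) (ρ y) S T)
    ; unit = λ S T → F.trans (LF.compound-cong k R.unit S T) (LF.compound-I k S T)
    }
    where module R = IsRepresentation representation

  open Setting Γ F K ι d ρ k src tgt ψ
  open GainWalks Γ src tgt ψ
  open GainSpace Γ F D R compound-representation src tgt ψ
  open GainDimension Γ F K ι embedding D R compound-representation src tgt ψ
  open Polynomials F K ι embedding (m * k * d)
  open AtGenericPoint t generic

  position : Fin m → Fin k → Fin d → Fin (m * k * d)
  position e i j = combine (combine e i) j

  points : Point → Points
  points τ e i j = τ (position e i j)

  assignment : Points → Point
  assignment p x = let ei , j = remQuot {m * k} d x ; e , i = remQuot {m} k ei in p e i j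

  points-assignment : ∀ (p : Points) e i j → points (assignment p) e i j ≡ p e i j
  points-assignment p e i j = ≡.trans
    (≡.cong (λ x → p (proj₁ (remQuot {m} k (proj₁ x))) (proj₂ (remQuot {m} k (proj₁ x))) (proj₂ x)) (Finₚ.remQuot-combine (combine e i) j))
    (≡.cong (λ x → p (proj₁ x) (proj₂ x) j) (Finₚ.remQuot-combine e i))

  Coordinate : Set
  Coordinate = Fin (n * D)

  -- Eliminators act on vectors indexed by a single `Fin`, while edge vectors have a vertex and an
  -- exterior coordinate.
  flatten : ∀ {c} {C : Set c} → (Fin n × Fin D → C) → Coordinate → C
  flatten x i = x (remQuot D i)

  edge-basis : Fin m → Fin D → Coordinate → Carrier
  edge-basis e T = flatten (ι ∘ edge-vector e (basis T))

  ⋀ : (Fin k → Fin d → Carrier) → Fin D → Carrier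
  ⋀ = wedge {k} {d}

  -- The vector x̂ of an edge up to the sign with which loops enter.
  edge-point : Points → Fin m → Coordinate → Carrier
  edge-point p e i = sumFin D (λ T → ⋀ (p e) T · edge-basis e T i)

  loop-sign : Fin m → Carrier
  loop-sign e with src e ≟ tgt e
  ... | yes _ = - 1#
  ... | no _  = 1#

  loop-sign² : ∀ e → loop-sign e · loop-sign e ≈ 1#
  loop-sign² e with src e ≟ tgt e
  ... | yes _ = solve 0 (:- con (1 , 0) :* :- con (1 , 0) := con (1 , 0)) refl
  ... | no _  = *-identityˡ _

  -- The edge vectors of the basis of the exterior power are weighted with the Plücker coordinates
  -- of the points; at the tail, `wedge-·v` turns the compound matrix applied to these coordinates
  -- into the wedge of the images.
  edge-point-expand : ∀ (p : Points) e v S → sumFin D (λ T → ⋀ (p e) T · ι (edge-vector e (basis T) (v , S))) ≈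
                      I (tgt e) v · ⋀ (p e) S - I (src e) v · ⋀ (λ i → ρK e ·v p e i) S
  edge-point-expand p e v S = begin
    sumFin D (λ T → w T · ι (edge-vector e (basis T) (v , S)))
      ≈⟨ sum-cong D (λ T → trans (*-congˡ (coordinate T))
           (solve 5 (λ w i δ j r → w :* (i :* δ :- j :* r) := i :* (w :* δ) :+ (:- j) :* (r :* w)) refl (w T) (I (tgt e) v) (I T S) (I (src e) v) (ι (R (ψ e) S T)))) ⟩
    sumFin D (λ T → I (tgt e) v · (w T · I T S) + - I (src e) v · (ι (R (ψ e) S T) · w T))
      ≈⟨ sum-+ D _ _ ⟩
    sumFin D (λ T → I (tgt e) v · (w T · I T S)) + sumFin D (λ T → - I (src e) v · (ι (R (ψ e) S T) · w T))
      ≈⟨ +-cong (trans (sym (sum-*ˡ D _ _)) (*-congˡ (sum-Iʳ D w S))) (sym (sum-*ˡ D _ _)) ⟩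
    I (tgt e) v · w S + - I (src e) v · sumFin D (λ T → ι (R (ψ e) S T) · w T)
      ≈⟨ +-congˡ (trans (sym (-‿distribˡ-* _ _)) (-‿cong (*-congˡ (trans (sum-cong D (λ T → *-congʳ (ι-det k _))) (sym (wedge-·v k (ρK e) (p e) S)))))) ⟩
    I (tgt e) v · w S - I (src e) v · ⋀ (λ i → ρK e ·v p e i) S ∎
    where
    open import Algebra.Properties.Ring ring using (-‿distribˡ-*)
    w = ⋀ (p e)
    coordinate : ∀ T → ι (edge-vector e (basis T) (v , S)) ≈ I (tgt e) v · I T S - I (src e) v · ι (R (ψ e) S T)
    coordinate T = trans (ι-- _ _) (+-cong (trans (*-homo _ _) (*-cong (ι-I (tgt e) v) (ι-I T S)))
      (-‿cong (trans (*-homo _ _) (*-cong (ι-I (src e) v) (⟦⟧-cong (F.trans (LF.sum-cong D (λ l → F.*-congˡ (I-sym T l))) (LF.sum-Iʳ D (R (ψ e) S) T)))))))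
      where
      I-sym : ∀ T l → LF.I T l F.≈ LF.I l T
      I-sym T l with T ≟ l
      ... | yes ≡.refl = F.sym (LF.I-diagonal T)
      ... | no ne      = F.sym (LF.I-off (ne ∘ ≡.sym))

  indicator : ∀ {n} (u v : Fin n) x → (if ⌊ v ≟ u ⌋ then x else 0#) ≈ I u v · x
  indicator u v x with v ≟ u
  ... | yes ≡.refl = sym (trans (*-congʳ (I-diagonal u)) (*-identityˡ x))
  ... | no ne      = sym (trans (*-congʳ (I-off (ne ∘ ≡.sym))) (zeroˡ x))

  xhat≈ : ∀ (p : Points) e v S → xhat p e v S ≈ loop-sign e · sumFin D (λ T → ⋀ (p e) T · ι (edge-vector e (basis T) (v , S)))
  xhat≈ p e v S = trans signed (*-congˡ (sym (edge-point-expand p e v S)))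
    where
    x y : Carrier
    x = ⋀ (λ i → ρK e ·v p e i) S
    y = ⋀ (p e) S
    signed : xhat p e v S ≈ loop-sign e · (I (tgt e) v · y - I (src e) v · x)
    signed with src e ≟ tgt e
    ... | yes eq = begin
      (if ⌊ v ≟ src e ⌋ then x - y else 0#)
        ≈⟨ indicator (src e) v (x - y) ⟩
      I (src e) v · (x - y)
        ≈⟨ solve 3 (λ i x y → i :* (x :- y) := :- con (1 , 0) :* (i :* y :- i :* x)) refl (I (src e) v) x y ⟩
      - 1# · (I (src e) v · y - I (src e) v · x)
        ≡⟨ ≡.cong (λ u → - 1# · (I u v · y - I (src e) v · x)) eq ⟩
      - 1# · (I (tgt e) v · y - I (src e) v · x) ∎
    ... | no _ = begin
      (if ⌊ v ≟ src e ⌋ then - x else 0#) + (if ⌊ v ≟ tgt e ⌋ then y else 0#)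
        ≈⟨ +-cong (indicator (src e) v (- x)) (indicator (tgt e) v y) ⟩
      I (src e) v · - x + I (tgt e) v · y
        ≈⟨ solve 4 (λ i j x y → i :* (:- x) :+ j :* y := con (1 , 0) :* (j :* y :- i :* x)) refl (I (src e) v) (I (tgt e) v) x y ⟩
      1# · (I (tgt e) v · y - I (src e) v · x) ∎

  xhat-flat : ∀ p e i → xhat p e (proj₁ (remQuot {n} D i)) (proj₂ (remQuot {n} D i)) ≈ loop-sign e · edge-point p e i
  xhat-flat p e i = xhat≈ p e _ _

  signed-zero : ∀ e {x} → loop-sign e · x ≈ 0# → x ≈ 0#
  signed-zero e {x} eq = begin
    x                                     ≈⟨ *-identityˡ x ⟨
    1# · x                                ≈⟨ *-congʳ (loop-sign² e) ⟨
    loop-sign e · loop-sign e · x         ≈⟨ *-assoc _ _ _ ⟩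
    loop-sign e · (loop-sign e · x)       ≈⟨ *-congˡ eq ⟩
    loop-sign e · 0#                      ≈⟨ zeroʳ _ ⟩
    0#                                    ∎

  signed-relation : ∀ p (co : Fin m → Carrier) i →
    sumFin m (λ e → co e · xhat p e (proj₁ (remQuot {n} D i)) (proj₂ (remQuot {n} D i))) ≈ sumFin m (λ e → loop-sign e · co e · edge-point p e i)
  signed-relation p co i = sum-cong m (λ e → trans (*-congˡ (xhat-flat p e i))
    (solve 3 (λ c s x → c :* (s :* x) := s :* c :* x) refl (co e) (loop-sign e) (edge-point p e i)))

  indepOn⇒independent : ∀ {p Fs} → IndepOn p Fs → Independent Fs (edge-point p)
  indepOn⇒independent {p} {Fs} indep co supp rel e = signed-zero e (indep (λ e → loop-sign e · co e)
    (λ e e∉ → trans (*-congˡ (supp e e∉)) (zeroʳ _))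
    (λ v S → ≡.subst (λ x → sumFin m (λ e → loop-sign e · co e · xhat p e (proj₁ x) (proj₂ x)) ≈ 0#) (Finₚ.remQuot-combine v S) (begin
      _ ≈⟨ signed-relation p (λ e → loop-sign e · co e) (combine v S) ⟩
      sumFin m (λ e → loop-sign e · (loop-sign e · co e) · edge-point p e (combine v S))
        ≈⟨ sum-cong m (λ e → *-congʳ (trans (sym (*-assoc _ _ _)) (trans (*-congʳ (loop-sign² e)) (*-identityˡ _)))) ⟩
      sumFin m (λ e → co e · edge-point p e (combine v S))
        ≈⟨ rel (combine v S) ⟩
      0# ∎)) e)

  independent⇒indepOn : ∀ {p Fs} → Independent Fs (edge-point p) → IndepOn p Fs
  independent⇒indepOn {p} indep co supp rel e = signed-zero e (indep (λ e → loop-sign e · co e)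
    (λ e e∉ → trans (*-congˡ (supp e e∉)) (zeroʳ _))
    (λ i → trans (sym (signed-relation p co i)) (rel _ _)) e)

  edge-point-basis : ∀ {p : Points} {e T} → (∀ i j → p e i j ≈ I j (basisIdx {k} {d} T i)) → ∀ s → edge-point p e s ≈ edge-basis e T s
  edge-point-basis {p} {e} {T} eq s = trans
    (sum-cong D (λ T′ → trans (*-congʳ (trans (wedge-cong eq T′) (wedge-basis {k} {d} T′ T))) (*-comm _ _)))
    (sum-Iʳ D (λ T′ → edge-basis e T′ s) T)

  edge-point-cong : ∀ {p q : Points} {e} → (∀ i j → p e i j ≈ q e i j) → ∀ s → edge-point p e s ≈ edge-point q e s
  edge-point-cong eq s = sum-cong D (λ T → *-congʳ (wedge-cong eq T))

  edge-point-polynomial : ∀ e s → Polynomial (λ τ → edge-point (points τ) e s)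
  edge-point-polynomial e s = poly-∑ D (λ T → poly-* (poly-det k (λ a b → poly-var (position e b (basisIdx T a)))) (poly-ι _))

  edge-point-span : ∀ {q} {S : Pred (Coordinate → Carrier) q} p e → (∀ T → Span S (edge-basis e T)) → Span S (edge-point p e)
  edge-point-span p e h = span-∑ D (λ T s → ⋀ (p e) T · edge-basis e T s) (λ T → span-* (⋀ (p e) T) (h T))

  span-flatten-ι : ∀ {p q} {S : Pred (Fin n × Fin D → F.Carrier) p} {T : Pred (Coordinate → Carrier) q} {v} →
                   (∀ {u} → S u → Span T (flatten (ι ∘ u))) → LF.Span S v → Span T (flatten (ι ∘ v))
  span-flatten-ι h (LF.null eq)        = null (λ s → trans (⟦⟧-cong (eq _)) 0#-homo)
  span-flatten-ι h (LF.term r s sp eq) = span-axpy (ι r) (h s) (span-flatten-ι h sp)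
    (λ s → trans (⟦⟧-cong (eq _)) (trans (+-homo _ _) (+-congʳ (*-homo _ _))))

  edge-vector-span : ∀ {q} {S : Pred (Coordinate → Carrier) q} {e} → (∀ T → Span S (edge-basis e T)) →
                     ∀ z → Span S (flatten (ι ∘ edge-vector e z))
  edge-vector-span {e = e} h z = span-flatten-ι
    (λ { (T , _ , eq) → span-resp (λ s → ⟦⟧-cong (eq (remQuot {n} D s))) (h T) })
    (span-linear linear {T = LF.Member ⊤ (λ T → edge-vector e (basis T))}
      (λ { (T , T∈ , eq) → LF.span-gen (T , T∈ , linear-cong linear eq) }) (basis-spans z))
    where linear = transport-linear (src e) (tgt e) (ψ e)

  -- Subtracting the relation, divided by `co e`, from the unit vector at `e` gives coefficients
  -- that vanish at `e` and still sum to `x e`.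
  own-span : ∀ {N M} {Y : Subset N} {x : Fin N → Fin M → Carrier} co → SupportedOn Y co → Relation x co →
             ∀ e → ¬ (co e ≈ 0#) → Span (Member (Y ∖ e) x) (x e)
  own-span {N} {M} {Y} {x} co supp rel e co≉0 with r , cr≈1 ← inverse (co e) co≉0 = span-combination {co = λ f → I e f - r · co f} off (λ j → begin
    x e j
      ≈⟨ sum-Iˡ N (λ f → x f j) e ⟨
    sumFin N (λ f → I e f · x f j)
      ≈⟨ trans (+-congˡ (trans (*-congˡ (rel j)) (zeroʳ (- r)))) (+-identityʳ _) ⟨
    sumFin N (λ f → I e f · x f j) + - r · sumFin N (λ f → co f · x f j)
      ≈⟨ +-congˡ (sum-*ˡ N (- r) (λ f → co f · x f j)) ⟩
    sumFin N (λ f → I e f · x f j) + sumFin N (λ f → - r · (co f · x f j))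
      ≈⟨ sum-+ N _ _ ⟨
    sumFin N (λ f → I e f · x f j + - r · (co f · x f j))
      ≈⟨ sum-cong N (λ f → solve 4 (λ i r c x → i :* x :+ (:- r) :* (c :* x) := (i :- r :* c) :* x) refl (I e f) r (co f) (x f j)) ⟩
    sumFin N (λ f → (I e f - r · co f) · x f j) ∎)
    where
    off : SupportedOn (Y ∖ e) (λ f → I e f - r · co f)
    off f f∉ with e ≟ f
    ... | yes ≡.refl = trans (+-congˡ (-‿cong (trans (*-comm _ _) cr≈1))) (-‿inverseʳ _)
    ... | no ne      = trans (+-identityˡ _) (trans (-‿cong (trans (*-congˡ (supp f (λ f∈ → f∉ (x∈p∧x≢y⇒x∈p-y f∈ (ne ∘ ≡.sym))))) (zeroʳ r))) -0#≈0#)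

  -- A generic point of the edge space of e lies in a subspace defined over the other coordinates only
  -- if the whole edge space does: specialise the points of e to basis vectors.
  specialise : ∀ {Y e} → e ∉ Y → Span (Member Y (edge-point (points t))) (edge-point (points t) e) →
               ∀ T → ¬ ¬ Span (Member Y (edge-point (points t))) (edge-basis e T)
  specialise {Y} {e} e∉Y sp T k′ = Elimination.eliminator-exists (value-subring pair) Y (edge-point (points t)) entries λ E →
    k′ (span-resp (λ s → sym (edge-point-basis {points (assignment special)} {e} {T} at-e s)) (Eliminator.kernel E (edge-point (points (assignment special)) e) (λ s → vanishes E s)))
    where
    special : Points
    special f with f ≟ e
    ... | yes _ = λ i j → I j (basisIdx {k} {d} T i)
    ... | no _  = points t f
    -- The two points differ only in the coordinates of `e`, so the vectors of edges in `Y` have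
    -- equal values at both, and so do the entries of any eliminator built from them.
    pair : Bool → Point
    pair true  = t
    pair false = assignment special
    at-e : ∀ i j → points (assignment special) e i j ≈ I j (basisIdx {k} {d} T i)
    at-e i j = trans (reflexive (points-assignment special e i j)) (special-e i j)
      where
      special-e : ∀ i j → special e i j ≈ I j (basisIdx {k} {d} T i)
      special-e i j with e ≟ e
      ... | yes _ = refl
      ... | no ne = ⊥-elim (ne ≡.refl)
    away : ∀ {f} → f ≢ e → ∀ i j → points (assignment special) f i j ≈ points t f i j
    away {f} ne i j = trans (reflexive (points-assignment special f i j)) (special-f i j)
      where
      special-f : ∀ i j → special f i j ≈ points t f i j
      special-f i j with f ≟ e
      ... | yes eq = ⊥-elim (ne eq)
      ... | no _   = refl
    entries : ∀ f → f ∈ Y → ∀ s → Value pair (edge-point (points t) f s)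
    entries f f∈ s = _ , edge-point-polynomial f s , λ where
      true  → refl
      false → edge-point-cong {points (assignment special)} {points t} {f} (away (λ { ≡.refl → e∉Y f∈ })) s
    -- Each entry of `P` is replaced by its polynomial. The product with the vector of `e` is zero
    -- at `t`, hence at the special point, where the entries of `P` have kept their values.
    vanishes : (E : Eliminator (Value pair) Y (edge-point (points t))) → ∀ s →
               (Eliminator.P E ·v edge-point (points (assignment special)) e) s ≈ 0#
    vanishes E s = trans (sum-cong (n * D) (λ l → *-congʳ (sym (value l false)))) (vanish-everywhere
      (poly-∑ (n * D) (λ l → poly-* (proj₁ (proj₂ (Eliminator.entries E s l))) (edge-point-polynomial e l)))
      (trans (sum-cong (n * D) (λ l → *-congʳ (value l true))) (Eliminator.kills-span E sp s)) (assignment special))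
      where
      value : ∀ l i → proj₁ (Eliminator.entries E s l) (pair i) ≈ Eliminator.P E s l
      value l = proj₂ (proj₂ (Eliminator.entries E s l))

  x : Fin m → Coordinate → Carrier
  x = edge-point (points t)

  module _ {X : Subset m} {c} (C : Components X c) (ds : Fin c → ℕ) (δ : ∀ i → Fin (ds i) → Vector) where
    open Components C
    open Family C ds δ

    flat-family : Fin size → Coordinate → Carrier
    flat-family j = flatten (ι ∘ family j)

    flat-family-independent : (∀ i → Independent ⊤ (λ l s → ι (δ i l s))) → Independent ⊤ flat-family
    flat-family-independent ind co supp rel = family-independent C ds δ ind co supp (λ { (v , S) →
      ≡.subst (λ y → sumFin size (λ j → co j · ι (family j y)) ≈ 0#) (Finₚ.remQuot-combine v S) (rel (combine v S)) })

    flat-family-spans : (∀ i u → Displacement (⟨ comp i ⟩at (base i)) u → LF.InSpanFam (δ i) u) →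
                        ∀ {e} → e ∈ X → Span (Member ⊤ flat-family) (x e)
    flat-family-spans spanned {e} e∈ = edge-point-span (points t) e (λ T → span-flatten-ι
      (λ { (j , _ , eq) → span-gen (j , ∈⊤ , λ s → ⟦⟧-cong (eq (remQuot {n} D s))) })
      (edge-family-span spanned e∈ (basis T)))

    flat-family-spanned : ∀ {q} {S : Pred (Coordinate → Carrier) q} → (∀ i l → Displacement (⟨ comp i ⟩at (base i)) (δ i l)) →
                          (∀ {e} → e ∈ X → ∀ T → Span S (edge-basis e T)) → ∀ j → Span S (flat-family j)
    flat-family-spanned displaced h j = span-flatten-ι
      (λ { (e , e∈ , z , eq) → span-resp (λ s → ⟦⟧-cong (eq (remQuot {n} D s))) (edge-vector-span {e = e} (h e∈) z) })
      (family-edge-span displaced j)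

  Sparse : Subset m → Set _
  Sparse Fs = ∀ X → X ⊆ Fs → Nonempty X → ∀ r → fρ≡ X r → ∣ X ∣ ≤ r

  -- The bases that come with the value r of f yield r vectors spanning all points of X, and more
  -- than r points would be dependent. Comparison of natural numbers is decidable, so a relation
  -- under double negation is enough.
  independent⇒sparse : ∀ Fs → Independent Fs x → Sparse Fs
  independent⇒sparse Fs ind X X⊆Fs _ r (c , C , ds , dims , r≡) with ∣ X ∣ ℕ.≤? r
  ... | yes le = le
  ... | no gt = ⊥-elim (span-dependent ⊤ X (flat-family C ds δ) x
        (λ e e∈ → flat-family-spans C ds δ (λ i → proj₂ (proj₂ (proj₂ (dims i)))) e∈)
        (ℕₚ.<-≤-trans (ℕ.s≤s (ℕₚ.≤-reflexive (≡.trans (∣⊤∣≡n (Family.size C ds δ)) (≡.trans (Family.size≡ C ds δ) (≡.sym r≡))))) (ℕₚ.≰⇒> gt))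
        λ { (co , (supp , e , e∈ , co≉0) , rel) → co≉0 (ind co (λ f f∉ → supp f (f∉ ∘ X⊆Fs)) rel e) })
    where
    δ : ∀ i → Fin (ds i) → Vector
    δ i = proj₁ (dims i)

  -- The support X of a relation violates the count: by genericity every edge space of X is spanned by
  -- the remaining points of X, so ∣X∣ − 1 vectors span a space of dimension f(X).
  sparse⇒weakly-independent : ∀ Fs → Sparse Fs → WeaklyIndependent Fs x
  sparse⇒weakly-independent Fs sparse co supp rel e* co*≉0 = ¬¬-decidable m (λ e → co e ≈ 0#) λ dec → contradict dec
    where
    contradict : ¬ (∀ e → Dec (co e ≈ 0#))
    contradict dec = ¬¬-∀Fin m (λ e → ¬¬-∀Fin D (λ T → edge-space e T)) λ spaces →
        components-exist X λ { (c , C) →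
        ¬¬-∀Fin c (λ i → displacement-basis (Components.connected C i) (Components.base C i) (Components.base∈ C i)) λ B →
        dimension-count spaces C B }
      where
      X = select (λ e → ¬? (dec e))
      X⁻ : ∀ {e} → e ∈ X → ¬ (co e ≈ 0#)
      X⁻ = ∈-select⁻ (λ e → ¬? (dec e))
      e*∈ : e* ∈ X
      e*∈ = ∈-select⁺ (λ e → ¬? (dec e)) co*≉0
      X-supports : SupportedOn X co
      X-supports e e∉ with dec e
      ... | yes eq = eq
      ... | no neq = ⊥-elim (e∉ (∈-select⁺ (λ e → ¬? (dec e)) neq))
      X⊆Fs : X ⊆ Fs
      X⊆Fs {e} e∈ with e ∈? Fs
      ... | yes e∈Fs = e∈Fs
      ... | no e∉Fs  = ⊥-elim (X⁻ e∈ (supp e e∉Fs))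
      W = Member (X ∖ e*) x
      -- `specialise` leaves out the edge `e` under consideration, whereas `W` always leaves out
      -- `e*`. The relation puts the vector of `e*` into the span of `W`, so one span serves for all
      -- edges.
      points-in-W : ∀ {e f} → f ∈ X ∖ e → Span W (x f)
      points-in-W {e} {f} f∈ with f ≟ e*
      ... | yes ≡.refl = own-span co X-supports rel f co*≉0
      ... | no ne      = span-member x (x∈p∧x≢y⇒x∈p-y (p─q⊆p X _ f∈) ne)
      edge-space : ∀ e T → ¬ ¬ (e ∈ X → Span W (edge-basis e T))
      edge-space e T k′ with e ∈? X
      ... | no e∉  = k′ λ e∈ → ⊥-elim (e∉ e∈)
      ... | yes e∈ = specialise (x∉p-x X e) (own-span co X-supports rel e (X⁻ e∈)) T λ sp →
        k′ λ _ → span-trans (λ { (f , f∈ , eq) → span-resp eq (points-in-W f∈) }) sp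
      dimension-count : (∀ e T → e ∈ X → Span W (edge-basis e T)) → ∀ {c} (C : Components X c) →
                        ¬ (∀ i → DisplacementBasis (⟨ Components.comp C i ⟩at (Components.base C i)))
      -- The size of `X ∖ e*` is less than that of X, which by sparsity is at most f(X), the size of
      -- an independent family inside the span of `W`.
      dimension-count spaces {c} C B = span-dependent (X ∖ e*) ⊤ x (flat-family C ds δ)
          (λ j _ → flat-family-spanned C ds δ (λ i → DisplacementBasis.displaced (B i)) (λ e∈ T → spaces _ T e∈) j)
          (ℕₚ.<-≤-trans (x∈p⇒∣p-x∣<∣p∣ e*∈) (ℕₚ.≤-trans
            (sparse X X⊆Fs (e* , e*∈) _ (c , C , ds , (λ i → DisplacementBasis.hasDim (B i)) , ≡.refl))
            (ℕₚ.≤-reflexive (≡.sym (≡.trans (∣⊤∣≡n (Family.size C ds δ)) (Family.size≡ C ds δ))))))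
          λ { (co , (off , j , _ , co≉0) , rel) →
              co≉0 (flat-family-independent C ds δ (λ i → DisplacementBasis.independentᴷ (B i)) co off rel j) }
        where
        ds = λ i → DisplacementBasis.dimension (B i)
        δ = λ i → DisplacementBasis.vector (B i)

  -- The edge `e` together with 1 ≤ k ≤ d names a coordinate of its points, which is the variable
  -- whose powers `combinable` uses.
  sparse⇒independent : 1 ≤ k → k ≤ d → ∀ Fs → Sparse Fs → Independent Fs x
  sparse⇒independent 1≤k k≤d Fs sparse co supp rel e = proj₂ (Elimination.independent generic-subring
    (combinable (position e (fromℕ< 1≤k) (fromℕ< (ℕₚ.≤-trans 1≤k k≤d)))) Fs x
    (λ f _ s → _ , edge-point-polynomial f s , λ _ → refl) (sparse⇒weakly-independent Fs sparse)) co supp rel e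

theorem7p1 : ∀ {a b c₁ ℓ₁ c₂ ℓ₂}
    (Γ : Group a b) (F : Field c₁ ℓ₁) (K : Field c₂ ℓ₂)
    (ι : Field.Carrier F → Field.Carrier K) → IsFieldEmbedding F K ι →
    (d : ℕ) (ρ : Group.Carrier Γ → LinAlg.Mat (Field.commutativeRing F) d d) →
    IsRepresentation Γ F d ρ →
    (k : ℕ) → 1 ≤ k → k ≤ d →
    (n m : ℕ) (src tgt : Fin m → Fin n) (ψ : Fin m → Group.Carrier Γ) →
    (t : Fin (m * k * d) → Field.Carrier K) → AlgIndep F K ι t →
    ∃[ p ] (∀ (Fs : Subset m) →
    Setting.IndepOn Γ F K ι d ρ k src tgt ψ p Fs ⇔
    (∀ (X : Subset m) → X ⊆ Fs → Nonempty X →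
    ∀ r → Setting.fρ≡ Γ F K ι d ρ k src tgt ψ X r → ∣ X ∣ ≤ r))
theorem7p1 Γ F K ι embedding d ρ representation k 1≤k k≤d n m src tgt ψ t generic =
  points t , λ Fs → mk⇔
    (λ indep → independent⇒sparse Fs (indepOn⇒independent indep))
    (λ sparse → independent⇒indepOn (sparse⇒independent 1≤k k≤d Fs sparse))
  where open ExteriorGains Γ F K ι embedding d ρ representation k n m src tgt ψ t generic
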